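{- There is a constant $c$ such that for every binary string $x$ the complexity $\mathrm{C}(x\mid x*)$ differs by at most $c$ from the plain stopping time complexity of $x$.
   Context: A description mode is a set $D$ of triples $(p,x,y)$ of binary strings such that: (1) $D$ is computably enumerable; (2) for every $p$ and $x$ there is at most one $y$ such that $(p,x,y)\in D$; (3) if $(p,x,y)\in D$ and $x$ is a prefix of $x'$, then $(p,x',y)\in D$. For a description mode $D$ let $\mathrm{C}_D(y\mid x*)=\min\{|p| : (p,x,y)\in D\}$. There exists an optimal description mode, i.e., a $D$ such that $\mathrm{C}_D\le \mathrm{C}_{D'}+O(1)$ for every description mode $D'$; fix such a $D$ and write $\mathrm{C}(y\mid x*)$ for $\mathrm{C}_D(y\mid x*)$ (the plain monotone-conditional complexity of $y$ given $x$ as a prefix). In $\mathrm{C}(x\mid x*)$ the same string $x$ is used as object and as condition. Consider Turing machines $M$ with a one-directional read-only input tape with binary alphabet and a work tape (or several work tapes) with arbitrary alphabet. Initially the input head is to the left of the input, so it must move right before seeing the first input bit. For a binary string $x$ we say that $M$ stops at $x$ if $M$, started with $x$ on the input tape and empty work tape, reads all the bits of $x$ and stops without trying to read more bits. The plain stopping time complexity of $x$ is the minimal plain Kolmogorov complexity of (a standard binary encoding of) a machine $M$ of this type that stops at $x$; it is defined up to an $O(1)$ additive term. -}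

module Defs where

open import Data.Bool.Base using (Bool; true; false)
open import Data.Fin.Base using (Fin; zero; toℕ)
open import Data.List.Base using (List; []; _∷_; _++_; length; replicate; concatMap; allFin; map)
open import Data.List.Relation.Binary.Prefix.Heterogeneous using (Prefix)
open import Data.Maybe.Base using (Maybe; just; nothing)
open import Data.Nat.Base using (ℕ; zero; suc; _+_; _≤_; _<_)
open import Data.Product.Base using (∃; ∃₂; _×_; _,_)
open import Data.Vec.Base as Vec using (Vec; []; _∷_; lookup)
open import Function.Bundles using (_⇔_)
open import Relation.Binary.PropositionalEquality using (_≡_)
open import Relation.Nullary.Negation using (¬_)

Str : Set
Str = List Bool

------------------------------------------------------------------------
-- Partial recursive functions on binary words: the analogue over
-- {0,1}* of the μ-recursive functions, with recursion on notation in
-- place of primitive recursion.  Minimisation ranges over the words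
-- 0ⁿ, and the empty word plays the role of the value 0.

data Rec : ℕ → Set where
  empty  : ∀ {n} → Rec n
  prefix : Bool → Rec 1
  proj   : ∀ {n} → Fin n → Rec n
  comp   : ∀ {m n} → Rec m → Vec (Rec n) m → Rec n
  rec    : ∀ {n} → Rec n → (Bool → Rec (2 + n)) → Rec (1 + n)
  mu     : ∀ {n} → Rec (1 + n) → Rec n

infix 4 _⟨_⟩⇓_ _⟪_⟫⇓_

mutual
  data _⟨_⟩⇓_ : ∀ {n} → Rec n → Vec Str n → Str → Set where
    ⇓empty  : ∀ {n} {v : Vec Str n} → empty ⟨ v ⟩⇓ []
    ⇓prefix : ∀ {b w} → prefix b ⟨ w ∷ [] ⟩⇓ (b ∷ w)
    ⇓proj   : ∀ {n} {v : Vec Str n} i → proj i ⟨ v ⟩⇓ lookup v i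
    ⇓comp   : ∀ {m n} {f : Rec m} {gs : Vec (Rec n) m} {v us r} →
              gs ⟪ v ⟫⇓ us → f ⟨ us ⟩⇓ r → comp f gs ⟨ v ⟩⇓ r
    ⇓rec-[] : ∀ {n} {f : Rec n} {h v r} →
              f ⟨ v ⟩⇓ r → rec f h ⟨ [] ∷ v ⟩⇓ r
    ⇓rec-∷  : ∀ {n} {f : Rec n} {h v b w r s} →
              rec f h ⟨ w ∷ v ⟩⇓ r → h b ⟨ w ∷ r ∷ v ⟩⇓ s →
              rec f h ⟨ (b ∷ w) ∷ v ⟩⇓ s
    ⇓mu     : ∀ {n} {f : Rec (1 + n)} {v} k →
              (∀ i → i < k → ∃₂ λ b w → f ⟨ replicate i false ∷ v ⟩⇓ (b ∷ w)) →
              f ⟨ replicate k false ∷ v ⟩⇓ [] →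
              mu f ⟨ v ⟩⇓ replicate k false

  data _⟪_⟫⇓_ : ∀ {m n} → Vec (Rec n) m → Vec Str n → Vec Str m → Set where
    []  : ∀ {n} {v : Vec Str n} → [] ⟪ v ⟫⇓ []
    _∷_ : ∀ {m n} {g : Rec n} {gs : Vec (Rec n) m} {v r rs} →
          g ⟨ v ⟩⇓ r → gs ⟪ v ⟫⇓ rs → (g ∷ gs) ⟪ v ⟫⇓ (r ∷ rs)

-- Computably enumerable = domain of a partial recursive function.

CE : ∀ {n} → (Vec Str n → Set) → Set
CE {n} P = ∃ λ (f : Rec n) → ∀ v → P v ⇔ ∃ λ r → f ⟨ v ⟩⇓ r

onPairs : (Str → Str → Set) → Vec Str 2 → Set
onPairs P (x ∷ y ∷ []) = P x y

onTriples : (Str → Str → Str → Set) → Vec Str 3 → Set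
onTriples P (x ∷ y ∷ z ∷ []) = P x y z

------------------------------------------------------------------------
-- Complexities are minima of sets of natural numbers.  Since they are
-- not computable, "the minimum of P is n" is a relation, and existence
-- of a minimum is only ever asserted up to double negation.

IsMin : (ℕ → Set) → ℕ → Set
IsMin P n = P n × (∀ m → P m → n ≤ m)

-- min P ≤ min Q + c, where an empty set has infinite minimum.

min_≤min_+_ : (ℕ → Set) → (ℕ → Set) → ℕ → Set
min P ≤min Q + c =
  ∀ n → IsMin Q n → ¬ ¬ (∃ λ m → IsMin P m × m ≤ n + c)

record DescriptionMode : Set₁ where
  field
    Describes  : Str → Str → Str → Set
    enumerable : CE (onTriples Describes)
    functional : ∀ {p x y y′} → Describes p x y → Describes p x y′ → y ≡ y′
    monotone   : ∀ {p x x′ y} → Prefix _≡_ x x′ →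
                 Describes p x y → Describes p x′ y

  Lengths : Str → Str → ℕ → Set
  Lengths y x n = ∃ λ p → length p ≡ n × Describes p x y

  -- C y x n: the complexity C_D(y | x*) equals n.
  C : (y x : Str) → ℕ → Set
  C y x = IsMin (Lengths y x)

Optimal : DescriptionMode → Set₁
Optimal D = ∀ (D′ : DescriptionMode) → ∃ λ c → ∀ y x →
  min Lengths D y x ≤min Lengths D′ y x + c
  where open DescriptionMode

------------------------------------------------------------------------
-- A decompressor is a partial computable
-- function on strings, given by its (computably enumerable) graph.

record Decompressor : Set₁ where
  field
    Describes  : Str → Str → Set
    enumerable : CE (onPairs Describes)
    functional : ∀ {p y y′} → Describes p y → Describes p y′ → y ≡ y′

  Lengths : Str → ℕ → Set
  Lengths y n = ∃ λ p → length p ≡ n × Describes p y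

  K : Str → ℕ → Set
  K y = IsMin (Lengths y)

OptimalDecompressor : Decompressor → Set₁
OptimalDecompressor U = ∀ (U′ : Decompressor) → ∃ λ c → ∀ y →
  min Lengths U y ≤min Lengths U′ y + c
  where open Decompressor

------------------------------------------------------------------------
-- Turing machines with a one-directional read-only binary input tape
-- and at least one two-way infinite work tape

data Move : Set where
  left stay right : Move

record TM : Set where
  field
    tapes′ states′ symbols′ : ℕ

  tapes : ℕ
  tapes = suc tapes′

  -- State zero is initial; symbol zero is the blank.
  State : Set
  State = Fin (suc states′)

  Symbol : Set
  Symbol = Fin (suc symbols′)

  -- The new state, whether the input head moves one cell to the right,
  -- and for each work tape the symbol written and the head movement.
  Action : Set
  Action = State × Bool × Vec (Symbol × Move) tapes

  field
    -- The second argument is the scanned input symbol, `nothing' while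
    -- the head is still to the left of the input.  The machine stops
    -- when the value is `nothing'.
    δ : State → Maybe Bool → Vec Symbol tapes → Maybe Action

-- The cells to the left of the head are listed from the nearest one
-- outwards; all cells not listed are blank.

record Tape (A : Set) : Set where
  constructor ⟪_,_,_⟫
  field
    before : List A
    head   : A
    after  : List A

module Run (M : TM) where
  open TM M

  blank : Symbol
  blank = zero

  blankTape : Tape Symbol
  blankTape = ⟪ [] , blank , [] ⟫

  move : Move → Tape Symbol → Tape Symbol
  move left  ⟪ []     , a , rs ⟫     = ⟪ [] , blank , a ∷ rs ⟫
  move left  ⟪ l ∷ ls , a , rs ⟫     = ⟪ ls , l , a ∷ rs ⟫
  move stay  t                       = t
  move right ⟪ ls     , a , [] ⟫     = ⟪ a ∷ ls , blank , [] ⟫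
  move right ⟪ ls     , a , r ∷ rs ⟫ = ⟪ a ∷ ls , r , rs ⟫

  update : Symbol × Move → Tape Symbol → Tape Symbol
  update (a , d) t = move d (record t { head = a })

  Input : Set
  Input = Maybe Bool × List Bool   -- scanned cell, unread bits

  -- Advance b i i′: the input head can go from i to i′, moving iff b.
  -- There is no move past the last bit: a machine that attempts one on
  -- input x does not stop at x.
  data Advance : Bool → Input → Input → Set where
    keep : ∀ {i} → Advance false i i
    read : ∀ {a b u} → Advance true (a , b ∷ u) (just b , u)

  record Config : Set where
    constructor config
    field
      state : State
      input : Input
      work  : Vec (Tape Symbol) tapes

  initial : Str → Config
  initial x = config zero (nothing , x) (Vec.replicate tapes blankTape)

  data StopsFrom : Config → Set where
    stop : ∀ {q a ts} →
           δ q a (Vec.map Tape.head ts) ≡ nothing →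
           StopsFrom (config q (a , []) ts)
    step : ∀ {q a u ts q′ b ws i′} →
           δ q a (Vec.map Tape.head ts) ≡ just (q′ , b , ws) →
           Advance b (a , u) i′ →
           StopsFrom (config q′ i′ (Vec.zipWith update ws ts)) →
           StopsFrom (config q (a , u) ts)

_StopsAt_ : TM → Str → Set
M StopsAt x = StopsFrom (initial x)
  where open Run M

------------------------------------------------------------------------
-- Binary encoding of machines: the three size parameters followed by
-- the list of all instructions (q , a , s⃗ ↦ action), with every number
-- n written as 1ⁿ0.

⌜_⌝ : ℕ → Str
⌜ n ⌝ = replicate n true ++ (false ∷ [])

allVecs : ∀ {A : Set} → List A → ∀ k → List (Vec A k)
allVecs as zero    = [] ∷ []
allVecs as (suc k) = concatMap (λ a → map (a ∷_) (allVecs as k)) as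

module Encode (M : TM) where
  open TM M

  encInput : Maybe Bool → Str
  encInput nothing      = ⌜ 0 ⌝
  encInput (just false) = ⌜ 1 ⌝
  encInput (just true)  = ⌜ 2 ⌝

  encMove : Move → Str
  encMove left  = ⌜ 0 ⌝
  encMove stay  = ⌜ 1 ⌝
  encMove right = ⌜ 2 ⌝

  encVec : ∀ {A : Set} {k} → (A → Str) → Vec A k → Str
  encVec e v = concatMap e (Vec.toList v)

  encFin : ∀ {n} → Fin n → Str
  encFin i = ⌜ toℕ i ⌝

  encWrite : Symbol × Move → Str
  encWrite (a , d) = encFin a ++ encMove d

  encAction : Action → Str
  encAction (q , b , ws) = encFin q ++ (b ∷ []) ++ encVec encWrite ws

  instruction : State → Maybe Bool → Vec Symbol tapes → Str
  instruction q a s with δ q a s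
  ... | nothing  = []
  ... | just act = encFin q ++ encInput a ++ encVec encFin s ++ encAction act

  table : Str
  table =
    concatMap (λ q →
      concatMap (λ a →
        concatMap (instruction q a) (allVecs (allFin (suc symbols′)) tapes))
      (nothing ∷ just false ∷ just true ∷ []))
    (allFin (suc states′))

  code : Str
  code = ⌜ tapes′ ⌝ ++ ⌜ states′ ⌝ ++ ⌜ symbols′ ⌝ ++ table

encode : TM → Str
encode = Encode.code

-- StoppingTime U x n: with U as the decompressor, the plain stopping
-- time complexity of x equals n.

StoppingTime : Decompressor → Str → ℕ → Set
StoppingTime U x =
  IsMin λ n → ∃ λ M → M StopsAt x × Decompressor.K U (encode M) n

{-# OPTIONS --safe #-}
module Submission where

{-
Both inequalities come from effective translations of descriptions.

If U maps p to the code of a machine M that stops at x, then p describes x given any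
extension of x: run M and return the part of the input that it has consumed when it
stops.  This is a description mode, since a deterministic machine cannot stop at two
prefixes of the same word, nor depend on letters that it has not read.

Conversely let S be the set of the words z that D describes from p given z.  Functionality
and monotonicity of D make S prefix-free.  A machine that has p built in therefore stops
exactly at the elements of S if, having read x, it enumerates S until some z in S extends
x, stops if z = x, and reads the next letter otherwise.  Its code is computable from p.

Enumerating S means running partial recursive functions on a Turing machine; each of them
becomes a program on finitely many stacks, and a stack is the part of a work tape to the
left of the head.  Since nothing can be decided constructively about minima, they are only
handled under double negation.
-}

open import Defs
open import Data.Bool.Base using (Bool; T; false; if_then_else_; true)
open import Data.Fin.Base using (Fin; _↑ʳ_; suc; toℕ; zero)
open import Data.Fin.Properties using (toℕ-injective; toℕ<n)
open import Data.List.Base as List using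
  (List; []; _++_; _ʳ++_; _∷_; allFin; concatMap; foldl; foldr; length; map; replicate; reverse;
   zipWith)
open import Data.List.Membership.Propositional using (_∈_; lose)
open import Data.List.Membership.Propositional.Properties using (∈-allFin; ∈-concatMap⁺; ∈-map⁺)
open import Data.List.Properties using
  (++-assoc; ++-cancelʳ; ++-cancelˡ; ++-identityʳ; concatMap-cong; length-++; length-map;
   length-replicate; map-injective; reverse-++; reverse-foldl; reverse-involutive;
   unfold-reverse; ʳ++-defn; ʳ++-ʳ++; ∷-injectiveʳ; ∷-injectiveˡ; ≡-dec)
open import Data.List.Relation.Binary.Prefix.Heterogeneous using (Prefix; []; _∷_)
open import Data.List.Relation.Unary.All as All using (All; []; _∷_)
import Data.List.Relation.Unary.All.Properties as All
open import Data.List.Relation.Unary.Any using (here; there)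
open import Data.Maybe.Base as Maybe using (Maybe; just; maybe′; nothing)
open import Data.Maybe.Properties using (just-injective)
open import Data.Nat.Base using
  (_+_; _<_; _∸_; _≡ᵇ_; _≤_; _≤′_; _⊓_; _⊔_; pred; suc; s≤s; zero; z≤n; ℕ; ∣_-_∣; ≤′-refl;
   ≤′-step)
open import Data.Nat.Properties using
  (+-assoc; +-cancelˡ-≡; +-comm; +-identityʳ; +-monoʳ-<; +-monoˡ-≤; +-suc; 1+n≢n; <-≤-trans; <⇒≢;
   <⇒≤; _<?_; _≟_; _≤?_; m<1+n⇒m<n∨m≡n; m<m+n; m∸[m∸n]≡n; m≤m+n; m≤m⊔n; m≤n+m; m≤n+o⇒m∸n≤o;
   m≤n⇒m∸n≡0; m≤n⇒m≤1+n; m≤n⇒m⊓n≡m; m≤n⇒∃[o]m+o≡n; m≤n⇒∣m-n∣≡n∸m; m≤n⇒∣n-m∣≡n∸m; m≤n⊔m;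
   m≥n⇒m⊓n≡n; n≤1+n; pred[m∸n]≡m∸[1+n]; suc-injective; ≡ᵇ⇒≡; ≤-pred; ≤-refl; ≤-total; ≤-trans;
   ≤⇒≤′; ≮⇒≥)
open import Data.Product.Base using (_,_; _×_; proj₁; proj₂; ∃; ∃₂)
open import Data.Sum.Base using (inj₁; inj₂)
open import Data.Unit.Base using (⊤)
open import Data.Vec.Base as Vec using (Vec; []; _∷_; lookup; toList)
open import Data.Vec.Properties using
  (cast-is-id; length-toList; lookup-map; lookup-replicate; lookup-zipWith; lookup∘tabulate;
   toList-injective)
open import Function.Base using (_∘_; case_of_; id)
open import Function.Bundles using (Equivalence; _⇔_; mk⇔)
open import Relation.Binary.PropositionalEquality using
  (_≡_; _≢_; cong; cong₂; module ≡-Reasoning; refl; subst; sym; trans)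
open import Relation.Nullary using (contradiction; no; yes; ¬_)
open import Relation.Nullary.Decidable using (decidable-stable)

-- `CE` asks for a code in `Rec`, so the Turing machine simulator and the computation of machine
-- codes must themselves exist as such codes. The typed language `Tm` bridges the gap: its terms
-- evaluate by reduction and compile to total codes, and unbounded search by `mu` is put on top of
-- them. Both translations keep the description `p` itself. However large the machine with `p` built
-- in may be, its code costs at most `length p` plus a constant, and the two additive constants come
-- from optimality alone: of `D` against the mode built from `U`, and of `U` against the
-- decompressor that sends `p` to the code of that machine. Each construction is verified in one
-- direction. The mode built from `U` has to be functional and monotone for every word that `U` may
-- output, whether or not it is the code of a machine; so the simulator accepts arbitrary words, is
-- deterministic on all of them, and is shown to succeed whenever a genuine machine stops. The
-- machine built from `p` is only shown to stop at each word that `D` describes from `p` given that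
-- word.

private variable
  A B   : Set
  k m n : ℕ

-- Total recursive functions on words, and pairing

-- The code travels with the Agda function that it computes, so that equations are proved for
-- functions and derivations of `⇓` are assembled only once per combinator.
record Total (n : ℕ) : Set where
  field
    codeᵀ : Rec n
    funᵀ  : Vec Str n → Str
    runsᵀ : ∀ v → codeᵀ ⟨ v ⟩⇓ funᵀ v

open Total

emptyᵀ : Total n
emptyᵀ = record { codeᵀ = empty ; funᵀ = λ _ → [] ; runsᵀ = λ _ → ⇓empty }

projᵀ : Fin n → Total n
projᵀ i = record { codeᵀ = proj i ; funᵀ = λ v → lookup v i ; runsᵀ = λ _ → ⇓proj i }

runsᵀ* : (gs : Vec (Total n) m) → ∀ v → Vec.map codeᵀ gs ⟪ v ⟫⇓ Vec.map (λ g → funᵀ g v) gs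
runsᵀ* []       v = []
runsᵀ* (g ∷ gs) v = runsᵀ g v ∷ runsᵀ* gs v

compᵀ : Total m → Vec (Total n) m → Total n
compᵀ f gs = record
  { codeᵀ = comp (codeᵀ f) (Vec.map codeᵀ gs)
  ; funᵀ  = λ v → funᵀ f (Vec.map (λ g → funᵀ g v) gs)
  ; runsᵀ = λ v → ⇓comp (runsᵀ* gs v) (runsᵀ f _)
  }

prefixᵀ : Bool → Total n → Total n
prefixᵀ b t = record
  { codeᵀ = comp (prefix b) (codeᵀ t ∷ [])
  ; funᵀ  = λ v → b ∷ funᵀ t v
  ; runsᵀ = λ v → ⇓comp (runsᵀ t v ∷ []) ⇓prefix
  }

tabulate⇓ : {fs : Fin m → Rec n} {v : Vec Str n} {u : Vec Str m} →
            (∀ i → fs i ⟨ v ⟩⇓ lookup u i) → Vec.tabulate fs ⟪ v ⟫⇓ u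
tabulate⇓ {u = []}    d = []
tabulate⇓ {u = _ ∷ _} d = d zero ∷ tabulate⇓ (d ∘ suc)

projs : Vec (Rec n) n
projs = Vec.tabulate proj

projs⇓ : (v : Vec Str n) → projs ⟪ v ⟫⇓ v
projs⇓ v = tabulate⇓ ⇓proj

recStr : A → (Bool → Str → A → A) → Str → A
recStr z s []      = z
recStr z s (b ∷ w) = s b w (recStr z s w)

recNat : A → (ℕ → A → A) → ℕ → A
recNat z s zero    = z
recNat z s (suc n) = s n (recNat z s n)

recᵀ : Total n → (Bool → Total (2 + n)) → Total (1 + n)
recᵀ f h = record
  { codeᵀ = rec (codeᵀ f) (codeᵀ ∘ h)
  ; funᵀ  = λ { (s ∷ v) → go v s }
  ; runsᵀ = λ { (s ∷ v) → go⇓ v s }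
  }
  where
  go : Vec Str _ → Str → Str
  go v = recStr (funᵀ f v) (λ b w r → funᵀ (h b) (w ∷ r ∷ v))
  go⇓ : ∀ v s → rec (codeᵀ f) (codeᵀ ∘ h) ⟨ s ∷ v ⟩⇓ go v s
  go⇓ v []      = ⇓rec-[] (runsᵀ f v)
  go⇓ v (b ∷ w) = ⇓rec-∷ (go⇓ v w) (runsᵀ (h b) _)

-- This is a `let`: the value of `t` becomes a new variable in front of the old ones.
onᵀ : Total (1 + n) → Total n → Total n
onᵀ f t = record
  { codeᵀ = comp (codeᵀ f) (codeᵀ t ∷ projs)
  ; funᵀ  = λ v → funᵀ f (funᵀ t v ∷ v)
  ; runsᵀ = λ v → ⇓comp (runsᵀ t v ∷ projs⇓ v) (runsᵀ f _)
  }

caseStr : A → (Str → A) → Str → A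
caseStr z s []      = z
caseStr z s (_ ∷ w) = s w

-- `Rec` has no case distinction; recursion with a step that drops the recursive value replaces it.
-- The value that `⇓rec-∷` still demands exists because everything here is total.
caseᵀ : Total n → Total (1 + n) → Total (1 + n)
caseᵀ {n} f h = record
  { codeᵀ = rec (codeᵀ f) (λ _ → comp (codeᵀ h) (proj zero ∷ Vec.tabulate (λ i → proj (suc (suc i)))))
  ; funᵀ  = λ { (s ∷ v) → caseStr (funᵀ f v) (λ w → funᵀ h (w ∷ v)) s }
  ; runsᵀ = λ { (s ∷ v) → go⇓ v s }
  }
  where
  go⇓ : ∀ v s → rec (codeᵀ f) _ ⟨ s ∷ v ⟩⇓ caseStr (funᵀ f v) (λ w → funᵀ h (w ∷ v)) s
  go⇓ v []      = ⇓rec-[] (runsᵀ f v)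
  go⇓ v (b ∷ w) = ⇓rec-∷ (go⇓ v w)
    (⇓comp (⇓proj zero ∷ tabulate⇓ (λ i → ⇓proj (suc (suc i)))) (runsᵀ h _))

#0 : Total (1 + n)
#0 = projᵀ zero
#1 : Total (2 + n)
#1 = projᵀ (suc zero)
#2 : Total (3 + n)
#2 = projᵀ (suc (suc zero))

appendᵀ : Total 2
appendᵀ = recᵀ #0 (λ b → prefixᵀ b #1)

unaryᵀ leadᵀ tailᵀ headᵀ : Total 1
unaryᵀ = recᵀ emptyᵀ (λ _ → prefixᵀ true #1)
leadᵀ  = recᵀ emptyᵀ λ { true → prefixᵀ true #1 ; false → emptyᵀ }
tailᵀ  = caseᵀ emptyᵀ #0
headᵀ  = recᵀ emptyᵀ (λ b → prefixᵀ b emptyᵀ)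

-- The first argument counts by its length, so that the unary block in front of a pair can be passed
-- as it stands. Recursion on the count leaves the second argument untouched, hence `takeᵀ` fetches
-- each further letter through `dropᵀ`.
dropᵀ takeᵀ : Total 2
dropᵀ = recᵀ #0 (λ _ → compᵀ tailᵀ (#1 ∷ []))
takeᵀ = recᵀ emptyᵀ
  (λ _ → compᵀ appendᵀ (#1 ∷ compᵀ headᵀ (compᵀ dropᵀ (#0 ∷ #2 ∷ []) ∷ []) ∷ []))

pairᵀ : Total 2
pairᵀ = compᵀ appendᵀ (compᵀ unaryᵀ (#0 ∷ []) ∷ prefixᵀ false appendᵀ ∷ [])

bodyᵀ : Total 1
bodyᵀ = compᵀ tailᵀ (compᵀ dropᵀ (leadᵀ ∷ #0 ∷ []) ∷ [])

fstᵀ sndᵀ : Total 1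
fstᵀ = compᵀ takeᵀ (leadᵀ ∷ bodyᵀ ∷ [])
sndᵀ = compᵀ dropᵀ (leadᵀ ∷ bodyᵀ ∷ [])

fun₁ : Total 1 → Str → Str
fun₁ f x = funᵀ f (x ∷ [])

fun₂ : Total 2 → Str → Str → Str
fun₂ f x y = funᵀ f (x ∷ y ∷ [])

append-++ : ∀ x y → fun₂ appendᵀ x y ≡ x ++ y
append-++ []      y = refl
append-++ (b ∷ x) y = cong (b ∷_) (append-++ x y)

pair : Str → Str → Str
pair x y = replicate (length x) true ++ false ∷ x ++ y

unary-length : ∀ x → fun₁ unaryᵀ x ≡ replicate (length x) true
unary-length []      = refl
unary-length (_ ∷ x) = cong (true ∷_) (unary-length x)

pairᵀ-pair : ∀ x y → fun₂ pairᵀ x y ≡ pair x y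
pairᵀ-pair x y = trans (append-++ (fun₁ unaryᵀ x) _)
  (cong₂ _++_ (unary-length x) (cong (false ∷_) (append-++ x y)))

drop-∷ : ∀ a c b w → fun₂ dropᵀ (c ∷ a) (b ∷ w) ≡ fun₂ dropᵀ a w
drop-∷ []      c b w = refl
drop-∷ (d ∷ a) c b w = cong (fun₁ tailᵀ) (drop-∷ a d b w)

drop-++ : ∀ a x y → length a ≡ length x → fun₂ dropᵀ a (x ++ y) ≡ y
drop-++ []      []      y _  = refl
drop-++ (c ∷ a) (b ∷ x) y eq =
  trans (drop-∷ a c b (x ++ y)) (drop-++ a x y (suc-injective eq))

head++tail : ∀ w → fun₁ headᵀ w ++ fun₁ tailᵀ w ≡ w
head++tail []      = refl
head++tail (_ ∷ _) = refl

-- Reduces `take-++` to `drop-++` by cancelling the common suffix.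
take++drop : ∀ a w → fun₂ takeᵀ a w ++ fun₂ dropᵀ a w ≡ w
take++drop []      w = refl
take++drop (c ∷ a) w = begin
  fun₂ appendᵀ t (fun₁ headᵀ d) ++ fun₁ tailᵀ d ≡⟨ cong (_++ fun₁ tailᵀ d) (append-++ t (fun₁ headᵀ d)) ⟩
  (t ++ fun₁ headᵀ d) ++ fun₁ tailᵀ d           ≡⟨ ++-assoc t (fun₁ headᵀ d) (fun₁ tailᵀ d) ⟩
  t ++ fun₁ headᵀ d ++ fun₁ tailᵀ d             ≡⟨ cong (t ++_) (head++tail d) ⟩
  t ++ d                                        ≡⟨ take++drop a w ⟩
  w                                             ∎
  where
  open ≡-Reasoning
  t d : Str
  t = fun₂ takeᵀ a w
  d = fun₂ dropᵀ a w

take-++ : ∀ a x y → length a ≡ length x → fun₂ takeᵀ a (x ++ y) ≡ x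
take-++ a x y eq = ++-cancelʳ y _ _
  (trans (cong (fun₂ takeᵀ a (x ++ y) ++_) (sym (drop-++ a x y eq))) (take++drop a (x ++ y)))

lead-replicate : ∀ k w → fun₁ leadᵀ (replicate k true ++ false ∷ w) ≡ replicate k true
lead-replicate zero    w = refl
lead-replicate (suc k) w = cong (true ∷_) (lead-replicate k w)

length-unary : ∀ (x : Str) → length (replicate (length x) true) ≡ length x
length-unary []      = refl
length-unary (_ ∷ x) = cong suc (length-unary x)

body-pair : ∀ x y → fun₁ bodyᵀ (pair x y) ≡ x ++ y
body-pair x y rewrite lead-replicate (length x) (x ++ y)
  | drop-++ (replicate (length x) true) (replicate (length x) true) (false ∷ x ++ y) refl = refl

fst-pair : ∀ x y → fun₁ fstᵀ (pair x y) ≡ x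
fst-pair x y = trans
  (cong₂ (fun₂ takeᵀ) (lead-replicate (length x) (x ++ y)) (body-pair x y))
  (take-++ (replicate (length x) true) x y (length-unary x))

snd-pair : ∀ x y → fun₁ sndᵀ (pair x y) ≡ y
snd-pair x y = trans
  (cong₂ (fun₂ dropᵀ) (lead-replicate (length x) (x ++ y)) (body-pair x y))
  (drop-++ (replicate (length x) true) x y (length-unary x))

-- Typed total programs

infixr 5 _⊗_

data Ty : Set where
  str nat bool : Ty
  opt list     : Ty → Ty
  _⊗_          : Ty → Ty → Ty

private variable
  σ τ τ₀ τ₁ τ₂ τ₃ τ₄ τ₅ : Ty
  Γ Δ                   : List Ty

⟦_⟧ : Ty → Set
⟦ str ⟧    = Str
⟦ nat ⟧    = ℕ
⟦ bool ⟧   = Bool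
⟦ opt τ ⟧  = Maybe ⟦ τ ⟧
⟦ list τ ⟧ = List ⟦ τ ⟧
⟦ σ ⊗ τ ⟧  = ⟦ σ ⟧ × ⟦ τ ⟧

Env : List Ty → Set
Env = All ⟦_⟧

-- A first-order language with de Bruijn variables. `call` runs a term in a context of its own, so
-- that programs are reused without renaming. `strRec` and `natRec` also serve as case distinctions,
-- by ignoring the recursive value.
data Tm : List Ty → Ty → Set where
  var     : τ ∈ Γ → Tm Γ τ
  call    : Tm Δ τ → All (Tm Γ) Δ → Tm Γ τ
  ε       : Tm Γ str
  _◂_     : Bool → Tm Γ str → Tm Γ str
  strRec  : Tm Γ str → Tm Γ τ → (Bool → Tm (str ∷ τ ∷ Γ) τ) → Tm Γ τ
  ze      : Tm Γ nat
  su      : Tm Γ nat → Tm Γ nat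
  natRec  : Tm Γ nat → Tm Γ τ → Tm (nat ∷ τ ∷ Γ) τ → Tm Γ τ
  tt ff   : Tm Γ bool
  ite     : Tm Γ bool → Tm Γ τ → Tm Γ τ → Tm Γ τ
  none    : Tm Γ (opt τ)
  some    : Tm Γ τ → Tm Γ (opt τ)
  optCase : Tm Γ (opt σ) → Tm Γ τ → Tm (σ ∷ Γ) τ → Tm Γ τ
  _,,_    : Tm Γ σ → Tm Γ τ → Tm Γ (σ ⊗ τ)
  fst     : Tm Γ (σ ⊗ τ) → Tm Γ σ
  snd     : Tm Γ (σ ⊗ τ) → Tm Γ τ
  nil     : Tm Γ (list τ)
  cons    : Tm Γ τ → Tm Γ (list τ) → Tm Γ (list τ)
  lstCase : Tm Γ (list σ) → Tm Γ τ → Tm (σ ∷ list σ ∷ Γ) τ → Tm Γ τ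
  fold    : Tm Γ (list σ) → Tm Γ τ → Tm (σ ∷ τ ∷ Γ) τ → Tm Γ τ

infixr 5 _◂_
infixr 4 _,,_

caseList : B → (A → List A → B) → List A → B
caseList z s []       = z
caseList z s (a ∷ as) = s a as

mutual
  eval : Tm Γ τ → Env Γ → ⟦ τ ⟧
  eval (var i)         ρ = All.lookup ρ i
  eval (call t us)     ρ = eval t (evals us ρ)
  eval ε               ρ = []
  eval (b ◂ t)         ρ = b ∷ eval t ρ
  eval (strRec t z s)  ρ = recStr (eval z ρ) (λ b w r → eval (s b) (w ∷ r ∷ ρ)) (eval t ρ)
  eval ze              ρ = zero
  eval (su t)          ρ = suc (eval t ρ)
  eval (natRec t z s)  ρ = recNat (eval z ρ) (λ n r → eval s (n ∷ r ∷ ρ)) (eval t ρ)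
  eval tt              ρ = true
  eval ff              ρ = false
  eval (ite c t u)     ρ = if eval c ρ then eval t ρ else eval u ρ
  eval none            ρ = nothing
  eval (some t)        ρ = just (eval t ρ)
  eval (optCase t z s) ρ = maybe′ (λ a → eval s (a ∷ ρ)) (eval z ρ) (eval t ρ)
  eval (t ,, u)        ρ = eval t ρ , eval u ρ
  eval (fst t)         ρ = proj₁ (eval t ρ)
  eval (snd t)         ρ = proj₂ (eval t ρ)
  eval nil             ρ = []
  eval (cons t u)      ρ = eval t ρ ∷ eval u ρ
  eval (lstCase t z s) ρ = caseList (eval z ρ) (λ a as → eval s (a ∷ as ∷ ρ)) (eval t ρ)
  eval (fold t z s)    ρ = foldl (λ r a → eval s (a ∷ r ∷ ρ)) (eval z ρ) (eval t ρ)

  evals : All (Tm Γ) Δ → Env Γ → Env Δ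
  evals []       ρ = []
  evals (t ∷ ts) ρ = eval t ρ ∷ evals ts ρ

mutual
  -- Numbers are words of zeros because these are the words that `mu` runs through. The values
  -- `false`, `nothing` and `[]` are the empty word, so that every case distinction is a test for
  -- emptiness.
  enc : ∀ τ → ⟦ τ ⟧ → Str
  enc str      s        = s
  enc nat      n        = replicate n false
  enc bool     true     = true ∷ []
  enc bool     false    = []
  enc (opt τ)  nothing  = []
  enc (opt τ)  (just a) = true ∷ enc τ a
  enc (list τ) as       = encList τ as
  enc (σ ⊗ τ)  (a , b)  = pair (enc σ a) (enc τ b)

  encList : ∀ τ → List ⟦ τ ⟧ → Str
  encList τ []       = []
  encList τ (a ∷ as) = true ∷ pair (enc τ a) (encList τ as)

encs : Env Γ → Vec Str (length Γ)
encs {Γ = []}    []      = []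
encs {Γ = τ ∷ _} (a ∷ ρ) = enc τ a ∷ encs ρ

index : {Γ : List Ty} → τ ∈ Γ → Fin (length Γ)
index (here _)  = zero
index (there i) = suc (index i)

lookup-drop : ∀ k (v : Vec Str (k + n)) i → lookup (Vec.drop k v) i ≡ lookup v (k ↑ʳ i)
lookup-drop zero    v       i = refl
lookup-drop (suc k) (_ ∷ v) i = lookup-drop k v i

++⇓ : {gs : Vec (Rec n) m} {hs : Vec (Rec n) k} {v : Vec Str n} {us : Vec Str m} {ws : Vec Str k} →
      gs ⟪ v ⟫⇓ us → hs ⟪ v ⟫⇓ ws → (gs Vec.++ hs) ⟪ v ⟫⇓ (us Vec.++ ws)
++⇓ []       es = es
++⇓ (d ∷ ds) es = d ∷ ++⇓ ds es

-- Adapts a function to other binders: the `k` innermost variables give way to the `m` values of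
-- `gs`, the outer ones stay.
underᵀ : ∀ k → Vec (Total (k + n)) m → Total (m + n) → Total (k + n)
underᵀ {n} k gs f = record
  { codeᵀ = comp (codeᵀ f) (Vec.map codeᵀ gs Vec.++ Vec.tabulate (λ i → proj (k ↑ʳ i)))
  ; funᵀ  = λ v → funᵀ f (Vec.map (λ g → funᵀ g v) gs Vec.++ Vec.drop k v)
  ; runsᵀ = λ v → ⇓comp
      (++⇓ (runsᵀ* gs v) (tabulate⇓ (λ i →
        subst (proj (k ↑ʳ i) ⟨ v ⟩⇓_) (sym (lookup-drop k v i)) (⇓proj (k ↑ʳ i)))))
      (runsᵀ f _)
  }

fst₀ snd₀ fst₁ : ∀ {n} → Total (2 + n)
fst₀ = compᵀ fstᵀ (#0 ∷ [])
snd₀ = compᵀ sndᵀ (#0 ∷ [])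
fst₁ = compᵀ fstᵀ (#1 ∷ [])

-- The state of a left fold is the pair of the accumulator and the remaining list.
foldStepᵀ : Total (2 + n) → Total (1 + n)
foldStepᵀ h = onᵀ
  (caseᵀ #0 (compᵀ pairᵀ (underᵀ 2 (fst₀ ∷ fst₁ ∷ []) h ∷ snd₀ ∷ [])))
  (compᵀ sndᵀ (#0 ∷ []))

-- The encoding of the list is its own counter: it is at least as long as the list, and further
-- steps change nothing once the list is exhausted.
foldᵀ : Total n → Total n → Total (2 + n) → Total n
foldᵀ t z h = compᵀ fstᵀ
  (onᵀ (recᵀ (compᵀ pairᵀ (z ∷ t ∷ [])) (λ _ → underᵀ 1 [] (foldStepᵀ h))) t ∷ [])

mutual
  compile : Tm Γ τ → Total (length Γ)
  compile (var i)         = projᵀ (index i)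
  compile (call t us)     = compᵀ (compile t) (compiles us)
  compile ε               = emptyᵀ
  compile (b ◂ t)         = prefixᵀ b (compile t)
  compile (strRec t z s)  = onᵀ (recᵀ (compile z) (λ b → compile (s b))) (compile t)
  compile ze              = emptyᵀ
  compile (su t)          = prefixᵀ false (compile t)
  compile (natRec t z s)  = onᵀ (recᵀ (compile z) (λ _ → compile s)) (compile t)
  compile tt              = prefixᵀ true emptyᵀ
  compile ff              = emptyᵀ
  compile (ite c t u)     = onᵀ (caseᵀ (compile u) (underᵀ 1 [] (compile t))) (compile c)
  compile none            = emptyᵀ
  compile (some t)        = prefixᵀ true (compile t)
  compile (optCase t z s) = onᵀ (caseᵀ (compile z) (compile s)) (compile t)
  compile (t ,, u)        = compᵀ pairᵀ (compile t ∷ compile u ∷ [])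
  compile (fst t)         = compᵀ fstᵀ (compile t ∷ [])
  compile (snd t)         = compᵀ sndᵀ (compile t ∷ [])
  compile nil             = emptyᵀ
  compile (cons t u)      = prefixᵀ true (compᵀ pairᵀ (compile t ∷ compile u ∷ []))
  compile (lstCase t z s) = onᵀ
    (caseᵀ (compile z) (underᵀ 1 (compᵀ fstᵀ (#0 ∷ []) ∷ compᵀ sndᵀ (#0 ∷ []) ∷ []) (compile s)))
    (compile t)
  compile (fold t z s)    = foldᵀ (compile t) (compile z) (compile s)

  compiles : All (Tm Γ) Δ → Vec (Total (length Γ)) (length Δ)
  compiles []       = []
  compiles (t ∷ ts) = compile t ∷ compiles ts

lookup-encs : (i : τ ∈ Γ) (ρ : Env Γ) → lookup (encs ρ) (index i) ≡ enc τ (All.lookup ρ i)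
lookup-encs (here refl) (_ ∷ _) = refl
lookup-encs (there i)   (_ ∷ ρ) = lookup-encs i ρ

pairᵀ-cong : ∀ {x x′ y y′} → x ≡ x′ → y ≡ y′ → fun₂ pairᵀ x y ≡ pair x′ y′
pairᵀ-cong {x} {y = y} refl refl = pairᵀ-pair x y

recStr-cong : {f : B → A} {z : A} {z′ : B} {g : Bool → Str → A → A} {g′ : Bool → Str → B → B} →
  z ≡ f z′ → (∀ b w r → g b w (f r) ≡ f (g′ b w r)) → ∀ w → recStr z g w ≡ f (recStr z′ g′ w)
recStr-cong p q []      = p
recStr-cong {g = g} p q (b ∷ w) = trans (cong (g b w) (recStr-cong p q w)) (q b w _)

recNat-cong : {z : Str} {f : B → Str} {g : Bool → Str → Str → Str} {g′ : ℕ → B → B} {z′ : B} →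
  z ≡ f z′ → (∀ n r → g false (replicate n false) (f r) ≡ f (g′ n r)) →
  ∀ n → recStr z g (replicate n false) ≡ f (recNat z′ g′ n)
recNat-cong p q zero    = p
recNat-cong {g = g} p q (suc n) = trans (cong (g false (replicate n false)) (recNat-cong p q n)) (q n _)

-- In `recStr` the last step is outermost, while induction on the list to be folded needs the first
-- step innermost. All steps are the same function, so the two agree.
recStr-outer : (f : A → A) (z : A) (w : Str) → recStr (f z) (λ _ _ → f) w ≡ f (recStr z (λ _ _ → f) w)
recStr-outer f z []      = refl
recStr-outer f z (_ ∷ w) = cong f (recStr-outer f z w)

foldStep-[] : (h : Total (2 + n)) (a : Str) (v : Vec Str n) →
  funᵀ (foldStepᵀ h) (pair a [] ∷ v) ≡ pair a []
foldStep-[] h a v rewrite snd-pair a [] = refl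

foldStep-∷ : (h : Total (2 + n)) (a x y : Str) (v : Vec Str n) →
  funᵀ (foldStepᵀ h) (pair a (true ∷ pair x y) ∷ v) ≡ pair (funᵀ h (x ∷ a ∷ v)) y
foldStep-∷ h a x y v = trans
  (cong (caseStr _ _) (snd-pair a (true ∷ pair x y)))
  (pairᵀ-cong (cong₂ (λ p q → funᵀ h (p ∷ q ∷ v)) (fst-pair x y) (fst-pair a (true ∷ pair x y))) (snd-pair x y))

length-encList : ∀ τ as → length as ≤ length (encList τ as)
length-encList τ []       = z≤n
length-encList τ (a ∷ as) = s≤s (≤-trans (length-encList τ as)
  (subst (_ ≤_) (sym eq) (m≤n+m _ (length (replicate (length x) true ++ false ∷ x)))))
  where
  x : Str
  x = enc τ a
  eq : length (pair x (encList τ as)) ≡ length (replicate (length x) true ++ false ∷ x) + length (encList τ as)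
  eq = trans (cong length (sym (++-assoc (replicate (length x) true) (false ∷ x) _)))
             (length-++ (replicate (length x) true ++ false ∷ x))

module _ (h : Total (2 + n)) (v : Vec Str n) {σ τ} (g : ⟦ τ ⟧ → ⟦ σ ⟧ → ⟦ τ ⟧)
  (hyp : ∀ r a → funᵀ h (enc σ a ∷ enc τ r ∷ v) ≡ enc τ (g r a)) where

  private
    iterate : Str → Str → Str
    iterate s = recStr s (λ _ _ r → funᵀ (foldStepᵀ h) (r ∷ v))

    iterate-[] : ∀ w a → iterate (pair a []) w ≡ pair a []
    iterate-[] []      a = refl
    iterate-[] (_ ∷ w) a = trans (cong (λ r → funᵀ (foldStepᵀ h) (r ∷ v)) (iterate-[] w a)) (foldStep-[] h a v)

  fold-iterate : ∀ as r w → length as ≤ length w →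
    iterate (pair (enc τ r) (encList σ as)) w ≡ pair (enc τ (foldl g r as)) []
  fold-iterate []       r w       _        = iterate-[] w _
  fold-iterate (a ∷ as) r (_ ∷ w) (s≤s le) = begin
    step (iterate (pair (enc τ r) (encList σ (a ∷ as))) w) ≡⟨ sym (recStr-outer step _ w) ⟩
    iterate (step (pair (enc τ r) (encList σ (a ∷ as)))) w ≡⟨ cong (λ s → iterate s w) (foldStep-∷ h _ _ _ v) ⟩
    iterate (pair (funᵀ h (enc σ a ∷ enc τ r ∷ v)) (encList σ as)) w
      ≡⟨ cong (λ s → iterate (pair s (encList σ as)) w) (hyp r a) ⟩
    iterate (pair (enc τ (g r a)) (encList σ as)) w        ≡⟨ fold-iterate as (g r a) w le ⟩
    pair (enc τ (foldl g r (a ∷ as))) []                   ∎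
    where
    open ≡-Reasoning
    step : Str → Str
    step r = funᵀ (foldStepᵀ h) (r ∷ v)

mutual
  compile-correct : (t : Tm Γ τ) (ρ : Env Γ) → funᵀ (compile t) (encs ρ) ≡ enc τ (eval t ρ)
  compile-correct (var i)         ρ = lookup-encs i ρ
  compile-correct (call t us)     ρ =
    trans (cong (funᵀ (compile t)) (compiles-correct us ρ)) (compile-correct t _)
  compile-correct ε               ρ = refl
  compile-correct (b ◂ t)         ρ = cong (b ∷_) (compile-correct t ρ)
  compile-correct (strRec t z s)  ρ = trans
    (cong (recStr _ _) (compile-correct t ρ))
    (recStr-cong {f = enc _} (compile-correct z ρ) (λ b w r → compile-correct (s b) (w ∷ r ∷ ρ)) (eval t ρ))
  compile-correct ze              ρ = refl
  compile-correct (su t)          ρ = cong (false ∷_) (compile-correct t ρ)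
  compile-correct (natRec t z s)  ρ = trans
    (cong (recStr _ _) (compile-correct t ρ))
    (recNat-cong {f = enc _} (compile-correct z ρ) (λ n r → compile-correct s (n ∷ r ∷ ρ)) (eval t ρ))
  compile-correct tt              ρ = refl
  compile-correct ff              ρ = refl
  compile-correct (ite c t u)     ρ with eval c ρ | compile-correct c ρ
  ... | true  | eq rewrite eq = compile-correct t ρ
  ... | false | eq rewrite eq = compile-correct u ρ
  compile-correct none            ρ = refl
  compile-correct (some t)        ρ = cong (true ∷_) (compile-correct t ρ)
  compile-correct (optCase t z s) ρ with eval t ρ | compile-correct t ρ
  ... | nothing | eq rewrite eq = compile-correct z ρ
  ... | just a  | eq rewrite eq = compile-correct s (a ∷ ρ)
  compile-correct (t ,, u)        ρ = pairᵀ-cong (compile-correct t ρ) (compile-correct u ρ)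
  compile-correct (fst t)         ρ = trans (cong (fun₁ fstᵀ) (compile-correct t ρ)) (fst-pair _ _)
  compile-correct (snd t)         ρ =
    trans (cong (fun₁ sndᵀ) (compile-correct t ρ)) (snd-pair (enc _ (proj₁ (eval t ρ))) _)
  compile-correct nil             ρ = refl
  compile-correct (cons t u)      ρ = cong (true ∷_) (pairᵀ-cong (compile-correct t ρ) (compile-correct u ρ))
  compile-correct (lstCase t z s) ρ with eval t ρ | compile-correct t ρ
  ... | []     | eq rewrite eq = compile-correct z ρ
  ... | a ∷ as | eq rewrite eq = trans
    (cong₂ (λ p q → funᵀ (compile s) (p ∷ q ∷ encs ρ)) (fst-pair (enc _ a) _) (snd-pair (enc _ a) _))
    (compile-correct s (a ∷ as ∷ ρ))
  compile-correct (fold t z s)    ρ = trans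
    (cong (fun₁ fstᵀ) (trans
      (cong₂ (λ p q → recStr p _ q)
        (pairᵀ-cong (compile-correct z ρ) (compile-correct t ρ)) (compile-correct t ρ))
      (fold-iterate (compile s) (encs ρ) _ (λ r a → compile-correct s (a ∷ r ∷ ρ))
        (eval t ρ) _ (encList _ (eval t ρ)) (length-encList _ (eval t ρ)))))
    (fst-pair _ _)

  compiles-correct : (us : All (Tm Γ) Δ) (ρ : Env Γ) →
    Vec.map (λ g → funᵀ g (encs ρ)) (compiles us) ≡ encs (evals us ρ)
  compiles-correct []       ρ = refl
  compiles-correct (u ∷ us) ρ = cong₂ _∷_ (compile-correct u ρ) (compiles-correct us ρ)

compile⇓ : (t : Tm Γ τ) (ρ : Env Γ) → codeᵀ (compile t) ⟨ encs ρ ⟩⇓ enc τ (eval t ρ)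
compile⇓ t ρ = subst (codeᵀ (compile t) ⟨ encs ρ ⟩⇓_) (compile-correct t ρ) (runsᵀ (compile t) (encs ρ))

v0 : Tm (τ₀ ∷ Γ) τ₀
v0 = var (here refl)
v1 : Tm (τ₀ ∷ τ₁ ∷ Γ) τ₁
v1 = var (there (here refl))
v2 : Tm (τ₀ ∷ τ₁ ∷ τ₂ ∷ Γ) τ₂
v2 = var (there (there (here refl)))
v3 : Tm (τ₀ ∷ τ₁ ∷ τ₂ ∷ τ₃ ∷ Γ) τ₃
v3 = var (there (there (there (here refl))))
v4 : Tm (τ₀ ∷ τ₁ ∷ τ₂ ∷ τ₃ ∷ τ₄ ∷ Γ) τ₄
v4 = var (there (there (there (there (here refl)))))
v5 : Tm (τ₀ ∷ τ₁ ∷ τ₂ ∷ τ₃ ∷ τ₄ ∷ τ₅ ∷ Γ) τ₅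
v5 = var (there (there (there (there (there (here refl))))))

-- Evaluation of partial recursive functions with a bound on the length of searches

argᵗ : ℕ → Tm (list str ∷ []) str
argᵗ zero    = lstCase v0 ε v0
argᵗ (suc i) = lstCase v0 ε (call (argᵗ i) (v1 ∷ []))

eval-arg : (i : Fin n) (v : Vec Str n) → eval (argᵗ (toℕ i)) (toList v ∷ []) ≡ lookup v i
eval-arg zero    (_ ∷ _) = refl
eval-arg (suc i) (_ ∷ v) = eval-arg i v

-- The state is some (ff ,, w) while w is to be tried next and some (tt ,, w) once the
-- search has ended at w; it is none after an evaluation that was cut short.
muState : Tm (nat ∷ list str ∷ []) (opt str) → Tm (nat ∷ list str ∷ []) (opt (bool ⊗ str))
muState t = natRec v0 (some (ff ,, ε))
  (optCase v1 none
    (ite (fst v0) (some v0)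
      (optCase (call t (v3 ∷ cons (snd v0) v4 ∷ [])) none
        (strRec v0 (some (tt ,, snd v1)) (λ _ → some (ff ,, false ◂ snd v3))))))

mutual
  -- The bound is spent on `mu` only, everything else terminates by itself. The arguments come as
  -- one list, so that the context is the same for all arities.
  bounded : Rec n → Tm (nat ∷ list str ∷ []) (opt str)
  bounded empty       = some ε
  bounded (prefix b)  = some (b ◂ call (argᵗ 0) (v1 ∷ []))
  bounded (proj i)    = some (call (argᵗ (toℕ i)) (v1 ∷ []))
  bounded (comp f gs) = optCase (boundeds gs) none (call (bounded f) (v1 ∷ v0 ∷ []))
  bounded (rec f h)   = lstCase v1 none
    (strRec v0 (call (bounded f) (v2 ∷ v1 ∷ []))
      (λ b → optCase v1 none (call (bounded (h b)) (v5 ∷ cons v1 (cons v0 v4) ∷ []))))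
  bounded (mu f)      = optCase (muState (bounded f)) none (ite (fst v0) (some (snd v0)) none)

  boundeds : Vec (Rec n) m → Tm (nat ∷ list str ∷ []) (opt (list str))
  boundeds []       = some nil
  boundeds (g ∷ gs) = optCase (bounded g) none
    (optCase (call (boundeds gs) (v1 ∷ v2 ∷ [])) none (some (cons v1 v0)))

run : Rec n → ℕ → Vec Str n → Maybe Str
run f k v = eval (bounded f) (k ∷ toList v ∷ [])

runs : Vec (Rec n) m → ℕ → Vec Str n → Maybe (List Str)
runs gs k v = eval (boundeds gs) (k ∷ toList v ∷ [])

recRun : Rec n → (Bool → Rec (2 + n)) → ℕ → Vec Str n → Str → Maybe Str
recRun f h k v = recStr (run f k v) (λ b w → maybe′ (λ r → run (h b) k (w ∷ r ∷ v)) nothing)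

muStep : (Str → Maybe Str) → ℕ → Maybe (Bool × Str) → Maybe (Bool × Str)
muStep e _ = maybe′ (λ s → if proj₁ s then just s else
  maybe′ (recStr (just (true , proj₂ s)) (λ _ _ _ → just (false , false ∷ proj₂ s))) nothing (e (proj₂ s))) nothing

muRun : (Str → Maybe Str) → ℕ → Maybe (Bool × Str)
muRun e = recNat (just (false , [])) (muStep e)

Nonempty : Maybe Str → Set
Nonempty r = ∃₂ λ b w → r ≡ just (b ∷ w)

-- The invariant collects the premises of `⇓mu`; a search that was cut short promises nothing.
MuInvariant : (Str → Maybe Str) → ℕ → Maybe (Bool × Str) → Set
MuInvariant e n nothing            = ⊤
MuInvariant e n (just (false , s)) = s ≡ replicate n false × (∀ i → i < n → Nonempty (e (replicate i false)))
MuInvariant e n (just (true , s))  = ∃ λ j → s ≡ replicate j false ×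
  (∀ i → i < j → Nonempty (e (replicate i false))) × e (replicate j false) ≡ just []

<-suc-elim : {P : ℕ → Set} → (∀ i → i < n → P i) → P n → ∀ i → i < suc n → P i
<-suc-elim below at i i<1+n with m<1+n⇒m<n∨m≡n i<1+n
... | inj₁ i<n  = below i i<n
... | inj₂ refl = at

muRun-invariant : ∀ e n → MuInvariant e n (muRun e n)
muRun-invariant e zero    = refl , λ _ ()
muRun-invariant e (suc n) with muRun e n | muRun-invariant e n
... | nothing          | _ = _
... | just (true , s)  | i = i
... | just (false , s) | refl , below with e (replicate n false) in eq
...   | nothing      = _
...   | just []      = n , refl , below , eq
...   | just (b ∷ w) = refl , <-suc-elim below (b , w , eq)

mutual
  run-sound : (f : Rec n) → ∀ k v {r} → run f k v ≡ just r → f ⟨ v ⟩⇓ r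
  run-sound empty       k v       refl = ⇓empty
  run-sound (prefix b)  k (w ∷ []) refl = ⇓prefix
  run-sound (proj i)    k v       refl rewrite eval-arg i v = ⇓proj i
  run-sound (comp f gs) k v       eq with runs gs k v in eqs
  ... | just us with runs-sound gs k v eqs
  ...   | ws , refl , ds = ⇓comp ds (run-sound f k ws eq)
  run-sound (rec f h)   k (s ∷ v) eq = go s eq
    where
    go : ∀ s {r} → recRun f h k v s ≡ just r → rec f h ⟨ s ∷ v ⟩⇓ r
    go []      eq = ⇓rec-[] (run-sound f k v eq)
    go (b ∷ w) eq with recRun f h k v w in eqw
    ... | just r = ⇓rec-∷ (go w eqw) (run-sound (h b) k (w ∷ r ∷ v) eq)
  run-sound (mu f)      k v       eq
    with muRun (λ s → run f k (s ∷ v)) k | muRun-invariant (λ s → run f k (s ∷ v)) k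
  run-sound (mu f) k v refl | just (true , _) | j , refl , below , at =
    ⇓mu j (λ i i<j → let b , w , e = below i i<j in b , w , run-sound f k _ e) (run-sound f k _ at)

  runs-sound : (gs : Vec (Rec n) m) → ∀ k v {us} → runs gs k v ≡ just us →
               ∃ λ ws → toList ws ≡ us × gs ⟪ v ⟫⇓ ws
  runs-sound []       k v refl = [] , refl , []
  runs-sound (g ∷ gs) k v eq with run g k v in eq₁
  ... | just r with runs gs k v in eq₂
  runs-sound (g ∷ gs) k v refl | just r | just us with runs-sound gs k v eq₂
  ... | ws , refl , ds = r ∷ ws , refl , run-sound g k v eq₁ ∷ ds

-- Completeness is stated for all large bounds because a composite evaluation needs one bound that
-- suits all its parts.
Eventually : (ℕ → Set) → Set
Eventually P = ∃ λ K → ∀ k → K ≤ k → P k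

eventually₂ : {P Q R : ℕ → Set} → (∀ k → P k → Q k → R k) → Eventually P → Eventually Q → Eventually R
eventually₂ f (K , p) (L , q) = K ⊔ L , λ k le →
  f k (p k (≤-trans (m≤m⊔n K L) le)) (q k (≤-trans (m≤n⊔m K L) le))

eventually-< : {P : ℕ → ℕ → Set} → ∀ n → (∀ i → i < n → Eventually (P i)) →
               Eventually (λ k → ∀ i → i < n → P i k)
eventually-< zero    f = 0 , λ _ _ _ ()
eventually-< (suc n) f =
  eventually₂ (λ k → <-suc-elim) (eventually-< n (λ i i<n → f i (m≤n⇒m≤1+n i<n))) (f n ≤-refl)

muRun-before : ∀ e n → (∀ i → i < n → Nonempty (e (replicate i false))) →
               muRun e n ≡ just (false , replicate n false)
muRun-before e zero    below = refl
muRun-before e (suc n) below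
  rewrite muRun-before e n (λ i i<n → below i (m≤n⇒m≤1+n i<n))
  with below n ≤-refl
... | b , w , eq rewrite eq = refl

muRun-after : ∀ e j → (∀ i → i < j → Nonempty (e (replicate i false))) → e (replicate j false) ≡ just [] →
              ∀ {n} → suc j ≤′ n → muRun e n ≡ just (true , replicate j false)
muRun-after e j below at ≤′-refl rewrite muRun-before e j below | at = refl
muRun-after e j below at (≤′-step le) rewrite muRun-after e j below at le = refl

mutual
  run-complete : {f : Rec n} {v : Vec Str n} {r : Str} → f ⟨ v ⟩⇓ r → Eventually (λ k → run f k v ≡ just r)
  run-complete ⇓empty           = 0 , λ _ _ → refl
  run-complete ⇓prefix          = 0 , λ _ _ → refl
  run-complete {v = v} (⇓proj i) = 0 , λ _ _ → cong just (eval-arg i v)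
  run-complete (⇓comp ds d)     = eventually₂
    (λ { k eqs eq → trans (cong (maybe′ _ nothing) eqs) eq }) (runs-complete ds) (run-complete d)
  run-complete (⇓rec-[] d)      = run-complete d
  run-complete {f = rec f h} {v = _ ∷ v} (⇓rec-∷ {b = b} {w} d e) = eventually₂
    (λ k eq₁ eq₂ → trans (cong (maybe′ (λ r → run (h b) k (w ∷ r ∷ v)) nothing) eq₁) eq₂)
    (run-complete d) (run-complete e)
  run-complete {f = mu f} {v = v} (⇓mu j below at) = eventually₂
    (λ { k bs (a , le) → cong (maybe′ (λ s → if proj₁ s then just (proj₂ s) else nothing) nothing)
           (muRun-after (λ s → run f k (s ∷ v)) j bs a (≤⇒≤′ le)) })
    (eventually-< j (λ i i<j → mu-below (below i i<j)))
    -- The word of `j` zeros is tested in step `suc j` of the search.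
    (eventually₂ (λ _ → _,_) (run-complete at) (suc j , λ _ le → le))

  mu-below : {f : Rec n} {v : Vec Str n} → (∃₂ λ b w → f ⟨ v ⟩⇓ (b ∷ w)) → Eventually (λ k → Nonempty (run f k v))
  mu-below (b , w , d) = let K , p = run-complete d in K , λ k le → b , w , p k le

  runs-complete : {gs : Vec (Rec n) m} {v : Vec Str n} {us : Vec Str m} → gs ⟪ v ⟫⇓ us →
                  Eventually (λ k → runs gs k v ≡ just (toList us))
  runs-complete []       = 0 , λ _ _ → refl
  runs-complete (d ∷ ds) = eventually₂ (λ { k eq₁ eq₂ → cong₂-maybe eq₁ eq₂ }) (run-complete d) (runs-complete ds)
    where
    cong₂-maybe : {x : Maybe Str} {xs : Maybe (List Str)} {r : Str} {us : List Str} → x ≡ just r → xs ≡ just us →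
      maybe′ (λ r → maybe′ (λ us → just (r ∷ us)) nothing xs) nothing x ≡ just (r ∷ us)
    cong₂-maybe refl refl = refl

-- Semidecision by unbounded search

-- The successor in bijective base two, lowest digit first. Iterating it reaches every word, whereas
-- `mu` by itself runs through words of zeros only.
sucStr : Str → Str
sucStr = recStr (false ∷ []) (λ b w r → if b then false ∷ r else true ∷ w)

nthStr : ℕ → Str
nthStr = recNat [] (λ _ → sucStr)

sucStrᵗ : Tm (str ∷ []) str
sucStrᵗ = strRec v0 (false ◂ ε) λ { true → false ◂ v1 ; false → true ◂ v0 }

nthStrᵗ : Tm (nat ∷ []) str
nthStrᵗ = natRec v0 ε (call sucStrᵗ (v1 ∷ []))

eval-sucStr : ∀ w → eval sucStrᵗ (w ∷ []) ≡ sucStr w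
eval-sucStr w = recStr-cong {f = id} refl (λ { true _ _ → refl ; false _ _ → refl }) w

recNat-ext : {z z′ : A} {s s′ : ℕ → A → A} → z ≡ z′ → (∀ n r → s n r ≡ s′ n r) →
             ∀ n → recNat z s n ≡ recNat z′ s′ n
recNat-ext p q zero    = p
recNat-ext {s′ = s′} p q (suc n) = trans (q n _) (cong (s′ n) (recNat-ext p q n))

eval-nthStr : ∀ k → eval nthStrᵗ (k ∷ []) ≡ nthStr k
eval-nthStr k = recNat-ext refl (λ _ → eval-sucStr) k

-- Two successor steps add one to the word behind the first letter.
nthStr-surjective : ∀ w → ∃ λ k → nthStr k ≡ w
nthStr-surjective []      = 0 , refl
nthStr-surjective (b ∷ w) with nthStr-surjective w
... | k , refl = at b
  where
  double : ℕ → ℕ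
  double zero    = zero
  double (suc n) = suc (suc (double n))
  even : ∀ n → nthStr (suc (double n)) ≡ false ∷ nthStr n
  even zero    = refl
  even (suc n) = cong (sucStr ∘ sucStr) (even n)
  at : ∀ b → ∃ λ j → nthStr j ≡ b ∷ nthStr k
  at false = suc (double k) , even k
  at true  = suc (suc (double k)) , cong sucStr (even k)

weaken : (∀ {τ} → τ ∈ Γ → τ ∈ Δ) → All (Tm Δ) Γ
weaken f = All.tabulate (var ∘ f)

evals-weaken : {Γ : List Ty} (f : ∀ {τ} → τ ∈ Γ → τ ∈ Δ) (ρ : Env Γ) (ρ′ : Env Δ) →
  (∀ {τ} (i : τ ∈ Γ) → All.lookup ρ′ (f i) ≡ All.lookup ρ i) → evals (weaken f) ρ′ ≡ ρ
evals-weaken f []      ρ′ eq = refl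
evals-weaken f (a ∷ ρ) ρ′ eq = cong₂ _∷_ (eq (here refl)) (evals-weaken (f ∘ there) ρ ρ′ (eq ∘ there))

private
  -- `mu` stops at an empty value, so success has to be the empty word.
  testᵗ : Tm (str ∷ Γ) bool → Tm (nat ∷ Γ) str
  testᵗ c = ite (call c (call nthStrᵗ (v0 ∷ []) ∷ weaken there)) ε (false ◂ ε)

  eval-test : (c : Tm (str ∷ Γ) bool) (ρ : Env Γ) (k : ℕ) →
    eval (testᵗ c) (k ∷ ρ) ≡ (if eval c (nthStr k ∷ ρ) then [] else false ∷ [])
  eval-test c ρ k = cong₂ (λ z ρ′ → if eval c (z ∷ ρ′) then [] else false ∷ [])
    (eval-nthStr k) (evals-weaken there ρ (k ∷ ρ) (λ _ → refl))

-- The domain is the projection of a decidable relation. The value is the index of a witness, from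
-- which `extension` recovers the witness.
search : Tm (str ∷ Γ) bool → Rec (length Γ)
search c = mu (codeᵀ (compile (testᵗ c)))

least : (P : ℕ → Bool) → ∀ k → P k ≡ true → ∃ λ j → (∀ i → i < j → P i ≡ false) × P j ≡ true
least P k eq with P 0 in eq₀
... | true  = 0 , (λ _ ()) , eq₀
least P zero    eq | false = case trans (sym eq₀) eq of λ ()
least P (suc k) eq | false with least (P ∘ suc) k eq
... | j , below , at = suc j , (λ { zero _ → eq₀ ; (suc i) (s≤s i<j) → below i i<j }) , at

module _ (c : Tm (str ∷ Γ) bool) (ρ : Env Γ) where
  private
    test⇓ : ∀ k {r} → (if eval c (nthStr k ∷ ρ) then [] else false ∷ []) ≡ r →
            codeᵀ (compile (testᵗ c)) ⟨ replicate k false ∷ encs ρ ⟩⇓ r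
    test⇓ k eq = subst (_ ⟨ _ ⟩⇓_) (trans (eval-test c ρ k) eq) (compile⇓ (testᵗ c) (k ∷ ρ))

  search⇓ : (∃ λ z → eval c (z ∷ ρ) ≡ true) →
    ∃ λ k → (search c ⟨ encs ρ ⟩⇓ replicate k false) × eval c (nthStr k ∷ ρ) ≡ true
  search⇓ (z , eq) with nthStr-surjective z
  ... | k , refl with least (λ k → eval c (nthStr k ∷ ρ)) k eq
  ... | j , below , at = j
    , ⇓mu j (λ i i<j → false , [] , test⇓ i (cong (if_then [] else _) (below i i<j)))
            (test⇓ j (cong (if_then [] else _) at))
    , at

-- Both derivations are reproduced by the function `run` at a common bound, which gives determinism
-- without an induction on derivations.
⇓-functional : {f : Rec n} {v : Vec Str n} {r s : Str} → f ⟨ v ⟩⇓ r → f ⟨ v ⟩⇓ s → r ≡ s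
⇓-functional {f = f} d e with run-complete d | run-complete e
... | K , p | L , q = just-injective (trans (sym (p (K ⊔ L) (m≤m⊔n K L))) (q (K ⊔ L) (m≤n⊔m K L)))

search⇓⁻¹ : (c : Tm (str ∷ Γ) bool) (ρ : Env Γ) → ∀ {r} → search c ⟨ encs ρ ⟩⇓ r →
  ∃ λ z → eval c (z ∷ ρ) ≡ true
search⇓⁻¹ c ρ (⇓mu k _ d) = nthStr k ,
  at (eval c (nthStr k ∷ ρ)) (trans (sym (eval-test c ρ k)) (⇓-functional (compile⇓ (testᵗ c) (k ∷ ρ)) d))
  where
  at : ∀ b → (if b then [] else false ∷ []) ≡ [] → b ≡ true
  at true  _ = refl
  at false ()

search-⇔ : (c : Tm (str ∷ Γ) bool) (ρ : Env Γ) →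
  (∃ λ z → eval c (z ∷ ρ) ≡ true) ⇔ (∃ λ r → search c ⟨ encs ρ ⟩⇓ r)
search-⇔ c ρ = mk⇔ (λ e → let k , d , _ = search⇓ c ρ e in _ , d) (λ { (_ , d) → search⇓⁻¹ c ρ d })

-- Equality tests and basic word operations as typed programs

bitsᵗ : Tm (str ∷ []) (list bool)
bitsᵗ = strRec v0 nil (λ b → cons (if b then tt else ff) v1)

eval-bits : ∀ w → eval bitsᵗ (w ∷ []) ≡ w
eval-bits w = trans (recStr-cong {f = id} refl (λ { true _ _ → refl ; false _ _ → refl }) w) (recStr-∷ w)
  where
  recStr-∷ : ∀ w → recStr [] (λ b _ → b ∷_) w ≡ w
  recStr-∷ []      = refl
  recStr-∷ (b ∷ w) = cong (b ∷_) (recStr-∷ w)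

-- Recursion consumes one word only, so one of the two words is folded as a list of letters. The
-- accumulator holds the verdict so far and the part of the other word not yet compared.
eqStep : Tm (bool ∷ (bool ⊗ str) ∷ Γ) (bool ⊗ str)
eqStep = strRec (snd v1) (ff ,, ε)
  (λ b → ite v2 (if b then fst v3 else ff) (if b then ff else fst v3) ,, v0)

eqStrᵗ : Tm (str ∷ str ∷ []) bool
eqStrᵗ = ite (fst s) (strRec (snd s) tt (λ _ → ff)) ff
  where
  s : Tm (str ∷ str ∷ []) (bool ⊗ str)
  s = fold (call bitsᵗ (v0 ∷ [])) (tt ,, v1) eqStep

module _ {ρ : Env Γ} where
  private
    step : Bool × Str → Bool → Bool × Str
    step s a = eval {Γ = bool ∷ (bool ⊗ str) ∷ Γ} eqStep (a ∷ s ∷ ρ)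

    holds : Bool × Str → Bool
    holds s = if proj₁ s then recStr true (λ _ _ _ → false) (proj₂ s) else false

    step-false : ∀ y a → ∃ λ y′ → step (false , y) a ≡ (false , y′)
    step-false []          a     = [] , refl
    step-false (true ∷ y)  true  = y , refl
    step-false (true ∷ y)  false = y , refl
    step-false (false ∷ y) true  = y , refl
    step-false (false ∷ y) false = y , refl

    foldl-false : ∀ x y → holds (foldl step (false , y) x) ≡ false
    foldl-false []      y = refl
    foldl-false (a ∷ x) y with step (false , y) a | step-false y a
    ... | _ | y′ , refl = foldl-false x y′

  foldl-sound : ∀ x y → holds (foldl step (true , y) x) ≡ true → x ≡ y
  foldl-sound []          []          eq = refl
  foldl-sound (a ∷ x)     []          eq = case trans (sym eq) (foldl-false x []) of λ ()
  foldl-sound (true ∷ x)  (true ∷ y)  eq = cong (true ∷_) (foldl-sound x y eq)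
  foldl-sound (false ∷ x) (false ∷ y) eq = cong (false ∷_) (foldl-sound x y eq)
  foldl-sound (true ∷ x)  (false ∷ y) eq = case trans (sym eq) (foldl-false x y) of λ ()
  foldl-sound (false ∷ x) (true ∷ y)  eq = case trans (sym eq) (foldl-false x y) of λ ()

  foldl-complete : ∀ x → holds (foldl step (true , x) x) ≡ true
  foldl-complete []          = refl
  foldl-complete (true ∷ x)  = foldl-complete x
  foldl-complete (false ∷ x) = foldl-complete x

eqStr-sound : ∀ x y → eval eqStrᵗ (x ∷ y ∷ []) ≡ true → x ≡ y
eqStr-sound x y eq rewrite eval-bits x = foldl-sound x y eq

eqStr-complete : ∀ x → eval eqStrᵗ (x ∷ x ∷ []) ≡ true
eqStr-complete x rewrite eval-bits x = foldl-complete x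

-- The components are those of `Tape` and `Config` in the same order, with states and symbols as
-- numbers and the scanned input cell coded by 0, 1 or 2.
tapeᵀ confᵀ : Ty
tapeᵀ = list nat ⊗ nat ⊗ list nat
confᵀ = nat ⊗ nat ⊗ str ⊗ list tapeᵀ

unaryᵗ : Tm (nat ∷ []) str
unaryᵗ = natRec v0 ε (false ◂ v1)

eval-unary : ∀ n → eval unaryᵗ (n ∷ []) ≡ replicate n false
eval-unary n = trans (recNat-ext refl (λ _ _ → refl) n) (go n)
  where
  go : ∀ n → recNat [] (λ _ → false ∷_) n ≡ replicate n false
  go zero    = refl
  go (suc n) = cong (false ∷_) (go n)

eqNatᵗ : Tm (nat ∷ nat ∷ []) bool
eqNatᵗ = call eqStrᵗ (call unaryᵗ (v0 ∷ []) ∷ call unaryᵗ (v1 ∷ []) ∷ [])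

eqNat-sound : ∀ m n → eval eqNatᵗ (m ∷ n ∷ []) ≡ true → m ≡ n
eqNat-sound m n eq = trans (sym (length-replicate m)) (trans
  (cong length (trans (sym (eval-unary m)) (trans (eqStr-sound _ _ eq) (eval-unary n)))) (length-replicate n))

eqNat-complete : ∀ n → eval eqNatᵗ (n ∷ n ∷ []) ≡ true
eqNat-complete n = eqStr-complete (eval unaryᵗ (n ∷ []))

appendᵗ : Tm (str ∷ str ∷ []) str
appendᵗ = strRec v0 v1 (λ b → b ◂ v1)

eval-append : ∀ x y → eval appendᵗ (x ∷ y ∷ []) ≡ x ++ y
eval-append x y = trans (recStr-cong {f = id} refl (λ _ _ _ → refl) x) (go x)
  where
  go : ∀ x → recStr y (λ b _ → b ∷_) x ≡ x ++ y
  go []      = refl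
  go (b ∷ x) = cong (b ∷_) (go x)

-- Words as lists of unary numbers

-- Recursion starts at the right end, where a numeral has its final 0: each 0 opens a number and
-- each 1 in front of it adds one.
numsᵗ : Tm (str ∷ []) (list nat)
numsᵗ = strRec v0 nil λ
  { false → cons ze v1
  ; true  → lstCase v1 nil (cons (su v0) v1)
  }

raise : List ℕ → List ℕ
raise = caseList [] (λ n → suc n ∷_)

nums : Str → List ℕ
nums = recStr [] (λ b _ ns → if b then raise ns else 0 ∷ ns)

eval-nums : ∀ w → eval numsᵗ (w ∷ []) ≡ nums w
eval-nums w = recStr-cong {f = id} refl
  (λ { false _ _ → refl ; true _ [] → refl ; true _ (_ ∷ _) → refl }) w

nums-⌜⌝ : ∀ n w → nums (⌜ n ⌝ ++ w) ≡ n ∷ nums w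
nums-⌜⌝ zero    w = refl
nums-⌜⌝ (suc n) w rewrite nums-⌜⌝ n w = refl

-- In the code of an action a raw bit precedes a numeral 1ⁿ0: the bit 0 reads as a
-- number of its own, while the bit 1 merges with the numeral to 1ⁿ⁺¹0.
unbit : Bool → List ℕ → List ℕ
unbit b ns = if b then raise ns else 0 ∷ ns

bitᵗ : Tm (list nat ∷ []) (bool ⊗ list nat)
bitᵗ = lstCase v0 (ff ,, nil)
  (natRec v0 (ff ,, v1) (tt ,, cons v0 v3))

eval-bit : ∀ b n ns → eval bitᵗ (unbit b (n ∷ ns) ∷ []) ≡ (b , n ∷ ns)
eval-bit true  n ns = refl
eval-bit false n ns = refl

tailᵗ : Tm (list nat ∷ []) (list nat)
tailᵗ = lstCase v0 nil v1

tailList : List A → List A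
tailList = caseList [] (λ _ as → as)

recNat-outer : (f : A → A) (z : A) → ∀ n → recNat (f z) (λ _ → f) n ≡ f (recNat z (λ _ → f) n)
recNat-outer f z zero    = refl
recNat-outer f z (suc n) = cong f (recNat-outer f z n)

recNat-fixed : (f : A → A) (z : A) → f z ≡ z → ∀ n → recNat z (λ _ → f) n ≡ z
recNat-fixed f z eq zero    = refl
recNat-fixed f z eq (suc n) = trans (cong f (recNat-fixed f z eq n)) eq

dropᵗ : Tm (nat ∷ list nat ∷ []) (list nat)
dropᵗ = natRec v0 v1 (call tailᵗ (v1 ∷ []))

eval-drop-++ : ∀ ns ms → eval dropᵗ (length ns ∷ (ns ++ ms) ∷ []) ≡ ms
eval-drop-++ ns ms = trans (recNat-ext refl (λ _ _ → refl) (length ns)) (go ns)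
  where
  go : ∀ ns → recNat (ns ++ ms) (λ _ → tailList) (length ns) ≡ ms
  go []       = refl
  go (n ∷ ns) = trans (sym (recNat-outer tailList (n ∷ ns ++ ms) (length ns))) (go ns)

eval-drop-[] : ∀ n → eval dropᵗ (n ∷ [] ∷ []) ≡ []
eval-drop-[] n = trans (recNat-ext refl (λ _ _ → refl) n) (recNat-fixed tailList [] refl n)

dropPairsᵗ : Tm (nat ∷ list nat ∷ []) (list nat)
dropPairsᵗ = natRec v0 v1 (call tailᵗ (call tailᵗ (v1 ∷ []) ∷ []))

flatten : List (ℕ × ℕ) → List ℕ → List ℕ
flatten []             ns = ns
flatten ((a , d) ∷ ws) ns = a ∷ d ∷ flatten ws ns

eval-dropPairs-flatten : ∀ ws ms → eval dropPairsᵗ (length ws ∷ flatten ws ms ∷ []) ≡ ms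
eval-dropPairs-flatten ws ms = trans (recNat-ext refl (λ _ _ → refl) (length ws)) (go ws)
  where
  go : ∀ ws → recNat (flatten ws ms) (λ _ → tailList ∘ tailList) (length ws) ≡ ms
  go []       = refl
  go (w ∷ ws) = trans (sym (recNat-outer (tailList ∘ tailList) (flatten (w ∷ ws) ms) (length ws))) (go ws)

eval-dropPairs-[] : ∀ n → eval dropPairsᵗ (n ∷ [] ∷ []) ≡ []
eval-dropPairs-[] n = trans (recNat-ext refl (λ _ _ → refl) n) (recNat-fixed (tailList ∘ tailList) [] refl n)

-- Instruction tables

record Entry : Set where
  constructor entry
  field
    key    : List ℕ
    target : ℕ
    reads  : Bool
    writes : List (ℕ × ℕ)

open Entry

actionNums : ℕ → Bool → List (ℕ × ℕ) → List ℕ → List ℕ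
actionNums q b ws ns = q ∷ unbit b (flatten ws ns)

tableNums : List Entry → List ℕ → List ℕ
tableNums []                     ns = ns
tableNums (entry κ q b ws ∷ es) ns = κ ++ actionNums q b ws (tableNums es ns)

stripᵗ : Tm (list nat ∷ list nat ∷ []) (opt (list nat))
stripᵗ = fold v0 (some v1)
  (optCase v1 none (lstCase v0 none (ite (call eqNatᵗ (v0 ∷ v3 ∷ [])) (some v1) none)))

strip : List ℕ → List ℕ → Maybe (List ℕ)
strip κ ns = eval stripᵗ (κ ∷ ns ∷ [])

-- With `k` tapes an entry consists of `2 + k` numbers of the key, one for the new state, the bit,
-- and `k` pairs.
skipᵗ : Tm (nat ∷ list nat ∷ []) (list nat)
skipᵗ = call dropPairsᵗ (v0 ∷ snd (call bitᵗ (call dropᵗ (su (su (su v0)) ∷ v1 ∷ []) ∷ [])) ∷ [])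

skip : ℕ → List ℕ → List ℕ
skip k ns = eval skipᵗ (k ∷ ns ∷ [])

-- The table is folded over itself merely as a counter, since it has at least as many numbers as
-- entries. A round skips one entry, unless the key is already in front; then the position stays
-- fixed.
findᵗ : Tm (list nat ∷ nat ∷ list nat ∷ []) (opt (list nat))
findᵗ = call stripᵗ (v0 ∷ fold v2 v2 (optCase (call stripᵗ (v2 ∷ v1 ∷ [])) (call skipᵗ (v3 ∷ v1 ∷ [])) v2) ∷ [])

find : List ℕ → ℕ → List ℕ → Maybe (List ℕ)
find κ k ns = eval findᵗ (κ ∷ k ∷ ns ∷ [])

private
  stripStep : Maybe (List ℕ) → ℕ → Maybe (List ℕ)
  stripStep r n = maybe′ (caseList nothing (λ m ns → if eval eqNatᵗ (m ∷ n ∷ []) then just ns else nothing)) nothing r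

  strip-nothing : ∀ κ → foldl stripStep nothing κ ≡ nothing
  strip-nothing []      = refl
  strip-nothing (n ∷ κ) = strip-nothing κ

  strip-complete : ∀ κ ns → foldl stripStep (just (κ ++ ns)) κ ≡ just ns
  strip-complete []      ns = refl
  strip-complete (n ∷ κ) ns rewrite eqNat-complete n = strip-complete κ ns

  strip-sound : ∀ κ κ′ ns {r} → length κ ≡ length κ′ → foldl stripStep (just (κ′ ++ ns)) κ ≡ just r → κ ≡ κ′
  strip-sound []      []        ns _ _ = refl
  strip-sound (n ∷ κ) (n′ ∷ κ′) ns l eq with eval eqNatᵗ (n′ ∷ n ∷ []) in e
  ... | true  = cong₂ _∷_ (sym (eqNat-sound n′ n e)) (strip-sound κ κ′ ns (suc-injective l) eq)
  ... | false = case trans (sym eq) (strip-nothing κ) of λ ()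

-- The writes are nonempty because `bitᵗ` undoes `unbit` only in front of a number; machines have at
-- least one work tape.
WellFormed : ℕ → Entry → Set
WellFormed k e = length (key e) ≡ 2 + k × ∃ λ w → ∃ λ ws → writes e ≡ w ∷ ws × length (w ∷ ws) ≡ k

skip-entry : ∀ {k e} es ns → WellFormed k e → skip k (tableNums (e ∷ es) ns) ≡ tableNums es ns
skip-entry {e = entry κ q b .((a , d) ∷ ws)} es ns (len , (a , d) , ws , refl , refl)
  rewrite sym (++-assoc κ (q ∷ []) (unbit b (flatten ((a , d) ∷ ws) (tableNums es ns))))
  with cong suc len
... | len′ = begin
  eval dropPairsᵗ (suc (length ws) ∷ proj₂ (eval bitᵗ (eval dropᵗ (suc (2 + suc (length ws)) ∷ ((κ ++ q ∷ []) ++ rest) ∷ []) ∷ [])) ∷ [])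
    ≡⟨ cong (λ j → eval dropPairsᵗ (suc (length ws) ∷ proj₂ (eval bitᵗ (eval dropᵗ (j ∷ ((κ ++ q ∷ []) ++ rest) ∷ []) ∷ [])) ∷ []))
         (trans (sym len′) (sym (trans (length-++ κ) (+-comm (length κ) 1)))) ⟩
  eval dropPairsᵗ (suc (length ws) ∷ proj₂ (eval bitᵗ (eval dropᵗ (length (κ ++ q ∷ []) ∷ ((κ ++ q ∷ []) ++ rest) ∷ []) ∷ [])) ∷ [])
    ≡⟨ cong (λ l → eval dropPairsᵗ (suc (length ws) ∷ proj₂ (eval bitᵗ (l ∷ [])) ∷ [])) (eval-drop-++ (κ ++ q ∷ []) rest) ⟩
  eval dropPairsᵗ (suc (length ws) ∷ proj₂ (eval bitᵗ (rest ∷ [])) ∷ [])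
    ≡⟨ cong (λ p → eval dropPairsᵗ (suc (length ws) ∷ proj₂ p ∷ [])) (eval-bit b a (d ∷ flatten ws (tableNums es ns))) ⟩
  eval dropPairsᵗ (length ((a , d) ∷ ws) ∷ flatten ((a , d) ∷ ws) (tableNums es ns) ∷ [])
    ≡⟨ eval-dropPairs-flatten ((a , d) ∷ ws) (tableNums es ns) ⟩
  tableNums es ns ∎
  where
  open ≡-Reasoning
  rest : List ℕ
  rest = unbit b (flatten ((a , d) ∷ ws) (tableNums es ns))

skip-[] : ∀ k → skip k [] ≡ []
skip-[] k rewrite eval-drop-[] (3 + k) = eval-dropPairs-[] k

from : List ℕ → List Entry → List Entry
from κ []       = []
from κ (e ∷ es) with ≡-dec _≟_ κ (key e)
... | yes _ = e ∷ es
... | no  _ = from κ es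

length-tableNums : ∀ es → length es ≤ length (tableNums es [])
length-tableNums []                  = z≤n
length-tableNums (entry κ q b ws ∷ es) = ≤-trans
  (s≤s (≤-trans (length-tableNums es) (≤-trans (flatten≥ ws (tableNums es [])) (unbit≥ b (flatten ws (tableNums es []))))))
  (subst (suc (length (unbit b (flatten ws (tableNums es [])))) ≤_) (sym (length-++ κ)) (m≤n+m _ (length κ)))
  where
  flatten≥ : ∀ ws ns → length ns ≤ length (flatten ws ns)
  flatten≥ []       ns = ≤-refl
  flatten≥ (_ ∷ ws) ns = m≤n⇒m≤1+n (m≤n⇒m≤1+n (flatten≥ ws ns))
  unbit≥ : ∀ b ns → length ns ≤ length (unbit b ns)
  unbit≥ true  []       = z≤n
  unbit≥ true  (_ ∷ ns) = ≤-refl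
  unbit≥ false ns       = m≤n⇒m≤1+n ≤-refl

module _ (κ₀ : ℕ) (κ′ : List ℕ) (k : ℕ) (len : length (κ₀ ∷ κ′) ≡ 2 + k) where
  private
    κ : List ℕ
    κ = κ₀ ∷ κ′

    findStep : List ℕ → List ℕ
    findStep ns = maybe′ (λ _ → ns) (skip k ns) (strip κ ns)

    findLoop : List ℕ → List ℕ → List ℕ
    findLoop = foldl (λ ns _ → findStep ns)

    findLoop-fixed : ∀ ns → findStep ns ≡ ns → ∀ l → findLoop ns l ≡ ns
    findLoop-fixed ns eq []      = refl
    findLoop-fixed ns eq (_ ∷ l) = trans (cong (λ ms → findLoop ms l) eq) (findLoop-fixed ns eq l)

    findLoop-from : ∀ es l → All (WellFormed k) es → length es ≤ length l →
                    findLoop (tableNums es []) l ≡ tableNums (from κ es) []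
    findLoop-from []       l       []       _        = findLoop-fixed [] (trans (cong (maybe′ _ (skip k []))
      (strip-nothing κ′)) (skip-[] k)) l
    findLoop-from (e ∷ es) (i ∷ l) (w ∷ ws) (s≤s le) with ≡-dec _≟_ κ (key e)
    ... | yes refl = findLoop-fixed _ (cong (maybe′ (λ _ → tableNums (e ∷ es) []) (skip k (tableNums (e ∷ es) []))) (strip-complete (key e) (actionNums (target e) (reads e) (writes e) (tableNums es [])))) (i ∷ l)
    ... | no  κ≢   with strip κ (tableNums (e ∷ es) []) in eq
    ...   | just _  = contradiction (strip-sound κ (key e) _ (trans len (sym (proj₁ w))) eq) κ≢
    ...   | nothing = trans (cong (λ ns → findLoop ns l) (skip-entry es [] w)) (findLoop-from es l ws le)

  find-from : ∀ es → All (WellFormed k) es → find κ k (tableNums es []) ≡ strip κ (tableNums (from κ es) [])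
  find-from es ws = cong (strip κ) (findLoop-from es (tableNums es []) ws (length-tableNums es))

  find-absent : ∀ es → All (WellFormed k) es → All (λ e → key e ≢ κ) es → find κ k (tableNums es []) ≡ nothing
  find-absent es ws ps = trans (find-from es ws) (trans (cong (λ es′ → strip κ (tableNums es′ [])) (absent es ps)) (strip-nothing κ′))
    where
    absent : ∀ es → All (λ e → key e ≢ κ) es → from κ es ≡ []
    absent []       []       = refl
    absent (e ∷ es) (p ∷ ps) with ≡-dec _≟_ κ (key e)
    ... | yes eq = contradiction (sym eq) p
    ... | no  _  = absent es ps

  find-present : ∀ es {q b vs} → All (WellFormed k) es → entry κ q b vs ∈ es →
    All (λ e → key e ≡ κ → e ≡ entry κ q b vs) es →
    ∃ λ ns → find κ k (tableNums es []) ≡ just (actionNums q b vs ns)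
  find-present es {q} {b} {vs} ws i uniq with present es i uniq
    where
    present : ∀ es → entry κ q b vs ∈ es → All (λ e → key e ≡ κ → e ≡ entry κ q b vs) es →
              ∃ λ es′ → from κ es ≡ entry κ q b vs ∷ es′
    present (e ∷ es) i (u ∷ us) with ≡-dec _≟_ κ (key e) | i
    ... | yes eq | _ rewrite u (sym eq) = es , refl
    ... | no  ne | here refl = contradiction refl ne
    ... | no  ne | there j   = present es j us
  ... | es′ , eq = tableNums es′ [] , trans (find-from es ws)
    (trans (cong (λ es′ → strip κ (tableNums es′ [])) eq) (strip-complete κ (actionNums q b vs (tableNums es′ []))))

-- A simulator of Turing machines on numerical configurations

Tapeℕ Confℕ : Set
Tapeℕ = ⟦ tapeᵀ ⟧
Confℕ = ⟦ confᵀ ⟧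

reverseᵗ : Tm (list τ ∷ []) (list τ)
reverseᵗ = fold v0 nil (cons v0 v1)

keyᵗ : Tm (confᵀ ∷ []) (list nat)
keyᵗ = cons (fst v0) (cons (fst (snd v0))
  (fold (call reverseᵗ (snd (snd (snd v0)) ∷ [])) nil (cons (fst (snd v0)) v1)))

keyOf : Confℕ → List ℕ
keyOf (q , a , _ , ts) = q ∷ a ∷ map (proj₁ ∘ proj₂) ts

eval-key : ∀ c → eval keyᵗ (c ∷ []) ≡ keyOf c
eval-key (q , a , u , ts) = cong (λ l → q ∷ a ∷ l)
  (trans (reverse-foldl (λ l t → proj₁ (proj₂ t) ∷ l) [] ts) (go ts))
  where
  go : ∀ (ts : List Tapeℕ) → foldr (λ t l → proj₁ (proj₂ t) ∷ l) [] ts ≡ map (proj₁ ∘ proj₂) ts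
  go []       = refl
  go (t ∷ ts) = cong (_ ∷_) (go ts)

-- The moves left, stay and right are numbered 0, 1 and 2.
updᵗ : Tm (nat ∷ nat ∷ tapeᵀ ∷ []) tapeᵀ
updᵗ = natRec v1
  (lstCase (fst v2)
    (nil ,, ze ,, cons v0 (snd (snd v2)))
    (v1 ,, v0 ,, cons v2 (snd (snd v4))))
  (natRec v0
    (fst v4 ,, v2 ,, snd (snd v4))
    (lstCase (snd (snd (var (there (there (there (there (there (there (here refl)))))))))) 
      (cons v4 (fst (var (there (there (there (there (there (there (here refl))))))))) ,, ze ,, nil)
      (cons (var (there (there (there (there (there (there (here refl))))))))
            (fst (var (there (there (there (there (there (there (there (there (here refl)))))))))))
        ,, v0 ,, v1)))

upd : ℕ × ℕ → Tapeℕ → Tapeℕ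
upd (a , d) t = eval updᵗ (a ∷ d ∷ t ∷ [])

updatesᵗ : Tm (list nat ∷ list tapeᵀ ∷ []) (list tapeᵀ)
updatesᵗ = call reverseᵗ (snd (fold v1 (v0 ,, nil)
  (lstCase (fst v1) v1 (lstCase v1 v3 (v1 ,, cons (call updᵗ (v2 ∷ v0 ∷ v4 ∷ [])) (snd v5))))) ∷ [])

eval-updates : ∀ ws ts ns → length ws ≡ length ts →
  eval updatesᵗ (flatten ws ns ∷ ts ∷ []) ≡ zipWith upd ws ts
eval-updates ws ts ns len = trans (cong (reverse ∘ proj₂) (go ws ts [] len))
  (trans (reverse-++ (reverse (zipWith upd ws ts)) []) (reverse-involutive (zipWith upd ws ts)))
  where
  simStep : List ℕ × List Tapeℕ → Tapeℕ → List ℕ × List Tapeℕ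
  simStep s t = caseList s (λ a r → caseList s (λ d r′ → r′ , upd (a , d) t ∷ proj₂ s) r) (proj₁ s)
  go : ∀ ws ts done → length ws ≡ length ts →
       foldl simStep (flatten ws ns , done) ts ≡ (ns , reverse (zipWith upd ws ts) ++ done)
  go []       []       done _   = refl
  go (w ∷ ws) (t ∷ ts) done len = trans (go ws ts (upd w t ∷ done) (suc-injective len))
    (cong (ns ,_) (trans (sym (++-assoc (reverse (zipWith upd ws ts)) (upd w t ∷ []) done))
      (cong (_++ done) (sym (unfold-reverse (upd w t) (zipWith upd ws ts))))))

advanceᵗ : Tm (nat ∷ (bool ⊗ list nat) ∷ confᵀ ∷ []) (opt confᵀ)
advanceᵗ = ite (fst v1)
  (strRec (fst (snd (snd v2))) none
    (λ b → some (v2 ,, (if b then su (su ze) else su ze) ,, v0 ,, call updatesᵗ (snd v3 ∷ snd (snd (snd v4)) ∷ []))))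
  (some (v0 ,, fst (snd v2) ,, fst (snd (snd v2)) ,, call updatesᵗ (snd v1 ∷ snd (snd (snd v2)) ∷ [])))

-- A configuration without applicable instruction is its own successor; the result is
-- none if the machine tries to read beyond the end of the input.
stepᵗ : Tm (confᵀ ∷ nat ∷ list nat ∷ []) (opt confᵀ)
stepᵗ = optCase (call findᵗ (call keyᵗ (v0 ∷ []) ∷ v1 ∷ v2 ∷ [])) (some v0)
  (lstCase v0 (some v1) (call advanceᵗ (v0 ∷ call bitᵗ (v1 ∷ []) ∷ v3 ∷ [])))

iterateᵗ : Tm (nat ∷ confᵀ ∷ nat ∷ list nat ∷ []) (opt confᵀ)
iterateᵗ = natRec v0 (some v1) (optCase v1 none (call stepᵗ (v0 ∷ v5 ∷ var (there (there (there (there (there (there (here refl))))))) ∷ [])))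

haltedᵗ : Tm (confᵀ ∷ nat ∷ list nat ∷ []) bool
haltedᵗ = optCase (call findᵗ (call keyᵗ (v0 ∷ []) ∷ v1 ∷ v2 ∷ [])) tt ff

-- The unread rest of the input once the machine has stopped.
simulateᵗ : Tm (nat ∷ str ∷ str ∷ []) (opt str)
simulateᵗ = lstCase (call numsᵗ (v1 ∷ [])) none
  (lstCase v1 none
    (lstCase v1 none
      (call outcomeᵗ (var (there (there (there (there (there (there (here refl)))))))
        ∷ (ze ,, ze ,, var (there (there (there (there (there (there (there (there (here refl)))))))))
           -- `v4` is the first number of the code, which is one less than the number of tapes.
           ,, natRec (su v4) nil (cons (nil ,, ze ,, nil) v1))
        ∷ su v4 ∷ v1 ∷ []))))
  where
  outcomeᵗ : Tm (nat ∷ confᵀ ∷ nat ∷ list nat ∷ []) (opt str)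
  outcomeᵗ = optCase (call iterateᵗ (v0 ∷ v1 ∷ v2 ∷ v3 ∷ [])) none
    (ite (call haltedᵗ (v0 ∷ v3 ∷ v4 ∷ [])) (some (fst (snd (snd v0)))) none)

module _ (k : ℕ) (T : List ℕ) where

  simStep : Confℕ → Maybe Confℕ
  simStep c = eval stepᵗ (c ∷ k ∷ T ∷ [])

  halted : Confℕ → Bool
  halted c = eval haltedᵗ (c ∷ k ∷ T ∷ [])

  simSteps : ℕ → Confℕ → Maybe Confℕ
  simSteps n c = recNat (just c) (λ _ → maybe′ simStep nothing) n

  halted-step : ∀ c → halted c ≡ true → simStep c ≡ just c
  halted-step c eq with find (eval keyᵗ (c ∷ [])) k T
  ... | nothing = refl

  extend : Str → Confℕ → Confℕ
  extend v (q , a , u , ts) = q , a , u ++ v , ts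

  -- A step notices the end of the input only by failing, so appending letters does not disturb a
  -- step that succeeds. The monotonicity of `stoppingMode` rests on this.
  step-extend : ∀ v c {c′} → simStep c ≡ just c′ → simStep (extend v c) ≡ just (extend v c′)
  step-extend v c@(q , a , u , ts) eq with find (eval keyᵗ (c ∷ [])) k T
  step-extend v (q , a , u , ts) refl | nothing = refl
  step-extend v (q , a , u , ts) refl | just [] = refl
  step-extend v (q , a , u , ts) eq | just (n ∷ ns) with eval bitᵗ (ns ∷ [])
  step-extend v (q , a , u , ts)     refl | just (n ∷ ns) | false , _ = refl
  step-extend v (q , a , true ∷ u , ts)  refl | just (n ∷ ns) | true , _ = refl
  step-extend v (q , a , false ∷ u , ts) refl | just (n ∷ ns) | true , _ = refl

  steps-extend : ∀ v n c {c′} → simSteps n c ≡ just c′ → simSteps n (extend v c) ≡ just (extend v c′)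
  steps-extend v zero    c refl = refl
  steps-extend v (suc n) c eq with simSteps n c in e
  ... | just c″ = trans (cong (maybe′ simStep nothing) (steps-extend v n c e)) (step-extend v c″ eq)

  steps-halted : ∀ {m n c c′} → m ≤′ n → simSteps m c ≡ just c′ → halted c′ ≡ true → simSteps n c ≡ just c′
  steps-halted ≤′-refl       eq h = eq
  steps-halted (≤′-step le)  eq h = trans (cong (maybe′ simStep nothing) (steps-halted le eq h)) (halted-step _ h)

  step-steps : ∀ n {c c′ c″} → simStep c ≡ just c′ → simSteps n c′ ≡ just c″ → simSteps (suc n) c ≡ just c″
  step-steps zero    eq refl = eq
  step-steps (suc n) {c′ = c′} eq eq′ with simSteps n c′ in e
  ... | just _ = trans (cong (maybe′ simStep nothing) (step-steps n eq e)) eq′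

  outcome : ℕ → Confℕ → Maybe Str
  outcome n c = maybe′ (λ c′ → if halted c′ then just (proj₁ (proj₂ (proj₂ c′))) else nothing) nothing (simSteps n c)

  outcome-step : ∀ n {c c′ u} → simStep c ≡ just c′ → outcome n c′ ≡ just u → outcome (suc n) c ≡ just u
  outcome-step n {c} {c′} eq eq′ with simSteps n c′ in e
  ... | just c″ rewrite step-steps n {c} eq e = eq′

  outcome-later : ∀ {m n c u} → m ≤ n → outcome m c ≡ just u → outcome n c ≡ just u
  outcome-later {m} {n} {c} le eq with simSteps m c in e
  ... | just c′ with halted c′ in h
  outcome-later le refl | just c′ | true rewrite steps-halted (≤⇒≤′ le) e h | h = refl

  outcome-extend : ∀ v n c {u} → outcome n c ≡ just u → outcome n (extend v c) ≡ just (u ++ v)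
  outcome-extend v n c eq with simSteps n c in e
  ... | just c′ with halted c′ in h
  outcome-extend v n c refl | just c′ | true rewrite steps-extend v n c e | h = refl

blankTapes : ℕ → List Tapeℕ
blankTapes = recNat [] (λ _ → ([] , 0 , []) ∷_)

simulate : ℕ → Str → Str → Maybe Str
simulate n w x = eval simulateᵗ (n ∷ w ∷ x ∷ [])

simulateNums : ℕ → List ℕ → Str → Maybe Str
simulateNums n ns x = caseList nothing (λ t ns₁ → caseList nothing (λ _ ns₂ → caseList nothing
  (λ _ T → outcome (suc t) T n (0 , 0 , x , blankTapes (suc t))) ns₂) ns₁) ns

simulate-nums : ∀ n w x → simulate n w x ≡ simulateNums n (nums w) x
simulate-nums n w x with eval numsᵗ (w ∷ []) | eval-nums w
... | ns | refl with nums w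
...   | []             = refl
...   | _ ∷ []         = refl
...   | _ ∷ _ ∷ []     = refl
...   | t ∷ _ ∷ _ ∷ T  = cong (λ ts → outcome (suc t) T n (0 , 0 , x , ([] , 0 , []) ∷ ts)) (recNat-ext refl (λ _ _ → refl) t)

simulate-later : ∀ {m n u} w x → m ≤ n → simulate m w x ≡ just u → simulate n w x ≡ just u
simulate-later {m} {n} w x le eq = trans (simulate-nums n w x) (go (nums w) (trans (sym (simulate-nums m w x)) eq))
  where
  go : ∀ ns → simulateNums m ns x ≡ just _ → simulateNums n ns x ≡ just _
  go (t ∷ _ ∷ _ ∷ T) eq = outcome-later (suc t) T {m} {n} le eq

simulate-functional : ∀ m n {u u′} w x → simulate m w x ≡ just u → simulate n w x ≡ just u′ → u ≡ u′
simulate-functional m n w x eq eq′ with ≤-total m n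
... | inj₁ le = just-injective (trans (sym (simulate-later {m} {n} w x le eq)) eq′)
... | inj₂ le = just-injective (trans (sym eq) (simulate-later {n} {m} w x le eq′))

simulate-extend : ∀ v n {u} w x → simulate n w x ≡ just u → simulate n w (x ++ v) ≡ just (u ++ v)
simulate-extend v n w x eq = trans (simulate-nums n w (x ++ v)) (go (nums w) (trans (sym (simulate-nums n w x)) eq))
  where
  go : ∀ ns → simulateNums n ns x ≡ just _ → simulateNums n ns (x ++ v) ≡ just _
  go (t ∷ _ ∷ _ ∷ T) eq = outcome-extend (suc t) T v n _ eq

-- Correctness of the simulation

allVecs-complete : {as : List A} → (∀ a → a ∈ as) → ∀ {k} (v : Vec A k) → v ∈ allVecs as k
allVecs-complete all []      = here refl
allVecs-complete all (a ∷ v) = ∈-concatMap⁺ (λ a → map (a ∷_) (allVecs _ _)) (lose (all a) (∈-map⁺ (a ∷_) (allVecs-complete all v)))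

All-concatMap : {P : B → Set} {f : A → List B} → (∀ a → All P (f a)) → ∀ as → All P (concatMap f as)
All-concatMap p []       = []
All-concatMap p (a ∷ as) = All.++⁺ (p a) (All-concatMap p as)

inputs : List (Maybe Bool)
inputs = nothing ∷ just false ∷ just true ∷ []

-- The continuation `w` makes the relation closed under concatenation: `nums` itself is not a
-- homomorphism, since a trailing block of ones merges with what follows.
Codes : Str → List Entry → Set
Codes s es = ∀ w → nums (s ++ w) ≡ tableNums es (nums w)

tableNums-++ : ∀ es es′ ns → tableNums (es ++ es′) ns ≡ tableNums es (tableNums es′ ns)
tableNums-++ []                     es′ ns = refl
tableNums-++ (entry κ q b ws ∷ es) es′ ns = cong (λ ms → κ ++ actionNums q b ws ms) (tableNums-++ es es′ ns)

Codes-concatMap : {f : A → Str} {g : A → List Entry} → (∀ a → Codes (f a) (g a)) →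
                  ∀ as → Codes (concatMap f as) (concatMap g as)
Codes-concatMap         c []       w = refl
Codes-concatMap {f = f} {g} c (a ∷ as) w = trans (cong nums (++-assoc (f a) _ w)) (trans (c a _)
  (trans (cong (tableNums (g a)) (Codes-concatMap c as w)) (sym (tableNums-++ (g a) _ _))))

module _ (M : TM) where
  open TM M
  open Run M
  open Encode M

  inputNum : Maybe Bool → ℕ
  inputNum nothing      = 0
  inputNum (just false) = 1
  inputNum (just true)  = 2

  moveNum : Move → ℕ
  moveNum left  = 0
  moveNum stay  = 1
  moveNum right = 2

  writeNum : Symbol × Move → ℕ × ℕ
  writeNum (a , d) = toℕ a , moveNum d

  instructionKey : State → Maybe Bool → Vec Symbol tapes → List ℕ
  instructionKey q a s = toℕ q ∷ inputNum a ∷ map toℕ (toList s)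

  instructionEntry : State → Maybe Bool → Vec Symbol tapes → Action → Entry
  instructionEntry q a s (q′ , b , ws) = entry (instructionKey q a s) (toℕ q′) b (map writeNum (toList ws))

  entriesAt : State → Maybe Bool → Vec Symbol tapes → List Entry
  entriesAt q a s = maybe′ (λ act → instructionEntry q a s act ∷ []) [] (δ q a s)

  allHeads : List (Vec Symbol tapes)
  allHeads = allVecs (allFin (suc symbols′)) tapes

  entriesFor : State → Maybe Bool → List Entry
  entriesFor q a = concatMap (entriesAt q a) allHeads

  entriesFrom : State → List Entry
  entriesFrom q = concatMap (entriesFor q) inputs

  entries : List Entry
  entries = concatMap entriesFrom (allFin (suc states′))

  nums-encInput : ∀ a w → nums (encInput a ++ w) ≡ inputNum a ∷ nums w
  nums-encInput nothing      = nums-⌜⌝ 0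
  nums-encInput (just false) = nums-⌜⌝ 1
  nums-encInput (just true)  = nums-⌜⌝ 2

  nums-encMove : ∀ d w → nums (encMove d ++ w) ≡ moveNum d ∷ nums w
  nums-encMove left  = nums-⌜⌝ 0
  nums-encMove stay  = nums-⌜⌝ 1
  nums-encMove right = nums-⌜⌝ 2

  nums-symbols : (s : Vec Symbol k) → ∀ w → nums (encVec encFin s ++ w) ≡ map toℕ (toList s) ++ nums w
  nums-symbols []      w = refl
  nums-symbols (a ∷ s) w = trans (cong nums (++-assoc (encFin a) _ w))
    (trans (nums-⌜⌝ (toℕ a) _) (cong (toℕ a ∷_) (nums-symbols s w)))

  nums-writes : (ws : Vec (Symbol × Move) k) → ∀ w →
                nums (encVec encWrite ws ++ w) ≡ flatten (map writeNum (toList ws)) (nums w)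
  nums-writes []             w = refl
  nums-writes ((a , d) ∷ ws) w = begin
    nums (((encFin a ++ encMove d) ++ r) ++ w) ≡⟨ cong nums (++-assoc (encFin a ++ encMove d) r w) ⟩
    nums ((encFin a ++ encMove d) ++ r ++ w)   ≡⟨ cong nums (++-assoc (encFin a) (encMove d) (r ++ w)) ⟩
    nums (encFin a ++ encMove d ++ r ++ w)     ≡⟨ nums-⌜⌝ (toℕ a) _ ⟩
    toℕ a ∷ nums (encMove d ++ r ++ w)         ≡⟨ cong (toℕ a ∷_) (nums-encMove d _) ⟩
    toℕ a ∷ moveNum d ∷ nums (r ++ w)          ≡⟨ cong (λ l → toℕ a ∷ moveNum d ∷ l) (nums-writes ws w) ⟩
    _                                          ∎
    where
    open ≡-Reasoning
    r : Str
    r = encVec encWrite ws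

  Codes-instruction : ∀ q a s → Codes (instruction q a s) (entriesAt q a s)
  Codes-instruction q a s w with δ q a s
  ... | nothing            = refl
  ... | just (q′ , b , ws) = begin
    nums ((encFin q ++ encInput a ++ encVec encFin s ++ encFin q′ ++ (b ∷ r)) ++ w)
      ≡⟨ cong nums (trans (++-assoc (encFin q) _ w) (cong (encFin q ++_) (trans (++-assoc (encInput a) _ w)
           (cong (encInput a ++_) (trans (++-assoc (encVec encFin s) _ w)
             (cong (encVec encFin s ++_) (++-assoc (encFin q′) _ w))))))) ⟩
    nums (encFin q ++ encInput a ++ encVec encFin s ++ encFin q′ ++ b ∷ r ++ w)
      ≡⟨ trans (nums-⌜⌝ (toℕ q) _) (cong (toℕ q ∷_) (trans (nums-encInput a _) (cong (inputNum a ∷_)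
           (trans (nums-symbols s _) (cong (map toℕ (toList s) ++_) (trans (nums-⌜⌝ (toℕ q′) _)
             (cong (λ l → toℕ q′ ∷ unbit b l) (nums-writes ws w)))))))) ⟩
    _ ∎
    where
    open ≡-Reasoning
    r : Str
    r = encVec encWrite ws

  instructionsFor : State → Maybe Bool → Str
  instructionsFor q a = concatMap (instruction q a) allHeads

  instructionsFrom : State → Str
  instructionsFrom q = concatMap (instructionsFor q) inputs

  Codes-for : ∀ q a → Codes (instructionsFor q a) (entriesFor q a)
  Codes-for q a = Codes-concatMap {f = instruction q a} {g = entriesAt q a} (Codes-instruction q a) allHeads

  Codes-from : ∀ q → Codes (instructionsFrom q) (entriesFrom q)
  Codes-from q = Codes-concatMap {f = instructionsFor q} {g = entriesFor q} (Codes-for q) inputs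

  nums-encode : nums (encode M) ≡ tapes′ ∷ states′ ∷ symbols′ ∷ tableNums entries []
  nums-encode = trans (nums-⌜⌝ tapes′ _) (cong (tapes′ ∷_) (trans (nums-⌜⌝ states′ _) (cong (states′ ∷_)
    (trans (nums-⌜⌝ symbols′ _) (cong (symbols′ ∷_) (trans (cong nums (sym (++-identityʳ table)))
      (Codes-concatMap {f = instructionsFrom} {g = entriesFrom} Codes-from (allFin (suc states′)) [])))))))

  All-entries : {P : Entry → Set} → (∀ q a s {act} → δ q a s ≡ just act → P (instructionEntry q a s act)) → All P entries
  All-entries {P} p = All-concatMap (λ q → All-concatMap (λ a → All-concatMap (λ s → at q a s) allHeads) inputs) (allFin (suc states′))
    where
    at : ∀ q a s → All P (entriesAt q a s)
    at q a s with δ q a s in eq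
    ... | nothing = []
    ... | just _  = p q a s eq ∷ []

  ∈-entries : ∀ q a s {act} → δ q a s ≡ just act → instructionEntry q a s act ∈ entries
  ∈-entries q a s {act} eq = ∈-concatMap⁺ entriesFrom (lose (∈-allFin q) (∈-concatMap⁺ (entriesFor q) (lose (inputs-complete a)
    (∈-concatMap⁺ (entriesAt q a) (lose (allVecs-complete ∈-allFin s) at)))))
    where
    inputs-complete : ∀ a → a ∈ inputs
    inputs-complete nothing      = here refl
    inputs-complete (just false) = there (here refl)
    inputs-complete (just true)  = there (there (here refl))
    at : instructionEntry q a s act ∈ entriesAt q a s
    at rewrite eq = here refl

  entries-wellFormed : All (WellFormed tapes) entries
  entries-wellFormed = All-entries λ { q a s {q′ , b , w ∷ ws} _ →
    cong (2 +_) (trans (length-map toℕ (toList s)) (length-toList s)) ,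
    writeNum w , map writeNum (toList ws) , refl ,
    cong suc (trans (length-map writeNum (toList ws)) (length-toList ws)) }

  -- Entries with equal keys come from the same arguments of `δ`, so the lookup cannot return a
  -- wrong action.
  instructionKey-injective : ∀ {q q′ a a′ s s′} → instructionKey q a s ≡ instructionKey q′ a′ s′ →
                             q ≡ q′ × a ≡ a′ × s ≡ s′
  instructionKey-injective {s = s} {s′} eq =
    toℕ-injective (∷-injectiveˡ eq) ,
    inputNum-injective (∷-injectiveˡ (∷-injectiveʳ eq)) ,
    trans (sym (cast-is-id refl s)) (toList-injective refl s s′ (map-injective toℕ-injective (∷-injectiveʳ (∷-injectiveʳ eq))))
    where
    inputNum-injective : ∀ {a a′} → inputNum a ≡ inputNum a′ → a ≡ a′
    inputNum-injective {nothing}    {nothing}    _ = refl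
    inputNum-injective {just false} {just false} _ = refl
    inputNum-injective {just true}  {just true}  _ = refl
    inputNum-injective {nothing}    {just false} ()
    inputNum-injective {nothing}    {just true}  ()
    inputNum-injective {just false} {nothing}    ()
    inputNum-injective {just false} {just true}  ()
    inputNum-injective {just true}  {nothing}    ()
    inputNum-injective {just true}  {just false} ()

  tapeNums : Tape Symbol → Tapeℕ
  tapeNums ⟪ ls , a , rs ⟫ = map toℕ ls , toℕ a , map toℕ rs

  configNums : Config → Confℕ
  configNums (config q (a , u) ts) = toℕ q , inputNum a , u , map tapeNums (toList ts)

  keyOf-config : ∀ q a u ts → keyOf (configNums (config q (a , u) ts)) ≡ instructionKey q a (Vec.map Tape.head ts)
  keyOf-config q a u ts = cong (λ l → toℕ q ∷ inputNum a ∷ l) (go ts)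
    where
    go : (ts : Vec (Tape Symbol) k) → map (proj₁ ∘ proj₂) (map tapeNums (toList ts)) ≡ map toℕ (toList (Vec.map Tape.head ts))
    go []       = refl
    go (t ∷ ts) = cong (_ ∷_) (go ts)

  upd-update : ∀ w t → upd (writeNum w) (tapeNums t) ≡ tapeNums (update w t)
  upd-update (a , left)  ⟪ []     , _ , rs ⟫     = refl
  upd-update (a , left)  ⟪ l ∷ ls , _ , rs ⟫     = refl
  upd-update (a , stay)  ⟪ ls     , _ , rs ⟫     = refl
  upd-update (a , right) ⟪ ls     , _ , [] ⟫     = refl
  upd-update (a , right) ⟪ ls     , _ , r ∷ rs ⟫ = refl

  updates-update : (ws : Vec (Symbol × Move) k) (ts : Vec (Tape Symbol) k) →
    zipWith upd (map writeNum (toList ws)) (map tapeNums (toList ts)) ≡ map tapeNums (toList (Vec.zipWith update ws ts))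
  updates-update []       []       = refl
  updates-update (w ∷ ws) (t ∷ ts) = cong₂ _∷_ (upd-update w t) (updates-update ws ts)

  private
    machineNums : List ℕ
    machineNums = tableNums entries []

  find-config : ∀ q a u ts → find (eval keyᵗ (configNums (config q (a , u) ts) ∷ [])) tapes machineNums ≡
    find (instructionKey q a (Vec.map Tape.head ts)) tapes machineNums
  find-config q a u ts = cong (λ κ → find κ tapes machineNums) (trans (eval-key (configNums (config q (a , u) ts))) (keyOf-config q a u ts))

  key-length : ∀ q a s → length (instructionKey q a s) ≡ 2 + tapes
  key-length q a s = cong (2 +_) (trans (length-map toℕ (toList s)) (length-toList s))

  find-stop : ∀ q a s → δ q a s ≡ nothing → find (instructionKey q a s) tapes machineNums ≡ nothing
  find-stop q a s eq = find-absent (toℕ q) _ tapes (key-length q a s) entries entries-wellFormed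
    (All-entries λ q′ a′ s′ {act} eq′ eqκ → case instructionKey-injective {q′} {q} {a′} {a} {s′} {s} eqκ of λ
      { (refl , refl , refl) → case trans (sym eq) eq′ of λ () })

  find-act : ∀ q a s {q′ b ws} → δ q a s ≡ just (q′ , b , ws) →
    ∃ λ ns → find (instructionKey q a s) tapes machineNums ≡ just (actionNums (toℕ q′) b (map writeNum (toList ws)) ns)
  find-act q a s eq = find-present (toℕ q) _ tapes (key-length q a s) entries entries-wellFormed
    (∈-entries q a s eq)
    (All-entries λ q′ a′ s′ {act} eq′ eqκ → case instructionKey-injective {q′} {q} {a′} {a} {s′} {s} eqκ of λ
      { (refl , refl , refl) → cong (instructionEntry q a s) (just-injective (trans (sym eq′) eq)) })

  halted-stop : ∀ {q a u ts} → δ q a (Vec.map Tape.head ts) ≡ nothing → halted tapes machineNums (configNums (config q (a , u) ts)) ≡ true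
  halted-stop {q} {a} {u} {ts} eq rewrite find-config q a u ts | find-stop q a _ eq = refl

  step-act : ∀ {q a u ts q′ b ws i′} → δ q a (Vec.map Tape.head ts) ≡ just (q′ , b , ws) → Advance b (a , u) i′ →
    simStep tapes machineNums (configNums (config q (a , u) ts)) ≡ just (configNums (config q′ i′ (Vec.zipWith update ws ts)))
  step-act {q} {a} {u} {ts} {q′} {b} {ws} eq adv
    with ns , eq′ ← find-act q a (Vec.map Tape.head ts) eq
    rewrite find-config q a u ts | eq′
    -- Splitting off the first write puts a number behind the bit, so that `bitᵗ` reduces as soon as
    -- `adv` determines the bit.
    with ws | ts | updates-update ws ts | eval-updates (map writeNum (toList ws)) (map tapeNums (toList ts)) ns
           (trans (length-map writeNum (toList ws)) (trans (length-toList ws)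
             (sym (trans (length-map tapeNums (toList ts)) (length-toList ts)))))
  ... | w ∷ ws | t ∷ ts | eq₁ | eq₂ with adv
  ...   | keep = cong (λ ts′ → just (toℕ q′ , inputNum a , u , ts′)) (trans eq₂ eq₁)
  ...   | read {b = true}  {u = u′} = cong (λ ts′ → just (toℕ q′ , 2 , u′ , ts′)) (trans eq₂ eq₁)
  ...   | read {b = false} {u = u′} = cong (λ ts′ → just (toℕ q′ , 1 , u′ , ts′)) (trans eq₂ eq₁)

  stops-outcome : ∀ {c} → StopsFrom c → ∃ λ n → outcome tapes machineNums n (configNums c) ≡ just []
  stops-outcome (stop {q} {a} {ts} eq) = 0 , cong (if_then just [] else nothing) (halted-stop {q} {a} {[]} {ts} eq)
  stops-outcome (step {q} {a} {u} {ts} {i′ = i′} eq adv s) with stops-outcome s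
  ... | n , eq′ = suc n , outcome-step tapes machineNums n (step-act eq adv) eq′

  simulate-stops : ∀ x → M StopsAt x → ∃ λ n → simulate n (encode M) x ≡ just []
  simulate-stops x s with stops-outcome s
  ... | n , eq = n , trans (simulate-nums n (encode M) x) (trans (cong (λ ns → simulateNums n ns x) nums-encode)
    (trans (cong (λ ts → outcome tapes machineNums n (0 , 0 , x , ts)) (blank-tapes tapes)) eq))
    where
    blank-tapes : ∀ k → blankTapes k ≡ map tapeNums (toList (Vec.replicate k blankTape))
    blank-tapes zero    = refl
    blank-tapes (suc k) = cong (_ ∷_) (blank-tapes k)

-- A search runs over single words; this reads such a word as a time bound in unary followed by a
-- second word.
splitᵗ : Tm (str ∷ []) (nat ⊗ str)
splitᵗ = strRec v0 (ze ,, ε) λ { true → su (fst v1) ,, snd v1 ; false → ze ,, v0 }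

split : Str → ℕ × Str
split z = eval splitᵗ (z ∷ [])

split-⌜⌝ : ∀ k w → split (⌜ k ⌝ ++ w) ≡ (k , w)
split-⌜⌝ k w = trans
  (recStr-cong {f = id} {g′ = λ b w r → if b then (suc (proj₁ r) , proj₂ r) else (0 , w)}
    refl (λ { true _ _ → refl ; false _ _ → refl }) (⌜ k ⌝ ++ w))
  (go k)
  where
  go : ∀ k → recStr (0 , []) (λ b w r → if b then (suc (proj₁ r) , proj₂ r) else (0 , w)) (⌜ k ⌝ ++ w) ≡ (k , w)
  go zero    = refl
  go (suc k) rewrite go k = refl

-- Machines as descriptions

prefix-++ : {x x′ : Str} → Prefix _≡_ x x′ → ∃ λ v → x ++ v ≡ x′
prefix-++ []         = _ , refl
prefix-++ (refl ∷ p) = let v , eq = prefix-++ p in v , cong (_ ∷_) eq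

module _ (U : Decompressor) where
  private
    module U = Decompressor U
    g : Rec 2
    g = proj₁ U.enumerable

  -- `U` is given by its graph, so the output `w` is guessed along with the bound, which serves for
  -- both runs. As the simulator returns the unread rest, the consumed part `y` is recognised by
  -- appending that rest to it.
  acceptsᵗ : Tm (nat ∷ str ∷ str ∷ str ∷ str ∷ []) bool
  acceptsᵗ = optCase (call (bounded g) (v0 ∷ cons v2 (cons v1 nil) ∷ [])) ff
    (optCase (call simulateᵗ (v1 ∷ v2 ∷ v4 ∷ [])) ff
      (call eqStrᵗ (call appendᵗ (var (there (there (there (there (there (there (here refl))))))) ∷ v0 ∷ []) ∷ v5 ∷ [])))

  searchᵗ : Tm (str ∷ str ∷ str ∷ str ∷ []) bool
  searchᵗ = call acceptsᵗ (fst (call splitᵗ (v0 ∷ [])) ∷ snd (call splitᵗ (v0 ∷ [])) ∷ v1 ∷ v2 ∷ v3 ∷ [])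

  Accepts : ℕ → Str → Str → Str → Str → Set
  Accepts k w p x y = ∃₂ λ r u → run g k (p ∷ w ∷ []) ≡ just r × simulate k w x ≡ just u × y ++ u ≡ x

  accepts : Maybe Str → Maybe Str → Str → Str → Bool
  accepts r s x y = maybe′ (λ _ → maybe′ (λ u → eval eqStrᵗ (eval appendᵗ (y ∷ u ∷ []) ∷ x ∷ [])) false s) false r

  accepts-sound : ∀ r s x y → accepts r s x y ≡ true → ∃₂ λ r′ u → r ≡ just r′ × s ≡ just u × y ++ u ≡ x
  accepts-sound (just r) (just u) x y eq =
    r , u , refl , refl , trans (sym (eval-append y u)) (eqStr-sound _ x eq)

  accepts-complete : ∀ {r s r′ u} y → r ≡ just r′ → s ≡ just u → accepts r s (y ++ u) y ≡ true
  accepts-complete {u = u} y refl refl =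
    trans (cong (λ z → eval eqStrᵗ (z ∷ (y ++ u) ∷ [])) (eval-append y u)) (eqStr-complete (y ++ u))

  Accepted : Str → Str → Str → Set
  Accepted p x y = ∃ λ z → eval searchᵗ (z ∷ p ∷ x ∷ y ∷ []) ≡ true

  Accepted⇒ : ∀ p x y → Accepted p x y → ∃₂ λ k w → Accepts k w p x y
  Accepted⇒ p x y (z , eq) = proj₁ (split z) , proj₂ (split z) , accepts-sound _ _ x y eq

  ⇒Accepted : ∀ k w p x y → Accepts k w p x y → Accepted p x y
  ⇒Accepted k w p _ y (_ , u , eq₁ , eq₂ , refl) = (⌜ k ⌝ ++ w) ,
    trans (cong (λ s → accepts (run g (proj₁ s) (p ∷ proj₂ s ∷ [])) (simulate (proj₁ s) (proj₂ s) (y ++ u)) (y ++ u) y)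
            (split-⌜⌝ k w))
          (accepts-complete y eq₁ eq₂)

  stoppingMode : DescriptionMode
  stoppingMode = record
    { Describes  = Accepted
    ; enumerable = search searchᵗ , λ { (p ∷ x ∷ y ∷ []) → search-⇔ searchᵗ (p ∷ x ∷ y ∷ []) }
    ; functional = λ {p} {x} {y} {y′} → functional {p} {x} {y} {y′}
    ; monotone   = λ {p} {x} {x′} {y} → monotone {p} {x} {x′} {y}
    }
    where
    described : ∀ k p w {r} → run g k (p ∷ w ∷ []) ≡ just r → U.Describes p w
    described k p w eq = Equivalence.from (proj₂ U.enumerable (p ∷ w ∷ [])) (_ , run-sound g k (p ∷ w ∷ []) eq)

    functional : ∀ {p x y y′} → Accepted p x y → Accepted p x y′ → y ≡ y′
    functional {p} {x} {y} {y′} a a′ with Accepted⇒ p x y a | Accepted⇒ p x y′ a′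
    ... | k , w , _ , u , run₁ , sim₁ , eq₁ | k′ , w′ , _ , u′ , run₂ , sim₂ , eq₂
      with refl ← U.functional (described k p w run₁) (described k′ p w′ run₂)
      with refl ← simulate-functional k k′ w x sim₁ sim₂ = ++-cancelʳ u y y′ (trans eq₁ (sym eq₂))

    monotone : ∀ {p x x′ y} → Prefix _≡_ x x′ → Accepted p x y → Accepted p x′ y
    monotone {p} {x} {y = y} pre a with prefix-++ pre | Accepted⇒ p x y a
    ... | v , refl | k , w , r , u , eq₁ , eq₂ , eq₃ =
      ⇒Accepted k w p (x ++ v) y (r , u ++ v , eq₁ , simulate-extend v k w x eq₂ , trans (sym (++-assoc y u v)) (cong (_++ v) eq₃))

  stops⇒described : ∀ {p M x} → U.Describes p (encode M) → M StopsAt x → DescriptionMode.Describes stoppingMode p x x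
  stops⇒described {p} {M} {x} d s
    with r , d⇓ ← Equivalence.to (proj₂ U.enumerable (p ∷ encode M ∷ [])) d
    with K , run≡ ← run-complete d⇓
    with n , sim≡ ← simulate-stops M x s =
      ⇒Accepted (K ⊔ n) (encode M) p x x (r , [] , run≡ (K ⊔ n) (m≤m⊔n K n)
        , simulate-later {n} {K ⊔ n} (encode M) x (m≤n⊔m K n) sim≡ , ++-identityʳ x)

-- Programs on stacks

infixr 5 _⨾_

-- `loop i P` pops a letter `b` and runs `P b` until stack `i` is empty. The body may push on stack
-- `i` again, so this is a while loop, and it is the only test.
data Prog : Set where
  nop  : Prog
  push : ℕ → Bool → Prog
  _⨾_  : Prog → Prog → Prog
  loop : (i : ℕ) (P : Bool → Prog) → Prog
  read : ℕ → Prog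

Store : Set
Store = ℕ → Str

infixl 8 _[_≔_]

_[_≔_] : Store → ℕ → Str → Store
(σ [ i ≔ s ]) j = if j ≡ᵇ i then s else σ j

≡ᵇ-refl : ∀ i → (i ≡ᵇ i) ≡ true
≡ᵇ-refl zero    = refl
≡ᵇ-refl (suc i) = ≡ᵇ-refl i

≢⇒≡ᵇ : ∀ {i j} → i ≢ j → (i ≡ᵇ j) ≡ false
≢⇒≡ᵇ {i} {j} i≢j with i ≡ᵇ j in eq
... | true  = contradiction (≡ᵇ⇒≡ i j (subst T (sym eq) _)) i≢j
... | false = refl

+-≡ᵇ : ∀ b i j → (b + i ≡ᵇ b + j) ≡ (i ≡ᵇ j)
+-≡ᵇ zero    i j = refl
+-≡ᵇ (suc b) i j = +-≡ᵇ b i j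

Inp : Set
Inp = Maybe Bool × List Bool

infix 4 _∶_,_⇒_,_

data _∶_,_⇒_,_ : Prog → Store → Inp → Store → Inp → Set where
  nop    : ∀ {σ u} → nop ∶ σ , u ⇒ σ , u
  push   : ∀ {i b σ u} → push i b ∶ σ , u ⇒ σ [ i ≔ b ∷ σ i ] , u
  _⨾_    : ∀ {P Q σ σ′ σ″ u u′ u″} → P ∶ σ , u ⇒ σ′ , u′ → Q ∶ σ′ , u′ ⇒ σ″ , u″ → P ⨾ Q ∶ σ , u ⇒ σ″ , u″
  loop-[] : ∀ {i P σ u} → σ i ≡ [] → loop i P ∶ σ , u ⇒ σ , u
  loop-∷ : ∀ {i P b s σ σ′ u u′} → σ i ≡ b ∷ s → P b ⨾ loop i P ∶ σ [ i ≔ s ] , u ⇒ σ′ , u′ →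
           loop i P ∶ σ , u ⇒ σ′ , u′
  read   : ∀ {i a b u σ} → read i ∶ σ , (a , b ∷ u) ⇒ σ [ i ≔ b ∷ σ i ] , (just b , u)

-- The stacks below `b` belong to the caller and hold `ρ`; those from `b` on hold `H`.
Shape : ℕ → Store → Store → Store → Set
Shape b ρ H σ = (∀ j → j < b → σ j ≡ ρ j) × (∀ k → σ (b + k) ≡ H k)

-- A Hoare triple for total correctness of programs that leave the input alone. Stores enter
-- pointwise, which avoids function extensionality.
Triple : ℕ → Store → Store → Prog → Store → Set
Triple b ρ H P H′ = ∀ {σ} → Shape b ρ H σ → ∃ λ σ′ → (∀ {u} → P ∶ σ , u ⇒ σ′ , u) × Shape b ρ H′ σ′

Shape-cong : ∀ {b ρ H H′ σ} → (∀ k → H k ≡ H′ k) → Shape b ρ H σ → Shape b ρ H′ σ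
Shape-cong eq (lo , hi) = lo , λ k → trans (hi k) (eq k)

Shape-update : ∀ {b ρ H σ} i s → Shape b ρ H σ → Shape b ρ (H [ i ≔ s ]) (σ [ b + i ≔ s ])
Shape-update {b} {H = H} {σ} i s (lo , hi) = lo′ , hi′
  where
  lo′ : ∀ j → j < b → (σ [ b + i ≔ s ]) j ≡ _
  lo′ j j<b rewrite ≢⇒≡ᵇ (<⇒≢ (<-≤-trans j<b (m≤m+n b i))) = lo j j<b
  hi′ : ∀ k → (σ [ b + i ≔ s ]) (b + k) ≡ (H [ i ≔ s ]) k
  hi′ k rewrite +-≡ᵇ b k i with k ≡ᵇ i
  ... | true  = refl
  ... | false = hi k

module _ {b : ℕ} {ρ : Store} where

  pre : ∀ {H H₁ P H′} → (∀ k → H k ≡ H₁ k) → Triple b ρ H₁ P H′ → Triple b ρ H P H′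
  pre eq t = t ∘ Shape-cong eq

  post : ∀ {H H₁ P H′} → (∀ k → H₁ k ≡ H′ k) → Triple b ρ H P H₁ → Triple b ρ H P H′
  post eq t sh = let σ′ , d , sh′ = t sh in σ′ , d , Shape-cong eq sh′

  ⨾ᵗ : ∀ {H H₁ H′ P Q} → Triple b ρ H P H₁ → Triple b ρ H₁ Q H′ → Triple b ρ H (P ⨾ Q) H′
  ⨾ᵗ t t′ sh = let _ , d , sh₁ = t sh; σ′ , d′ , sh′ = t′ sh₁ in σ′ , (d ⨾ d′) , sh′

  nopᵗ : ∀ {H} → Triple b ρ H nop H
  nopᵗ sh = _ , nop , sh

  pushᵗ : ∀ {H} i c → Triple b ρ H (push (b + i) c) (H [ i ≔ c ∷ H i ])
  pushᵗ i c sh = _ , push , subst (λ s → Shape b ρ (_ [ i ≔ c ∷ s ]) _) (proj₂ sh i) (Shape-update i _ sh)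

  loop-[]ᵗ : ∀ {H P} i → H i ≡ [] → Triple b ρ H (loop (b + i) P) H
  loop-[]ᵗ i eq sh = _ , loop-[] (trans (proj₂ sh i) eq) , sh

  loop-∷ᵗ : ∀ {H H′ P} i c {s} → H i ≡ c ∷ s → Triple b ρ (H [ i ≔ s ]) (P c ⨾ loop (b + i) P) H′ →
            Triple b ρ H (loop (b + i) P) H′
  loop-∷ᵗ i c eq t sh = let _ , d , sh′ = t (Shape-update i _ sh) in
    _ , loop-∷ (trans (proj₂ sh i) eq) d , sh′

-- Clearing, moving and copying stacks

nth : List Str → Store
nth []      _       = []
nth (s ∷ l) zero    = s
nth (s ∷ l) (suc k) = nth l k

clear : ℕ → Prog
clear i = loop i (λ _ → nop)

spill : ℕ → ℕ → Prog
spill i j = loop i (push j)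

spill₂ : ℕ → ℕ → ℕ → Prog
spill₂ i j k = loop i (λ b → push j b ⨾ push k b)

-- A spill reverses the word, so moving it unchanged takes two spills through an auxiliary stack.
transfer : ℕ → ℕ → ℕ → Prog
transfer i j t = spill i t ⨾ spill t j

copy : ℕ → ℕ → ℕ → Prog
copy i j t = spill i t ⨾ spill₂ t i j

update-same : ∀ i {s x : Str} → (if i ≡ᵇ i then s else x) ≡ s
update-same i rewrite ≡ᵇ-refl i = refl

update-other : ∀ {i j} {s x : Str} → j ≢ i → (if j ≡ᵇ i then s else x) ≡ x
update-other ne rewrite ≢⇒≡ᵇ ne = refl

module _ {b : ℕ} {ρ : Store} where

  clearᵗ : ∀ {H} i → Triple b ρ H (clear (b + i)) (H [ i ≔ [] ])
  clearᵗ {H} i = go H (H i) refl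
    where
    go : ∀ H s → H i ≡ s → Triple b ρ H (clear (b + i)) (H [ i ≔ [] ])
    go H []      eq = post eq′ (loop-[]ᵗ i eq)
      where
      eq′ : ∀ k → H k ≡ (H [ i ≔ [] ]) k
      eq′ k with k ≟ i
      ... | yes refl = trans eq (sym (update-same i))
      ... | no  k≢i  = sym (update-other k≢i)
    go H (c ∷ s) eq = post eq′ (loop-∷ᵗ i c eq (⨾ᵗ nopᵗ (go (H [ i ≔ s ]) s (update-same i))))
      where
      eq′ : ∀ k → (H [ i ≔ s ] [ i ≔ [] ]) k ≡ (H [ i ≔ [] ]) k
      eq′ k with k ≡ᵇ i
      ... | true  = refl
      ... | false = refl

  spillᵗ : ∀ {H} i j → i ≢ j → Triple b ρ H (spill (b + i) (b + j)) (H [ i ≔ [] ] [ j ≔ H i ʳ++ H j ])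
  spillᵗ {H} i j i≢j = go H (H i) refl
    where
    go : ∀ H s → H i ≡ s → Triple b ρ H (spill (b + i) (b + j)) (H [ i ≔ [] ] [ j ≔ H i ʳ++ H j ])
    go H []      eq = post eq′ (loop-[]ᵗ i eq)
      where
      eq′ : ∀ k → H k ≡ (H [ i ≔ [] ] [ j ≔ H i ʳ++ H j ]) k
      eq′ k with k ≟ j | k ≟ i
      ... | yes refl | _        = trans (cong (_ʳ++ H j) (sym eq)) (sym (update-same j))
      ... | no  k≢j  | yes refl = trans eq (sym (trans (update-other k≢j) (update-same i)))
      ... | no  k≢j  | no  k≢i  = sym (trans (update-other k≢j) (update-other k≢i))
    go H (c ∷ s) eq = post eq′ (loop-∷ᵗ i c eq (⨾ᵗ (pushᵗ j c) (go H₁ s H₁i)))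
      where
      H₁ : Store
      H₁ = H [ i ≔ s ] [ j ≔ c ∷ (H [ i ≔ s ]) j ]
      H₁i : H₁ i ≡ s
      H₁i = trans (update-other i≢j) (update-same i)
      H₁j : H₁ i ʳ++ H₁ j ≡ H i ʳ++ H j
      H₁j = trans (cong₂ _ʳ++_ H₁i (trans (update-same j) (cong (c ∷_) (update-other (i≢j ∘ sym)))))
                  (cong (_ʳ++ H j) (sym eq))
      eq′ : ∀ k → (H₁ [ i ≔ [] ] [ j ≔ H₁ i ʳ++ H₁ j ]) k ≡ (H [ i ≔ [] ] [ j ≔ H i ʳ++ H j ]) k
      eq′ k with k ≡ᵇ j | k ≡ᵇ i
      ... | true  | _     = H₁j
      ... | false | true  = refl
      ... | false | false = refl

  spill₂ᵗ : ∀ {H} i j l → i ≢ j → i ≢ l → j ≢ l → Triple b ρ H (spill₂ (b + i) (b + j) (b + l))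
            (H [ i ≔ [] ] [ j ≔ H i ʳ++ H j ] [ l ≔ H i ʳ++ H l ])
  spill₂ᵗ {H} i j l i≢j i≢l j≢l = go H (H i) refl
    where
    go : ∀ H s → H i ≡ s → Triple b ρ H (spill₂ (b + i) (b + j) (b + l))
         (H [ i ≔ [] ] [ j ≔ H i ʳ++ H j ] [ l ≔ H i ʳ++ H l ])
    go H []      eq = post eq′ (loop-[]ᵗ i eq)
      where
      eq′ : ∀ k → H k ≡ (H [ i ≔ [] ] [ j ≔ H i ʳ++ H j ] [ l ≔ H i ʳ++ H l ]) k
      eq′ k with k ≟ l | k ≟ j | k ≟ i
      ... | yes refl | _        | _        = trans (cong (_ʳ++ H l) (sym eq)) (sym (update-same l))
      ... | no  k≢l  | yes refl | _        = trans (cong (_ʳ++ H j) (sym eq)) (sym (trans (update-other k≢l) (update-same j)))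
      ... | no  k≢l  | no  k≢j  | yes refl = trans eq (sym (trans (update-other k≢l) (trans (update-other k≢j) (update-same i))))
      ... | no  k≢l  | no  k≢j  | no  k≢i  = sym (trans (update-other k≢l) (trans (update-other k≢j) (update-other k≢i)))
    go H (c ∷ s) eq = post eq′ (loop-∷ᵗ i c eq (⨾ᵗ (⨾ᵗ (pushᵗ j c) (pushᵗ l c)) (go H₂ s H₂i)))
      where
      H₁ H₂ : Store
      H₁ = H [ i ≔ s ] [ j ≔ c ∷ (H [ i ≔ s ]) j ]
      H₂ = H₁ [ l ≔ c ∷ H₁ l ]
      H₂i : H₂ i ≡ s
      H₂i = trans (update-other i≢l) (trans (update-other i≢j) (update-same i))
      H₂j : H₂ i ʳ++ H₂ j ≡ H i ʳ++ H j
      H₂j = trans (cong₂ _ʳ++_ H₂i (trans (update-other j≢l) (trans (update-same j) (cong (c ∷_) (update-other (i≢j ∘ sym))))))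
                  (cong (_ʳ++ H j) (sym eq))
      H₂l : H₂ i ʳ++ H₂ l ≡ H i ʳ++ H l
      H₂l = trans (cong₂ _ʳ++_ H₂i (trans (update-same l) (cong (c ∷_) (trans (update-other (j≢l ∘ sym)) (update-other (i≢l ∘ sym))))))
                  (cong (_ʳ++ H l) (sym eq))
      eq′ : ∀ k → (H₂ [ i ≔ [] ] [ j ≔ H₂ i ʳ++ H₂ j ] [ l ≔ H₂ i ʳ++ H₂ l ]) k ≡
                  (H [ i ≔ [] ] [ j ≔ H i ʳ++ H j ] [ l ≔ H i ʳ++ H l ]) k
      eq′ k with k ≡ᵇ l in kl | k ≡ᵇ j in kj | k ≡ᵇ i in ki
      ... | true  | _     | _     = H₂l
      ... | false | true  | _     = H₂j
      ... | false | false | true  = refl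
      ... | false | false | false = refl

  transferᵗ : ∀ {H} i j t → i ≢ j → i ≢ t → j ≢ t → H t ≡ [] →
          Triple b ρ H (transfer (b + i) (b + j) (b + t)) (H [ i ≔ [] ] [ j ≔ H i ++ H j ])
  transferᵗ {H} i j t i≢j i≢t j≢t eq = post eq′ (⨾ᵗ (spillᵗ i t i≢t) (spillᵗ t j (j≢t ∘ sym)))
    where
    H₁ : Store
    H₁ = H [ i ≔ [] ] [ t ≔ H i ʳ++ H t ]
    eq′ : ∀ k → (H₁ [ t ≔ [] ] [ j ≔ H₁ t ʳ++ H₁ j ]) k ≡ (H [ i ≔ [] ] [ j ≔ H i ++ H j ]) k
    eq′ k with k ≟ j
    ... | yes refl = trans (update-same j) (trans (cong₂ _ʳ++_ (trans (update-same t) (cong (H i ʳ++_) eq))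
                       (trans (update-other j≢t) (update-other (i≢j ∘ sym)))) (trans (ʳ++-ʳ++ (H i)) (sym (update-same j))))
    ... | no  k≢j with k ≟ t
    ...   | yes refl = trans (update-other k≢j) (trans (update-same t) (sym (trans (update-other k≢j) (trans (update-other (i≢t ∘ sym)) eq))))
    ...   | no  k≢t  = trans (update-other k≢j) (trans (update-other k≢t) (trans (update-other k≢t) (sym (update-other k≢j))))

-- The source belongs to the caller and is empty for a while, which no triple with base `b` can
-- express. The spills are therefore run with base 0, and the restoration of the lower stacks is
-- checked afterwards.
copyᵗ : ∀ {b ρ H} a j t → a < b → j ≢ t → H t ≡ [] →
        Triple b ρ H (copy a (b + j) (b + t)) (H [ j ≔ ρ a ++ H j ])
copyᵗ {b} {ρ} {H} a j t a<b j≢t eq {σ} (lo , hi) with spillᵗ {0} {σ} {σ} a (b + t) (<⇒≢ (<-≤-trans a<b (m≤m+n b t))) ((λ _ ()) , λ _ → refl)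
... | σ₁ , d₁ , sh₁@(_ , hi₁)
  with spill₂ᵗ {0} {σ} {σ₁} (b + t) a (b + j) (a≢ t ∘ sym) (j≢t ∘ sym ∘ +-cancelˡ-≡ b t j) (a≢ j) ((λ _ ()) , λ _ → refl)
  where
  a≢ : ∀ i → a ≢ b + i
  a≢ i = <⇒≢ (<-≤-trans a<b (m≤m+n b i))
... | σ₂ , d₂ , (_ , hi₂) = σ₂ , (d₁ ⨾ d₂) , lo′ , hi′
  where
  a≢ : ∀ {j} → j < b → ∀ i → j ≢ b + i
  a≢ j<b i = <⇒≢ (<-≤-trans j<b (m≤m+n b i))
  b+ : ∀ {i k} → i ≢ k → b + i ≢ b + k
  b+ i≢k eq = i≢k (+-cancelˡ-≡ b _ _ eq)
  at-t : σ₁ (b + t) ≡ σ a ʳ++ []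
  at-t = trans (hi₁ (b + t)) (trans (update-same (b + t)) (cong (σ a ʳ++_) (trans (hi t) eq)))
  at-a : σ₁ a ≡ []
  at-a = trans (hi₁ a) (trans (update-other (a≢ a<b t)) (update-same a))
  back : ∀ s → σ₁ (b + t) ʳ++ s ≡ σ a ++ s
  back s = trans (cong (_ʳ++ s) at-t) (ʳ++-ʳ++ (σ a))
  lo′ : ∀ k → k < b → σ₂ k ≡ ρ k
  lo′ k k<b with k ≟ a
  ... | yes refl = trans (hi₂ a) (trans (update-other (a≢ k<b j)) (trans (update-same a)
                     (trans (back (σ₁ a)) (trans (cong (σ a ++_) at-a) (trans (++-identityʳ (σ a)) (lo a a<b))))))
  ... | no  k≢a  = trans (hi₂ k) (trans (update-other (a≢ k<b j)) (trans (update-other k≢a) (trans (update-other (a≢ k<b t))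
                     (trans (hi₁ k) (trans (update-other (a≢ k<b t)) (trans (update-other k≢a) (lo k k<b)))))))
  σ₁-j : ∀ k → k ≢ t → σ₁ (b + k) ≡ H k
  σ₁-j k k≢t = trans (hi₁ (b + k)) (trans (update-other (b+ k≢t)) (trans (update-other (a≢ a<b k ∘ sym)) (hi k)))
  hi′ : ∀ k → σ₂ (b + k) ≡ (H [ j ≔ ρ a ++ H j ]) k
  hi′ k with k ≟ j
  ... | yes refl = trans (hi₂ (b + j)) (trans (update-same (b + j)) (trans (back _)
                     (trans (cong₂ _++_ (lo a a<b) (σ₁-j j j≢t)) (sym (update-same j)))))
  ... | no  k≢j with k ≟ t
  ...   | yes refl = trans (hi₂ (b + t)) (trans (update-other (b+ k≢j)) (trans (update-other (a≢ a<b t ∘ sym))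
                       (trans (update-same (b + t)) (sym (trans (update-other k≢j) eq)))))
  ...   | no  k≢t  = trans (hi₂ (b + k)) (trans (update-other (b+ k≢j)) (trans (update-other (a≢ a<b k ∘ sym))
                       (trans (update-other (b+ k≢t)) (trans (σ₁-j k k≢t) (sym (update-other k≢j))))))

-- Compilation of partial recursive functions

-- The sums are kept in the form `b + k` in which triples address stacks.
range : ℕ → (m : ℕ) → Vec ℕ m
range b zero    = []
range b (suc m) = (b + 0) ∷ range (b + 1) m

clears : ℕ → ℕ → Prog
clears b zero    = nop
clears b (suc m) = clear (b + 0) ⨾ clears (b + 1) m

-- The flag is the letter `false` because `true` marks the first round in the loops that use it.
raiseFlag : ℕ → ℕ → Prog
raiseFlag i t = loop i (λ _ → clear t ⨾ push t false)

-- The arguments are read from the stacks as, which lie below b; the result is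
-- left on stack b, and the stacks from b on serve as scratch space.  Recursion
-- keeps on b + 2 the suffix w processed so far, on b its value, and on b + 1 the
-- remaining letters, the one in front of w on top.  Minimisation counts on b; its
-- flag on b + 1 is empty when the search ends.
mutual
  program : Rec n → Vec ℕ n → ℕ → Prog
  program empty       as       b = nop
  program (prefix c)  (a ∷ []) b = copy a (b + 0) (b + 1) ⨾ push (b + 0) c
  program (proj i)    as       b = copy (lookup as i) (b + 0) (b + 1)
  program {n} (comp {m} f gs) as b =
    programs gs as (b + 1) ⨾
    program f (range (b + 1) m) (b + suc m) ⨾
    transfer (b + suc m) (b + 0) (b + suc (suc m)) ⨾
    clears (b + 1) m
  program (rec f h)   (a ∷ as) b =
    copy a (b + 2) (b + 3) ⨾
    spill (b + 2) (b + 1) ⨾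
    program f as (b + 3) ⨾
    transfer (b + 3) (b + 0) (b + 4) ⨾
    loop (b + 1) (recBody h as b) ⨾
    clear (b + 2)
  program (mu f)      as       b = push (b + 1) true ⨾ loop (b + 1) (λ first →
    (if first then nop else push (b + 0) false) ⨾ muBody f as b)

  recBody : (Bool → Rec (2 + n)) → Vec ℕ n → ℕ → Bool → Prog
  recBody h as b c =
    program (h c) ((b + 2) ∷ (b + 0) ∷ as) (b + 3) ⨾
    clear (b + 0) ⨾
    transfer (b + 3) (b + 0) (b + 4) ⨾
    push (b + 2) c

  muBody : Rec (suc n) → Vec ℕ n → ℕ → Prog
  muBody f as b = program f ((b + 0) ∷ as) (b + 2) ⨾ raiseFlag (b + 2) (b + 1)

  programs : Vec (Rec n) m → Vec ℕ n → ℕ → Prog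
  programs []       as b = nop
  programs (g ∷ gs) as b = program g as b ⨾ programs gs as (b + 1)

nth-++ : ∀ l l′ k → nth (l ++ l′) (length l + k) ≡ nth l′ k
nth-++ []      l′ k = refl
nth-++ (_ ∷ l) l′ k = nth-++ l l′ k

nth-++< : ∀ l l′ k → k < length l → nth (l ++ l′) k ≡ nth l k
nth-++< (_ ∷ l) l′ zero    _         = refl
nth-++< (_ ∷ l) l′ (suc k) (s≤s k<n) = nth-++< l l′ k k<n

Shape-rebase : ∀ {b ρ σ} l l′ → Shape b ρ (nth (l ++ l′)) σ → Shape (b + length l) σ (nth l′) σ
Shape-rebase {b} {σ = σ} l l′ (_ , hi) = (λ _ _ → refl) , λ k →
  trans (cong σ (+-assoc b (length l) k)) (trans (hi (length l + k)) (nth-++ l l′ k))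

Shape-unbase : ∀ {b ρ σ σ′} l {l′} l″ → Shape b ρ (nth (l ++ l′)) σ →
               Shape (b + length l) σ (nth l″) σ′ → Shape b ρ (nth (l ++ l″)) σ′
Shape-unbase {b} {ρ} {σ} {σ′} l {l′} l″ (lo , hi) (lo′ , hi′) =
  (λ j j<b → trans (lo′ j (<-≤-trans j<b (m≤m+n b (length l)))) (lo j j<b)) , at
  where
  at : ∀ k → σ′ (b + k) ≡ nth (l ++ l″) k
  at k with k <? length l
  ... | yes k<l = trans (lo′ (b + k) (+-monoʳ-< b k<l)) (trans (hi k) (trans (nth-++< l l′ k k<l) (sym (nth-++< l l″ k k<l))))
  ... | no  k≮l with m≤n⇒∃[o]m+o≡n (≮⇒≥ k≮l)
  ...   | d , refl = trans (cong σ′ (sym (+-assoc b (length l) d))) (trans (hi′ d) (sym (nth-++ l l″ d)))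

-- The frame rule: raising the base by `length l` hands the stacks `l` over to the caller's side,
-- where they are preserved.
frameᵗ : ∀ {b ρ P} l l′ l″ →
  (∀ {σ} → Shape b ρ (nth (l ++ l′)) σ → Triple (b + length l) σ (nth l′) P (nth l″)) →
  Triple b ρ (nth (l ++ l′)) P (nth (l ++ l″))
frameᵗ l l′ l″ t sh = let σ′ , d , sh′ = t sh (Shape-rebase l l′ sh) in σ′ , d , Shape-unbase l l″ sh sh′

nth-last : ∀ l s → nth (l ++ s ∷ []) (length l) ≡ s
nth-last []      s = refl
nth-last (_ ∷ l) s = nth-last l s

nth-drop-last : ∀ l s k → (nth (l ++ s ∷ []) [ length l ≔ [] ]) k ≡ nth l k
nth-drop-last []      s zero    = refl
nth-drop-last []      s (suc k) = refl
nth-drop-last (_ ∷ l) s zero    = refl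
nth-drop-last (_ ∷ l) s (suc k) = nth-drop-last l s k

nth-beyond : ∀ l k → length l ≤ k → nth l k ≡ []
nth-beyond []      k       _        = refl
nth-beyond (_ ∷ l) (suc k) (s≤s le) = nth-beyond l k le

clearsᵗ : ∀ {b ρ} l → Triple b ρ (nth l) (clears b (length l)) (nth [])
clearsᵗ         []      = nopᵗ
clearsᵗ {b} {ρ} (s ∷ l) = ⨾ᵗ (post {H₁ = nth (s ∷ l) [ 0 ≔ [] ]} (λ { zero → refl ; (suc _) → refl }) (clearᵗ 0))
  (post (λ { zero → refl ; (suc _) → refl }) (frameᵗ {b} {ρ} ([] ∷ []) l [] (λ _ → clearsᵗ l)))

flag : Str → Str → Str
flag []      t = t
flag (_ ∷ _) t = false ∷ []

raiseFlagᵗ : ∀ {b ρ} c t s → Triple b ρ (nth (c ∷ t ∷ s ∷ [])) (raiseFlag (b + 2) (b + 1)) (nth (c ∷ flag s t ∷ []))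
raiseFlagᵗ c t []      = post (λ { 0 → refl ; 1 → refl ; 2 → refl ; (suc (suc (suc _))) → refl }) (loop-[]ᵗ 2 refl)
raiseFlagᵗ c t (d ∷ s) = loop-∷ᵗ 2 d refl (⨾ᵗ (⨾ᵗ (clearᵗ 1) (pushᵗ 1 false))
  (pre (λ { 0 → refl ; 1 → refl ; 2 → refl ; (suc (suc (suc _))) → refl })
    (post (λ { 0 → refl ; 1 → lemma s ; (suc (suc _)) → refl }) (raiseFlagᵗ c (false ∷ []) s))))
  where
  lemma : ∀ s → flag s (false ∷ []) ≡ false ∷ []
  lemma []      = refl
  lemma (_ ∷ _) = refl

Args : ℕ → Store → Vec ℕ n → Vec Str n → Set
Args b ρ as v = ∀ i → lookup as i < b × ρ (lookup as i) ≡ lookup v i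

Args-frame : ∀ {b ρ H σ} d (as : Vec ℕ n) v → Shape b ρ H σ → Args b ρ as v → Args (b + d) σ as v
Args-frame {b = b} d as v (lo , _) args i = let lt , eq = args i in <-≤-trans lt (m≤m+n b d) , trans (lo _ lt) eq

Args-∷ : ∀ {b ρ H σ} d k {as : Vec ℕ n} {v s} → k < d → H k ≡ s → Shape b ρ H σ → Args (b + d) σ as v →
         Args (b + d) σ ((b + k) ∷ as) (s ∷ v)
Args-∷ {b = b} d k k<d eq (_ , hi) args zero    = +-monoʳ-< b k<d , trans (hi k) eq
Args-∷         d k k<d eq sh       args (suc i) = args i

lookup-range : ∀ c m (i : Fin m) → lookup (range c m) i ≡ c + toℕ i
lookup-range c (suc m) zero    = refl
lookup-range c (suc m) (suc i) = trans (lookup-range (c + 1) m i) (+-assoc c 1 (toℕ i))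

nth-toList : (us : Vec Str m) (i : Fin m) → nth (toList us) (toℕ i) ≡ lookup us i
nth-toList (_ ∷ _)  zero    = refl
nth-toList (_ ∷ us) (suc i) = nth-toList us i

Args-range : ∀ {b ρ σ s} (us : Vec Str m) → Shape b ρ (nth (s ∷ toList us)) σ →
             Args (b + suc (length (toList us))) σ (range (b + 1) m) us
Args-range {m} {b} {σ = σ} us (_ , hi) i = subst (_< _) (sym eq)
    (+-monoʳ-< b (s≤s (subst (toℕ i <_) (sym (length-toList us)) (toℕ<n i))))
  , trans (cong σ eq) (trans (hi (suc (toℕ i))) (nth-toList us i))
  where
  eq : lookup (range (b + 1) m) i ≡ b + suc (toℕ i)
  eq = trans (lookup-range (b + 1) m i) (+-assoc b 1 (toℕ i))

⨾-assocᵗ : ∀ {b ρ H P Q R H′} → Triple b ρ H (P ⨾ Q ⨾ R) H′ → Triple b ρ H ((P ⨾ Q) ⨾ R) H′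
⨾-assocᵗ t sh = let σ′ , d , sh′ = t sh in σ′ , assoc d , sh′
  where
  assoc : ∀ {P Q R σ σ′ u u′} → P ⨾ Q ⨾ R ∶ σ , u ⇒ σ′ , u′ → (P ⨾ Q) ⨾ R ∶ σ , u ⇒ σ′ , u′
  assoc (p ⨾ (q ⨾ r)) = (p ⨾ q) ⨾ r

Computes : Rec n → Vec ℕ n → Vec Str n → ℕ → Str → Set
Computes f as v b r = ∀ {ρ} → Args b ρ as v → Triple b ρ (nth []) (program f as b) (nth (r ∷ []))

module _ {f : Rec (suc n)} {as : Vec ℕ n} {v : Vec Str n} {b : ℕ} {ρ : Store} (args : Args b ρ as v) where

  muBodyᵗ : ∀ {c s} → Computes f ((b + 0) ∷ as) (c ∷ v) (b + 2) s →
            Triple b ρ (nth (c ∷ [])) (muBody f as b) (nth (c ∷ flag s [] ∷ []))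
  muBodyᵗ {c} {s} t = ⨾ᵗ
    (pre (λ { 0 → refl ; 1 → refl ; (suc (suc _)) → refl })
      (frameᵗ (c ∷ [] ∷ []) [] (s ∷ []) (λ sh → t (Args-∷ 2 0 (s≤s z≤n) refl sh (Args-frame 2 as v sh args)))))
    (raiseFlagᵗ c [] s)

  private
    muLoop : Prog
    muLoop = loop (b + 1) (λ first → (if first then nop else push (b + 0) false) ⨾ muBody f as b)

  muᵗ : ∀ k → (∀ i → i < k → ∃₂ λ c w → Computes f ((b + 0) ∷ as) (replicate i false ∷ v) (b + 2) (c ∷ w)) →
        Computes f ((b + 0) ∷ as) (replicate k false ∷ v) (b + 2) [] →
        Triple b ρ (nth []) (program (mu f) as b) (nth (replicate k false ∷ []))
  muᵗ k below at = ⨾ᵗ (pushᵗ 1 true)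
    (loop-∷ᵗ 1 true refl (⨾-assocᵗ (⨾ᵗ nopᵗ (pre (λ { 0 → refl ; 1 → refl ; (suc (suc _)) → refl }) (after k 0 refl)))))
    where
    after : ∀ d j → j + d ≡ k → Triple b ρ (nth (replicate j false ∷ [])) (muBody f as b ⨾ muLoop) (nth (replicate k false ∷ []))
    after zero j eq with refl ← trans (sym (+-identityʳ j)) eq =
      ⨾ᵗ (muBodyᵗ at) (post (λ { 0 → refl ; 1 → refl ; (suc (suc _)) → refl }) (loop-[]ᵗ 1 refl))
    after (suc d) j eq with below j (subst (j <_) eq (m<m+n j (s≤s z≤n)))
    ... | c , w , t = ⨾ᵗ (muBodyᵗ t) (loop-∷ᵗ 1 false refl (⨾-assocᵗ (⨾ᵗ (pushᵗ 0 false)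
      (pre (λ { 0 → refl ; 1 → refl ; (suc (suc _)) → refl }) (after d (suc j) (trans (sym (+-suc j d)) eq))))))

module _ {h : Bool → Rec (2 + n)} {as : Vec ℕ n} {v : Vec Str n} {b : ℕ} {ρ : Store} (args : Args b ρ as v) where

  recBodyᵗ : ∀ {c r t w s} → Computes (h c) ((b + 2) ∷ (b + 0) ∷ as) (w ∷ r ∷ v) (b + 3) s →
             Triple b ρ (nth (r ∷ t ∷ w ∷ [])) (recBody h as b c) (nth (s ∷ t ∷ (c ∷ w) ∷ []))
  recBodyᵗ {c} {r} {t} {w} {s} tr = post
    (λ { 0 → ++-identityʳ s ; 1 → refl ; 2 → refl ; 3 → refl ; (suc (suc (suc (suc _)))) → refl })
    (⨾ᵗ (frameᵗ (r ∷ t ∷ w ∷ []) [] (s ∷ []) (λ sh → tr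
          (Args-∷ 3 2 (s≤s (s≤s (s≤s z≤n))) refl sh (Args-∷ 3 0 (s≤s z≤n) refl sh (Args-frame 3 as v sh args)))))
      (⨾ᵗ (clearᵗ 0) (⨾ᵗ (transferᵗ 3 0 4 (λ ()) (λ ()) (λ ()) refl) (pushᵗ 2 c))))

mutual
  program-correct : {f : Rec n} {v : Vec Str n} {r : Str} → f ⟨ v ⟩⇓ r → ∀ as b → Computes f as v b r
  program-correct ⇓empty     as b args = post (λ { zero → refl ; (suc _) → refl }) nopᵗ
  program-correct (⇓prefix {c} {w}) (a ∷ []) b args = let a<b , eq = args zero in
    post (λ { 0 → cong (c ∷_) (trans (++-identityʳ _) eq) ; (suc _) → refl })
      (⨾ᵗ (copyᵗ a 0 1 a<b (λ ()) refl) (pushᵗ 0 c))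
  program-correct (⇓proj i)  as b args = let a<b , eq = args i in
    post (λ { 0 → trans (++-identityʳ _) eq ; (suc _) → refl }) (copyᵗ (lookup as i) 0 1 a<b (λ ()) refl)
  program-correct (⇓comp {m = m} {f = f} {v = v} {us = us} {r = r} ds d) as b {ρ} args =
    ⨾ᵗ (pre (λ { 0 → refl ; (suc _) → refl })
         (frameᵗ ([] ∷ []) [] (toList us) (λ sh → programs-correct ds as (b + 1) (Args-frame 1 as v sh args))))
      -- The program speaks of the arity `m`, the triples speak of the length of `toList us`.
      (subst (λ len → Triple b ρ (nth ([] ∷ toList us))
          (program f (range (b + 1) m) (b + suc len) ⨾ transfer (b + suc len) (b + 0) (b + suc (suc len)) ⨾ clears (b + 1) len)
          (nth (r ∷ [])))
        (length-toList us)
        (⨾ᵗ (pre nth-nil (frameᵗ ([] ∷ toList us) [] (r ∷ []) (λ sh →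
               program-correct d (range (b + 1) m) (b + suc len) (Args-range us (Shape-cong (sym ∘ nth-nil) sh)))))
          (⨾ᵗ (post moved (transferᵗ (suc len) 0 (suc (suc len)) (λ ()) (1+n≢n ∘ sym) (λ ()) (nth-beyond (toList us ++ r ∷ []) (suc len) le)))
            (frameᵗ (r ∷ []) (toList us) [] (λ _ → clearsᵗ (toList us))))))
    where
    len : ℕ
    len = length (toList us)
    nth-nil : ∀ i → nth ([] ∷ toList us) i ≡ nth (([] ∷ toList us) ++ []) i
    nth-nil i = cong (λ l → nth ([] ∷ l) i) (sym (++-identityʳ (toList us)))
    le : length (toList us ++ r ∷ []) ≤ suc len
    le = subst (_≤ suc len) (sym (trans (length-++ (toList us)) (+-comm len 1))) ≤-refl
    moved : ∀ i → (nth ([] ∷ toList us ++ r ∷ []) [ suc len ≔ [] ] [ 0 ≔ nth (toList us ++ r ∷ []) len ++ [] ]) i ≡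
                  nth (r ∷ toList us) i
    moved zero    = trans (++-identityʳ _) (nth-last (toList us) r)
    moved (suc i) = nth-drop-last (toList us) r i
  program-correct (⇓rec-[] d) (a ∷ as) b args = rec-correct (⇓rec-[] d) a as b args
  program-correct (⇓rec-∷ d e) (a ∷ as) b args = rec-correct (⇓rec-∷ d e) a as b args
  program-correct (⇓mu k below at) as b args =
    muᵗ args k (λ i i<k → mu-below-correct (below i i<k) _ _) (program-correct at _ _)

  mu-below-correct : {f : Rec n} {v : Vec Str n} → (∃₂ λ c w → f ⟨ v ⟩⇓ (c ∷ w)) →
                     ∀ as b → ∃₂ λ c w → Computes f as v b (c ∷ w)
  mu-below-correct (c , w , d) as b = c , w , program-correct d as b

  rec-correct : {f : Rec n} {h : Bool → Rec (2 + n)} {w : Str} {v : Vec Str n} {r : Str} → rec f h ⟨ w ∷ v ⟩⇓ r →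
                ∀ a as b → Computes (rec f h) (a ∷ as) (w ∷ v) b r
  rec-correct {w = w} {v} {r} d a as b args with rec-unroll d as b (args ∘ suc) | args zero
  ... | r₀ , t , unroll | a<b , eq = post (λ { 0 → refl ; 1 → refl ; 2 → refl ; (suc (suc (suc _))) → refl })
    (⨾ᵗ (copyᵗ a 2 3 a<b (λ ()) refl)
    (⨾ᵗ (post (λ { 0 → refl ; 1 → cong (_ʳ++ []) (trans (++-identityʳ _) eq) ; 2 → refl ; (suc (suc (suc _))) → refl })
          (spillᵗ 2 1 (λ ())))
    (⨾ᵗ (frameᵗ ([] ∷ (w ʳ++ []) ∷ [] ∷ []) [] (r₀ ∷ []) (λ sh → t (Args-frame 3 as v sh (args ∘ suc))))
    (⨾ᵗ (post (λ { 0 → ++-identityʳ r₀ ; 1 → refl ; 2 → refl ; 3 → refl ; (suc (suc (suc (suc _)))) → refl })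
          (transferᵗ 3 0 4 (λ ()) (λ ()) (λ ()) refl))
    (⨾ᵗ (unroll [] (loop-[]ᵗ 1 refl)) (clearᵗ 2))))))

  -- The loop meets the letters in the order opposite to that of the derivation. Hence the
  -- continuation form: whatever the loop reaches once `w` is processed and `t` is still to come, it
  -- also reaches from the start.
  rec-unroll : {f : Rec n} {h : Bool → Rec (2 + n)} {w : Str} {v : Vec Str n} {r : Str} → rec f h ⟨ w ∷ v ⟩⇓ r →
    ∀ as b {ρ} → Args b ρ as v → ∃ λ r₀ → Computes f as v (b + 3) r₀ ×
      (∀ t {H} → Triple b ρ (nth (r ∷ t ∷ w ∷ [])) (loop (b + 1) (recBody h as b)) H →
                 Triple b ρ (nth (r₀ ∷ (w ʳ++ t) ∷ [] ∷ [])) (loop (b + 1) (recBody h as b)) H)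
  rec-unroll (⇓rec-[] d) as b args = _ , program-correct d as (b + 3) , λ t tr → tr
  rec-unroll {h = h} (⇓rec-∷ {b = c} d e) as b args with rec-unroll d as b args
  ... | r₀ , tr₀ , unroll = r₀ , tr₀ , λ t tr → unroll (c ∷ t) (loop-∷ᵗ 1 c refl
    (⨾ᵗ (pre (λ { 0 → refl ; 1 → refl ; 2 → refl ; (suc (suc (suc _))) → refl })
          (recBodyᵗ {h = h} args (program-correct e _ (b + 3)))) tr))

  programs-correct : {gs : Vec (Rec n) m} {v : Vec Str n} {us : Vec Str m} → gs ⟪ v ⟫⇓ us →
    ∀ as b {ρ} → Args b ρ as v → Triple b ρ (nth []) (programs gs as b) (nth (toList us))
  programs-correct []       as b args = nopᵗ
  programs-correct (_∷_ {v = v} {r} {rs} d ds) as b args = ⨾ᵗ (program-correct d as b args)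
    (frameᵗ (r ∷ []) [] (toList rs) (λ sh → programs-correct ds as (b + 1) (Args-frame 1 as v sh args)))

-- Machine code for programs on stacks

-- The blank is reserved for the cell below a stack, so one scan tells an empty stack from either
-- letter on top.
bit : Bool → Fin 3
bit false = suc zero
bit true  = suc (suc zero)

-- The behaviour of one state. Only the jump target depends on what is scanned, and different
-- reactions are given to different states; this keeps the encoding easy to compute.
record Instr (K : ℕ) : Set where
  field
    nextᴵ   : Maybe Bool → Vec (Fin 3) K → Maybe ℕ
    readsᴵ  : Bool
    writesᴵ : Vec (Fin 3 × Move) K

-- Turns any address into a state, so that `machine` is defined without a proof that jumps stay
-- inside the code. In the encoding it appears as a minimum with the last state.
clamp : ∀ {n} → ℕ → Fin (suc n)
clamp         zero    = zero
clamp {zero}  (suc t) = zero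
clamp {suc n} (suc t) = suc (clamp t)

toℕ-clamp : ∀ t → toℕ (clamp {n} t) ≡ t ⊓ n
toℕ-clamp         zero    = refl
toℕ-clamp {zero}  (suc t) = refl
toℕ-clamp {suc n} (suc t) = cong suc (toℕ-clamp t)

machine : ∀ K → Instr (suc K) → List (Instr (suc K)) → TM
machine K c cs = record
  { tapes′ = K ; states′ = length cs ; symbols′ = 2
  ; δ = λ q a s → let open Instr (List.lookup (c ∷ cs) q) in
      Maybe.map (λ t → clamp t , readsᴵ , writesᴵ) (nextᴵ a s)
  }

at : ∀ {k} → Vec (Fin 3) k → ℕ → Fin 3
at []      _       = zero
at (a ∷ _) zero    = a
at (_ ∷ s) (suc i) = at s i

branch : ℕ → ℕ → ℕ → Fin 3 → ℕ
branch e f t zero             = e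
branch e f t (suc zero)       = f
branch e f t (suc (suc zero)) = t

size : Prog → ℕ
size nop        = 0
size (push i b) = 1
size (P ⨾ Q)    = size P + size Q
size (loop i P) = 2 + (size (P false) + (1 + (size (P true) + 1)))
size (read i)   = 4

module _ {K : ℕ} where

  idle : Vec (Fin 3 × Move) K
  idle = Vec.replicate K (zero , stay)

  only : ℕ → Fin 3 × Move → Vec (Fin 3 × Move) K
  only i w = Vec.tabulate (λ j → if toℕ j ≡ᵇ i then w else (zero , stay))

  stopᴵ : Instr K
  stopᴵ = record { nextᴵ = λ _ _ → nothing ; readsᴵ = false ; writesᴵ = idle }

  jumpᴵ : ℕ → Instr K
  jumpᴵ t = record { nextᴵ = λ _ _ → just t ; readsᴵ = false ; writesᴵ = idle }

  pushᴵ : ℕ → Bool → ℕ → Instr K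
  pushᴵ i b t = record { nextᴵ = λ _ _ → just t ; readsᴵ = false ; writesᴵ = only i (bit b , right) }

  leftᴵ : ℕ → ℕ → Instr K
  leftᴵ i t = record { nextᴵ = λ _ _ → just t ; readsᴵ = false ; writesᴵ = only i (zero , left) }

  branchᴵ : ℕ → ℕ → ℕ → ℕ → Instr K
  branchᴵ i e f t = record { nextᴵ = λ _ s → just (branch e f t (at s i)) ; readsᴵ = false ; writesᴵ = idle }

  readᴵ : ℕ → Instr K
  readᴵ t = record { nextᴵ = λ _ _ → just t ; readsᴵ = true ; writesᴵ = idle }

  inputᴵ : ℕ → ℕ → Instr K
  inputᴵ f t = record { nextᴵ = λ a _ → Maybe.map (if_then t else f) a ; readsᴵ = false ; writesᴵ = idle }

  -- Jump targets are absolute; pc is the address of the code.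
  assemble : Prog → ℕ → List (Instr K)
  assemble nop        pc = []
  assemble (push i b) pc = pushᴵ i b (pc + 1) ∷ []
  assemble (P ⨾ Q)    pc = assemble P pc ++ assemble Q (pc + size P)
  assemble (loop i P) pc =
    leftᴵ i (pc + 1) ∷
    branchᴵ i (pc + size (loop i P)) (pc + 2) (pc + 2 + size (P false) + 1) ∷
    assemble (P false) (pc + 2) ++
    jumpᴵ pc ∷
    assemble (P true) (pc + 2 + size (P false) + 1) ++
    jumpᴵ pc ∷ []
  assemble (read i)   pc =
    readᴵ (pc + 1) ∷ inputᴵ (pc + 2) (pc + 3) ∷ pushᴵ i false (pc + 4) ∷ pushᴵ i true (pc + 4) ∷ []

  length-assemble : ∀ P pc → length (assemble P pc) ≡ size P
  length-assemble nop        pc = refl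
  length-assemble (push i b) pc = refl
  length-assemble (P ⨾ Q)    pc = trans (length-++ (assemble P pc))
    (cong₂ _+_ (length-assemble P pc) (length-assemble Q (pc + size P)))
  length-assemble (loop i P) pc = cong (2 +_) (trans (length-++ (assemble (P false) (pc + 2)))
    (cong₂ _+_ (length-assemble (P false) (pc + 2)) (cong suc
      (trans (length-++ (assemble (P true) (pc + 2 + size (P false) + 1)))
        (cong (_+ 1) (length-assemble (P true) (pc + 2 + size (P false) + 1)))))))
  length-assemble (read i)   pc = refl

-- Only `loop` inspects a stack, so only its stack has to be a tape: a push beyond the last tape
-- does nothing, and `Represents` does not see that stack.
height : Prog → ℕ
height nop        = 0
height (push i b) = 0
height (P ⨾ Q)    = height P ⊔ height Q
height (loop i P) = suc i ⊔ (height (P false) ⊔ height (P true))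
height (read i)   = 0

Segment : {A : Set} → List A → ℕ → List A → Set
Segment code pc seg = ∃₂ λ pre post → code ≡ pre ++ seg ++ post × pc ≡ length pre

module _ {A : Set} where

  segment-++ : ∀ {code : List A} {pc} xs {ys} → Segment code pc (xs ++ ys) →
               Segment code pc xs × Segment code (pc + length xs) ys
  segment-++ {pc = pc} xs {ys} (pre , post , eq , len) =
    (pre , ys ++ post , trans eq (cong (pre ++_) (++-assoc xs ys post)) , len) ,
    (pre ++ xs , post , trans eq (trans (cong (pre ++_) (++-assoc xs ys post)) (sym (++-assoc pre xs (ys ++ post)))) ,
      trans (cong (_+ length xs) len) (sym (length-++ pre)))

  segment-lookup : ∀ {c : A} {cs pc x xs} → Segment (c ∷ cs) pc (x ∷ xs) → List.lookup (c ∷ cs) (clamp pc) ≡ x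
  segment-lookup ([]          , post , eq , refl) = ∷-injectiveˡ eq
  segment-lookup {cs = []}     (_ ∷ []      , post , () , refl)
  segment-lookup {cs = []}     (_ ∷ _ ∷ _   , post , () , refl)
  segment-lookup {cs = _ ∷ _}  (_ ∷ pre     , post , eq , refl) = segment-lookup (pre , post , ∷-injectiveʳ eq , refl)

module Simulation (K : ℕ) (c : Instr (suc K)) (cs : List (Instr (suc K))) where
  M : TM
  M = machine K c cs

  open Run M

  -- A stack is the part of a tape to the left of the head; the scanned cell and
  -- everything to its right are junk.
  Represents : Store → Vec (Tape (Fin 3)) (suc K) → Set
  Represents σ ts = ∀ i → Tape.before (lookup ts i) ≡ map bit (σ (toℕ i))

  Halts : ℕ → Store → Inp → Set
  Halts pc σ u = ∀ ts → Represents σ ts → StopsFrom (config (clamp pc) u ts)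

  At : ℕ → Instr (suc K) → Set
  At pc ins = List.lookup (c ∷ cs) (clamp pc) ≡ ins

  δ-at : ∀ pc {ins} → At pc ins → ∀ a s →
         TM.δ M (clamp pc) a s ≡ Maybe.map (λ t → clamp t , Instr.readsᴵ ins , Instr.writesᴵ ins) (Instr.nextᴵ ins a s)
  δ-at pc refl a s = refl

  after : ∀ (ws : Vec (Fin 3 × Move) (suc K)) ts i →
          lookup (Vec.zipWith update ws ts) i ≡ update (lookup ws i) (lookup ts i)
  after ws ts i = lookup-zipWith update i ws ts

  after-only : ∀ i w ts j → lookup (Vec.zipWith update (only i w) ts) j ≡
               update (if toℕ j ≡ᵇ i then w else (zero , stay)) (lookup ts j)
  after-only i w ts j = trans (after (only i w) ts j) (cong (λ w → update w (lookup ts j)) (lookup∘tabulate (λ j → if toℕ j ≡ᵇ i then w else (zero , stay)) j))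

  represents-idle : ∀ {σ} ts → Represents σ ts → Represents σ (Vec.zipWith update idle ts)
  represents-idle ts r i = trans (cong Tape.before (trans (after idle ts i)
    (cong (λ w → update w (lookup ts i)) (lookup-replicate i (zero , stay))))) (r i)

  before-right : ∀ a t → Tape.before (move right (record t { head = a })) ≡ a ∷ Tape.before t
  before-right a ⟪ ls , _ , [] ⟫    = refl
  before-right a ⟪ ls , _ , _ ∷ _ ⟫ = refl

  represents-push : ∀ {σ ts} i b → Represents σ ts →
    Represents (σ [ i ≔ b ∷ σ i ]) (Vec.zipWith update (only i (bit b , right)) ts)
  represents-push {σ} {ts} i b r j rewrite after-only i (bit b , right) ts j
    with toℕ j ≡ᵇ i in eq
  ... | false = r j
  ... | true  = trans (before-right (bit b) (lookup ts j)) (cong (bit b ∷_)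
    (trans (r j) (cong (map bit ∘ σ) (≡ᵇ⇒≡ (toℕ j) i (subst T (sym eq) _)))))

  top : Str → Fin 3
  top []      = zero
  top (b ∷ _) = bit b

  rest : Str → Str
  rest []      = []
  rest (_ ∷ s) = s

  -- On an empty stack the head moves onto a fresh blank cell, which is what `branchᴵ` takes for the
  -- bottom, and the part to its left remains empty.
  left-tape : ∀ t s → Tape.before t ≡ map bit s →
    Tape.before (move left (record t { head = zero })) ≡ map bit (rest s) ×
    Tape.head (move left (record t { head = zero })) ≡ top s
  left-tape ⟪ []     , _ , _ ⟫ []      eq   = refl , refl
  left-tape ⟪ l ∷ ls , _ , _ ⟫ (b ∷ s) refl = refl , refl

  module _ {σ ts} (i : ℕ) (r : Represents σ ts) where
    private
      ts′ : Vec (Tape (Fin 3)) (suc K)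
      ts′ = Vec.zipWith update (only i (zero , left)) ts

    represents-left : Represents (σ [ i ≔ rest (σ i) ]) ts′
    represents-left j rewrite after-only i (zero , left) ts j
      with toℕ j ≡ᵇ i in eq
    ... | false = r j
    ... | true  = proj₁ (left-tape (lookup ts j) (σ i) (trans (r j)
      (cong (map bit ∘ σ) (≡ᵇ⇒≡ (toℕ j) i (subst T (sym eq) _)))))

    head-left : ∀ j → toℕ j ≡ i → Tape.head (lookup ts′ j) ≡ top (σ i)
    head-left j refl rewrite after-only i (zero , left) ts j
      | ≡ᵇ-refl (toℕ j) = proj₂ (left-tape (lookup ts j) (σ i) (r j))

  at-lookup : ∀ {k} (s : Vec (Fin 3) k) {i} → i < k → ∃ λ j → toℕ j ≡ i × at s i ≡ lookup s j
  at-lookup (_ ∷ _) {zero}  _         = zero , refl , refl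
  at-lookup (_ ∷ s) {suc i} (s≤s i<k) = let j , eq , eq′ = at-lookup s i<k in suc j , cong suc eq , eq′

  halts-jump : ∀ {pc t σ u} → At pc (jumpᴵ t) → Halts t σ u → Halts pc σ u
  halts-jump {pc} {σ = σ} {a , _} e h ts r = step (δ-at pc e a _) keep (h _ (represents-idle {σ} ts r))

  halts-push : ∀ {pc i b t σ u} → At pc (pushᴵ i b t) → Halts t (σ [ i ≔ b ∷ σ i ]) u → Halts pc σ u
  halts-push {pc} {i} {b} {σ = σ} {a , _} e h ts r = step (δ-at pc e a _) keep (h _ (represents-push {σ} {ts} i b r))

  halts-stop : ∀ {pc σ a} → At pc stopᴵ → Halts pc σ (a , [])
  halts-stop {pc} {a = a} e ts r = stop (δ-at pc e a _)

  halts-pop : ∀ {pc pc′ i e f t σ u} → i < suc K → At pc (leftᴵ i pc′) → At pc′ (branchᴵ i e f t) →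
    Halts (branch e f t (top (σ i))) (σ [ i ≔ rest (σ i) ]) u → Halts pc σ u
  halts-pop {pc} {pc′} {i} {e} {f} {t} {σ} {u = a , _} i<K l br h ts r = step (δ-at pc l a _) keep (step (trans (δ-at pc′ br a _) eq) keep
    (h _ (represents-idle {σ [ i ≔ rest (σ i) ]} ts′ (represents-left {σ} {ts} i r))))
    where
    ts′ : Vec (Tape (Fin 3)) (suc K)
    ts′ = Vec.zipWith update (only i (zero , left)) ts
    eq : just (clamp (branch e f t (at (Vec.map Tape.head ts′) i)) , false , idle) ≡ just (clamp (branch e f t (top (σ i))) , false , idle)
    eq with at-lookup (Vec.map Tape.head ts′) i<K
    ... | j , eqj , eqs = cong (λ s → just (clamp (branch e f t s) , false , idle))
      (trans eqs (trans (lookup-map j Tape.head ts′) (head-left {σ} {ts} i r j eqj)))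

  -- The letter is visible only after the input head has moved: one state moves, the next one
  -- inspects, and one of two others pushes.
  halts-read : ∀ {pc pc′ pcᶠ pcᵗ t i σ a b u} → At pc (readᴵ pc′) → At pc′ (inputᴵ pcᶠ pcᵗ) →
    At pcᶠ (pushᴵ i false t) → At pcᵗ (pushᴵ i true t) →
    Halts t (σ [ i ≔ b ∷ σ i ]) (just b , u) → Halts pc σ (a , b ∷ u)
  halts-read {pc} {pc′} {pcᶠ} {pcᵗ} {σ = σ} {a} {false} rd inp pf pt h ts r =
    step (δ-at pc rd a _) read (step (δ-at pc′ inp (just false) _) keep (halts-push {pcᶠ} pf h _ (represents-idle {σ} (Vec.zipWith update idle ts) (represents-idle {σ} ts r))))
  halts-read {pc} {pc′} {pcᶠ} {pcᵗ} {σ = σ} {a} {true}  rd inp pf pt h ts r =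
    step (δ-at pc rd a _) read (step (δ-at pc′ inp (just true) _) keep (halts-push {pcᵗ} pt h _ (represents-idle {σ} (Vec.zipWith update idle ts) (represents-idle {σ} ts r))))

  Halts-cong : ∀ {pc σ σ′ u} → (∀ j → σ j ≡ σ′ j) → Halts pc σ′ u → Halts pc σ u
  Halts-cong eq h ts r = h ts (λ i → trans (r i) (cong (map bit) (eq (toℕ i))))

  Code : ℕ → List (Instr (suc K)) → Set
  Code = Segment (c ∷ cs)

  at-address : ∀ {pc pc′ ins} → pc ≡ pc′ → At pc ins → At pc′ ins
  at-address refl e = e

  code-address : ∀ {pc pc′ is} → pc ≡ pc′ → Code pc is → Code pc′ is
  code-address refl s = s

  code-∷ : ∀ {pc ins is} → Code pc (ins ∷ is) → At pc ins × Code (pc + 1) is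
  code-∷ {pc} {ins} s = segment-lookup {pc = pc} s , proj₂ (segment-++ (ins ∷ []) s)

  code-++ : ∀ {pc} P {is} → Code pc (assemble P pc ++ is) → Code pc (assemble P pc) × Code (pc + size P) is
  code-++ {pc} P {is} s = let l , r = segment-++ (assemble P pc) s in
    l , subst (λ k → Code (pc + k) is) (length-assemble P pc) r

  -- `StopsFrom` is built from the end of a run, so correctness is stated backwards as well:
  -- stopping from behind the code implies stopping from its beginning.
  run-halts : ∀ {P σ u σ′ u′} → P ∶ σ , u ⇒ σ′ , u′ → ∀ {pc} → height P ≤ suc K → Code pc (assemble P pc) →
              Halts (pc + size P) σ′ u′ → Halts pc σ u
  run-halts {σ = σ} {u} nop {pc} hP s h = subst (λ pc → Halts pc σ u) (+-identityʳ pc) h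
  run-halts push {pc} hP s h = halts-push {pc} (segment-lookup {pc = pc} s) h
  run-halts {P ⨾ Q} {σ′ = σ′} {u′} (d ⨾ e) {pc} hP s h with code-++ {pc} P s
  ... | sP , sQ = run-halts d (≤-trans (m≤m⊔n _ (height Q)) hP) sP
    (run-halts e (≤-trans (m≤n⊔m (height P) _) hP) sQ (subst (λ pc → Halts pc σ′ u′) (sym (+-assoc pc (size P) (size Q))) h))
  run-halts {read i} read {pc} hP s h with code-∷ {pc} s
  ... | a₀ , s₁ with code-∷ {pc + 1} s₁
  ... | a₁ , s₂ with code-∷ {pc + 1 + 1} s₂
  ... | a₂ , s₃ with code-∷ {pc + 1 + 1 + 1} s₃
  ... | a₃ , _ = halts-read {pc} {pc + 1} {pc + 2} {pc + 3} a₀ a₁ (at-address (+-assoc pc 1 1) a₂)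
    (at-address (trans (+-assoc (pc + 1) 1 1) (+-assoc pc 1 2)) a₃) h
  run-halts {loop i P} {σ} {u} (loop-[] eq) {pc} hP s h with code-∷ {pc} s
  ... | a₀ , s₁ with code-∷ {pc + 1} s₁
  ... | a₁ , _ = halts-pop {pc} {pc + 1} {σ = σ} (≤-trans (m≤m⊔n (suc i) (height (P false) ⊔ height (P true))) hP) a₀ a₁
    (subst (λ t → Halts (branch (pc + size (loop i P)) (pc + 2) (pc + 2 + size (P false) + 1) (top t)) (σ [ i ≔ rest t ]) u) (sym eq)
      (Halts-cong same h))
    where
    same : ∀ j → (σ [ i ≔ [] ]) j ≡ σ j
    same j with j ≡ᵇ i in e
    ... | true  = trans (sym eq) (cong σ (sym (≡ᵇ⇒≡ j i (subst T (sym e) _))))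
    ... | false = refl
  run-halts {loop i P} {σ} {u} (loop-∷ {b = b} {s = s′} eq (_⨾_ {σ′ = σ₁} {u′ = u₁} d e)) {pc} hP s h with code-∷ {pc} s
  ... | a₀ , s₁ with code-∷ {pc + 1} s₁
  ... | a₁ , s₂ with code-++ {pc + 2} (P false) (code-address (+-assoc pc 1 1) s₂)
  ... | sF , s₃ with code-∷ {pc + 2 + size (P false)} s₃
  ... | aF , s₄ with code-++ {pc + 2 + size (P false) + 1} (P true) s₄
  ... | sT , s₅ with code-∷ {pc + 2 + size (P false) + 1 + size (P true)} {is = []} s₅
  ... | aT , _ = halts-pop {pc} {pc + 1} {σ = σ} (≤-trans (m≤m⊔n (suc i) (height (P false) ⊔ height (P true))) hP) a₀ a₁
    (subst (λ t → Halts (branch (pc + size (loop i P)) (pc + 2) (pc + 2 + size (P false) + 1) (top t)) (σ [ i ≔ rest t ]) u) (sym eq)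
      (body b d))
    where
    hBodies : height (P false) ⊔ height (P true) ≤ suc K
    hBodies = ≤-trans (m≤n⊔m (suc i) (height (P false) ⊔ height (P true))) hP
    again : Halts pc σ₁ u₁
    again = run-halts e hP s h
    body : ∀ b → P b ∶ σ [ i ≔ s′ ] , u ⇒ σ₁ , u₁ →
           Halts (branch (pc + size (loop i P)) (pc + 2) (pc + 2 + size (P false) + 1) (bit b)) (σ [ i ≔ s′ ]) u
    body false d = run-halts d (≤-trans (m≤m⊔n (height (P false)) (height (P true))) hBodies) sF (halts-jump {pc + 2 + size (P false)} {pc} {σ₁} {u₁} aF again)
    body true  d = run-halts d (≤-trans (m≤n⊔m (height (P false)) (height (P true))) hBodies) sT (halts-jump {pc + 2 + size (P false) + 1 + size (P true)} {pc} {σ₁} {u₁} aT again)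

-- Encodings of machines with a loader

lit : Str → Tm Γ str
lit []      = ε
lit (b ∷ s) = b ◂ lit s

eval-lit : ∀ s (ρ : Env Γ) → eval (lit s) ρ ≡ s
eval-lit []      ρ = refl
eval-lit (b ∷ s) ρ = cong (b ∷_) (eval-lit s ρ)

add : ℕ → Tm Γ nat → Tm Γ nat
add zero    t = t
add (suc n) t = su (add n t)

eval-add : ∀ n (t : Tm Γ nat) ρ → eval (add n t) ρ ≡ n + eval t ρ
eval-add zero    t ρ = refl
eval-add (suc n) t ρ = cong suc (eval-add n t ρ)

infixr 5 _⊕_

_⊕_ : Tm Γ str → Tm Γ str → Tm Γ str
t ⊕ u = call appendᵗ (t ∷ u ∷ [])

eval-⊕ : ∀ (t u : Tm Γ str) {ρ x y} → eval t ρ ≡ x → eval u ρ ≡ y → eval (t ⊕ u) ρ ≡ x ++ y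
eval-⊕ t u {ρ} p q = trans (eval-append (eval t ρ) (eval u ρ)) (cong₂ _++_ p q)

concatMapᵗ : (A → Tm Γ str) → List A → Tm Γ str
concatMapᵗ f []       = ε
concatMapᵗ f (a ∷ as) = f a ⊕ concatMapᵗ f as

eval-concatMap : (f : A → Tm Γ str) {g : A → Str} {ρ : Env Γ} → (∀ a → eval (f a) ρ ≡ g a) →
                 ∀ as → eval (concatMapᵗ f as) ρ ≡ concatMap g as
eval-concatMap f eq []       = refl
eval-concatMap f eq (a ∷ as) = eval-⊕ (f a) (concatMapᵗ f as) (eq a) (eval-concatMap f eq as)

numeralᵗ : Tm (nat ∷ []) str
numeralᵗ = natRec v0 (false ◂ ε) (true ◂ v1)

eval-numeral : ∀ n → eval numeralᵗ (n ∷ []) ≡ ⌜ n ⌝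
eval-numeral n = trans (recNat-ext refl (λ _ _ → refl) n) (go n)
  where
  go : ∀ n → recNat (false ∷ []) (λ _ → true ∷_) n ≡ ⌜ n ⌝
  go zero    = refl
  go (suc n) = cong (true ∷_) (go n)

lengthᵗ : Tm (str ∷ []) nat
lengthᵗ = strRec v0 ze (λ _ → su v1)

eval-length : ∀ s → eval lengthᵗ (s ∷ []) ≡ length s
eval-length s = trans (recStr-cong {f = id} refl (λ _ _ _ → refl) s) (go s)
  where
  go : ∀ s → recStr 0 (λ _ _ → suc) s ≡ length s
  go []      = refl
  go (_ ∷ s) = cong suc (go s)

monusᵗ : Tm (nat ∷ nat ∷ []) nat
monusᵗ = natRec v1 v0 (natRec v1 ze v0)

eval-monus : ∀ m n → eval monusᵗ (m ∷ n ∷ []) ≡ m ∸ n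
eval-monus m n = trans (recNat-ext refl (λ { _ zero → refl ; _ (suc _) → refl }) n) (go n)
  where
  go : ∀ n → recNat m (λ _ → pred) n ≡ m ∸ n
  go zero    = refl
  go (suc n) = trans (cong pred (go n)) (pred[m∸n]≡m∸[1+n] m n)

minᵗ : Tm (nat ∷ nat ∷ []) nat
minᵗ = call monusᵗ (v0 ∷ call monusᵗ (v0 ∷ v1 ∷ []) ∷ [])

eval-min : ∀ m n → eval minᵗ (m ∷ n ∷ []) ≡ m ⊓ n
eval-min m n = trans (cong (λ k → eval monusᵗ (m ∷ k ∷ [])) (eval-monus m n)) (trans (eval-monus m (m ∸ n)) (go (≤-total m n)))
  where
  go : _ → m ∸ (m ∸ n) ≡ m ⊓ n
  go (inj₁ m≤n) = trans (cong (m ∸_) (m≤n⇒m∸n≡0 m≤n)) (sym (m≤n⇒m⊓n≡m m≤n))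
  go (inj₂ n≤m) = trans (m∸[m∸n]≡n n≤m) (sym (m≥n⇒m⊓n≡n n≤m))

inputStr : Maybe Bool → Str
inputStr nothing      = ⌜ 0 ⌝
inputStr (just false) = ⌜ 1 ⌝
inputStr (just true)  = ⌜ 2 ⌝

moveStr : Move → Str
moveStr left  = ⌜ 0 ⌝
moveStr stay  = ⌜ 1 ⌝
moveStr right = ⌜ 2 ⌝

symbolsStr : Vec (Fin 3) k → Str
symbolsStr s = concatMap (λ i → ⌜ toℕ i ⌝) (Vec.toList s)

writesStr : Vec (Fin 3 × Move) k → Str
writesStr ws = concatMap (λ w → ⌜ toℕ (proj₁ w) ⌝ ++ moveStr (proj₂ w)) (Vec.toList ws)

module _ {K : ℕ} where

  -- S is the last state, at which machine cuts off all jump targets.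
  piece : ℕ → ℕ → Instr K → Maybe Bool → Vec (Fin 3) K → Str
  piece S n ins a s = maybe′ (λ t → ⌜ n ⌝ ++ inputStr a ++ symbolsStr s ++ ⌜ t ⊓ S ⌝ ++
    Instr.readsᴵ ins ∷ writesStr (Instr.writesᴵ ins)) [] (Instr.nextᴵ ins a s)

  block : ℕ → ℕ → Instr K → Str
  block S n ins = concatMap (λ a → concatMap (piece S n ins a) (allVecs (allFin 3) K)) inputs

  blocks : ℕ → ℕ → List (Instr K) → Str
  blocks S n []       = []
  blocks S n (i ∷ is) = block S n i ++ blocks S (suc n) is

  blocks-++ : ∀ S n is js → blocks S n (is ++ js) ≡ blocks S n is ++ blocks S (length is + n) js
  blocks-++ S n []       js = refl
  blocks-++ S n (i ∷ is) js = trans (cong (block S n i ++_) (trans (blocks-++ S (suc n) is js)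
      (cong (λ m → blocks S (suc n) is ++ blocks S m js) (+-suc (length is) n))))
    (sym (++-assoc (block S n i) (blocks S (suc n) is) _))

  -- Jump targets are terms because those of the loader depend on `p`; what an instruction writes
  -- enters the code as a literal.
  Targets : List Ty → Set
  Targets Γ = Maybe Bool → Vec (Fin 3) K → Maybe (Tm Γ nat)

  pieceᵗ : Tm Γ nat → Tm Γ nat → Targets Γ → Bool → Vec (Fin 3 × Move) K → Maybe Bool → Vec (Fin 3) K → Tm Γ str
  pieceᵗ S n next b ws a s = maybe′ (λ t → call numeralᵗ (n ∷ []) ⊕ lit (inputStr a) ⊕ lit (symbolsStr s) ⊕
    call numeralᵗ (call minᵗ (t ∷ S ∷ []) ∷ []) ⊕ lit (b ∷ writesStr ws)) ε (next a s)

  blockᵗ : Tm Γ nat → Tm Γ nat → Targets Γ → Bool → Vec (Fin 3 × Move) K → Tm Γ str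
  blockᵗ S n next b ws = concatMapᵗ (λ a → concatMapᵗ (pieceᵗ S n next b ws a) (allVecs (allFin 3) K)) inputs

  module _ (S n : Tm Γ nat) (ins : Instr K) (next : Targets Γ) (ρ : Env Γ)
    (eq : ∀ a s → Maybe.map (λ t → eval t ρ) (next a s) ≡ Instr.nextᴵ ins a s) where
    open Instr ins using (readsᴵ; writesᴵ)

    eval-piece : ∀ a s → eval (pieceᵗ S n next readsᴵ writesᴵ a s) ρ ≡ piece (eval S ρ) (eval n ρ) ins a s
    eval-piece a s with next a s | Instr.nextᴵ ins a s | eq a s
    ... | nothing | _ | refl = refl
    ... | just t  | _ | refl =
      eval-⊕ (call numeralᵗ (n ∷ [])) (lit (inputStr a) ⊕ lit (symbolsStr s) ⊕ cut ⊕ rest) (eval-numeral (eval n ρ))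
        (eval-⊕ (lit (inputStr a)) (lit (symbolsStr s) ⊕ cut ⊕ rest) (eval-lit (inputStr a) ρ)
        (eval-⊕ (lit (symbolsStr s)) (cut ⊕ rest) (eval-lit (symbolsStr s) ρ)
        (eval-⊕ cut rest
          (trans (eval-numeral (eval minᵗ (eval t ρ ∷ eval S ρ ∷ []))) (cong ⌜_⌝ (eval-min (eval t ρ) (eval S ρ))))
          (eval-lit (readsᴵ ∷ writesStr writesᴵ) ρ))))
      where
      cut rest : Tm _ str
      cut = call numeralᵗ (call minᵗ (t ∷ S ∷ []) ∷ [])
      rest   = lit (readsᴵ ∷ writesStr writesᴵ)

    eval-block : eval (blockᵗ S n next readsᴵ writesᴵ) ρ ≡ block (eval S ρ) (eval n ρ) ins
    eval-block = eval-concatMap (λ a → concatMapᵗ (pieceᵗ S n next readsᴵ writesᴵ a) (allVecs (allFin 3) K))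
      (λ a → eval-concatMap (pieceᵗ S n next readsᴵ writesᴵ a) (eval-piece a) (allVecs (allFin 3) K)) inputs

  constant : Instr K → Targets Γ
  constant ins a s = Maybe.map (λ t → add t ze) (Instr.nextᴵ ins a s)

  eval-constant : ∀ ins (ρ : Env Γ) a s → Maybe.map (λ t → eval t ρ) (constant ins a s) ≡ Instr.nextᴵ ins a s
  eval-constant ins ρ a s with Instr.nextᴵ ins a s
  ... | nothing = refl
  ... | just t  = cong just (trans (eval-add t ze ρ) (+-identityʳ t))

  blocksᵗ : Tm Γ nat → ℕ → List (Instr K) → Tm Γ str
  blocksᵗ S n []       = ε
  blocksᵗ S n (i ∷ is) = blockᵗ S (add n ze) (constant i) (Instr.readsᴵ i) (Instr.writesᴵ i) ⊕ blocksᵗ S (suc n) is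

  eval-blocks : ∀ (S : Tm Γ nat) n is ρ → eval (blocksᵗ S n is) ρ ≡ blocks (eval S ρ) n is
  eval-blocks S n []       ρ = refl
  eval-blocks S n (i ∷ is) ρ = eval-⊕ (blockᵗ S (add n ze) (constant i) (Instr.readsᴵ i) (Instr.writesᴵ i)) (blocksᵗ S (suc n) is)
    (trans (eval-block S (add n ze) i (constant i) ρ (eval-constant i ρ))
      (cong (λ m → block (eval S ρ) m i) (trans (eval-add n ze ρ) (+-identityʳ n))))
    (eval-blocks S (suc n) is ρ)

module _ (K : ℕ) (c : Instr (suc K)) (cs : List (Instr (suc K))) where
  private
    M : TM
    M = machine K c cs

  open Encode M

  encInput-inputStr : ∀ a → encInput a ≡ inputStr a
  encInput-inputStr nothing      = refl
  encInput-inputStr (just false) = refl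
  encInput-inputStr (just true)  = refl

  encMove-moveStr : ∀ d → encMove d ≡ moveStr d
  encMove-moveStr left  = refl
  encMove-moveStr stay  = refl
  encMove-moveStr right = refl

  encWrites-writesStr : (ws : Vec (Fin 3 × Move) k) → encVec encWrite ws ≡ writesStr ws
  encWrites-writesStr []             = refl
  encWrites-writesStr ((a , d) ∷ ws) = cong₂ (λ x y → (⌜ toℕ a ⌝ ++ x) ++ y) (encMove-moveStr d) (encWrites-writesStr ws)

  instruction-piece : ∀ q a s → instruction q a s ≡ piece (length cs) (toℕ q) (List.lookup (c ∷ cs) q) a s
  instruction-piece q a s with Instr.nextᴵ (List.lookup (c ∷ cs) q) a s
  ... | nothing = refl
  ... | just t  = cong (⌜ toℕ q ⌝ ++_) (cong₂ _++_ (encInput-inputStr a) (cong (symbolsStr s ++_)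
    (cong₂ (λ x y → ⌜ x ⌝ ++ Instr.readsᴵ (List.lookup (c ∷ cs) q) ∷ y) (toℕ-clamp t)
      (encWrites-writesStr (Instr.writesᴵ (List.lookup (c ∷ cs) q))))))

  concatMap-blocks : ∀ {S n} (F : A → Str) (is : List (Instr (suc K))) (g : Fin (length is) → A) →
    (∀ i → F (g i) ≡ block S (n + toℕ i) (List.lookup is i)) → concatMap F (List.tabulate g) ≡ blocks S n is
  concatMap-blocks         F []       g eq = refl
  concatMap-blocks {S = S} {n} F (i ∷ is) g eq = cong₂ _++_
    (trans (eq zero) (cong (λ m → block S m i) (+-identityʳ n)))
    (concatMap-blocks F is (g ∘ suc) (λ j → trans (eq (suc j)) (cong (λ m → block S m (List.lookup is j)) (+-suc n (toℕ j)))))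

  encode-machine : encode M ≡ ⌜ K ⌝ ++ ⌜ length cs ⌝ ++ ⌜ 2 ⌝ ++ blocks (length cs) 0 (c ∷ cs)
  encode-machine = cong (λ t → ⌜ K ⌝ ++ ⌜ length cs ⌝ ++ ⌜ 2 ⌝ ++ t)
    (concatMap-blocks _ (c ∷ cs) id (λ q → concatMap-cong (λ a → concatMap-cong (instruction-piece q a) (allVecs (allFin 3) (suc K))) inputs))

-- The machine that first writes p on its first stack, letter by letter, and then
-- starts the program at address 1.  The letters are written by the last states,
-- in descending order, so that the states of a suffix of p form an initial segment.
module Loader (K : ℕ) (prog : List (Instr (suc K))) where

  fixed : List (Instr (suc K))
  fixed = prog ++ jumpᴵ 1 ∷ []

  writers : Str → List (Instr (suc K))
  writers []      = []
  writers (b ∷ p) = writers p ++ pushᴵ 0 b (length fixed + length p) ∷ []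

  -- This instruction is state 0, so address `length fixed` is that of `jumpᴵ 1`, where loading
  -- ends, and the target is the writer of the first letter. Each writer jumps to the address just
  -- before its own.
  start : Str → Instr (suc K)
  start p = jumpᴵ (length fixed + length p)

  code : Str → List (Instr (suc K))
  code p = fixed ++ writers p

  loader : Str → TM
  loader p = machine K (start p) (code p)

  length-writers : ∀ p → length (writers p) ≡ length p
  length-writers []      = refl
  length-writers (b ∷ p) = trans (length-++ (writers p)) (trans (+-comm (length (writers p)) 1) (cong suc (length-writers p)))

  length-code : ∀ p → length (code p) ≡ length fixed + length p
  length-code p = trans (length-++ fixed) (cong (length fixed +_) (length-writers p))

  addressᵗ : Tm (str ∷ Γ) nat
  addressᵗ = add (length fixed) (call lengthᵗ (v0 ∷ []))

  eval-address : ∀ p (ρ : Env Γ) → eval addressᵗ (p ∷ ρ) ≡ length fixed + length p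
  eval-address p ρ = trans (eval-add (length fixed) (call lengthᵗ (v0 ∷ [])) (p ∷ ρ)) (cong (length fixed +_) (eval-length p))

  to : Tm Γ nat → Targets {suc K} Γ
  to t _ _ = just t

  writersᵗ : Tm (str ∷ []) str
  writersᵗ = strRec v0 ε (λ b → v1 ⊕
    -- `v2` is the whole of `p` and gives the last state; `v0` is the current suffix and gives the
    -- address.
    blockᵗ (call addressᵗ (v2 ∷ [])) (su (call addressᵗ (v0 ∷ []))) (to (call addressᵗ (v0 ∷ []))) false (only 0 (bit b , right)))

  eval-writers : ∀ p → eval writersᵗ (p ∷ []) ≡ blocks (length fixed + length p) (suc (length fixed)) (writers p)
  eval-writers p = go p
    where
    S : ℕ
    S = length fixed + length p
    emit : Bool → Str → Str → Str
    emit b w r = eval {Γ = str ∷ str ∷ str ∷ []} (v1 ⊕ blockᵗ (call addressᵗ (v2 ∷ [])) (su (call addressᵗ (v0 ∷ [])))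
      (to (call addressᵗ (v0 ∷ []))) false (only 0 (bit b , right))) (w ∷ r ∷ p ∷ [])
    go : ∀ w → recStr [] emit w ≡ blocks S (suc (length fixed)) (writers w)
    go []      = refl
    go (b ∷ w) = begin
      emit b w (recStr [] emit w)
        ≡⟨ eval-⊕ v1 (blockᵗ (call addressᵗ (v2 ∷ [])) (su (call addressᵗ (v0 ∷ [])))
             (to (call addressᵗ (v0 ∷ []))) false (only 0 (bit b , right))) (go w)
             (trans (eval-block (call addressᵗ (v2 ∷ [])) (su (call addressᵗ (v0 ∷ []))) ins (to (call addressᵗ (v0 ∷ [])))
                      (w ∷ recStr [] emit w ∷ p ∷ []) (λ a s → cong just (eval-address w [])))
               (cong₂ (λ S n → block S (suc n) ins) (eval-address p []) (eval-address w []))) ⟩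
      blocks S (suc (length fixed)) (writers w) ++ block S (suc (length fixed + length w)) ins
        ≡⟨ cong (blocks S (suc (length fixed)) (writers w) ++_) (trans
             (cong (λ n → block S n ins) (trans (cong suc (+-comm (length fixed) (length w)))
               (trans (sym (+-suc (length w) (length fixed))) (cong (_+ suc (length fixed)) (sym (length-writers w))))))
             (sym (++-identityʳ _))) ⟩
      blocks S (suc (length fixed)) (writers w) ++ blocks S (length (writers w) + suc (length fixed)) (ins ∷ [])
        ≡⟨ sym (blocks-++ S (suc (length fixed)) (writers w) (ins ∷ [])) ⟩
      blocks S (suc (length fixed)) (writers (b ∷ w)) ∎
      where
      open ≡-Reasoning
      ins : Instr (suc K)
      ins = pushᴵ 0 b (length fixed + length w)

  encodeᵗ : Tm (str ∷ []) str
  encodeᵗ = lit ⌜ K ⌝ ⊕ call numeralᵗ (addressᵗ ∷ []) ⊕ lit ⌜ 2 ⌝ ⊕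
    blockᵗ addressᵗ ze (to addressᵗ) false idle ⊕ blocksᵗ addressᵗ 1 fixed ⊕ writersᵗ

  eval-encode : ∀ p → eval encodeᵗ (p ∷ []) ≡ encode (loader p)
  eval-encode p = trans
    (eval-⊕ (lit ⌜ K ⌝) (states ⊕ lit ⌜ 2 ⌝ ⊕ first ⊕ main ⊕ writersᵗ) (eval-lit ⌜ K ⌝ ρ)
    (eval-⊕ states (lit ⌜ 2 ⌝ ⊕ first ⊕ main ⊕ writersᵗ) (trans (eval-numeral (eval addressᵗ ρ)) (cong ⌜_⌝ S≡))
    (eval-⊕ (lit ⌜ 2 ⌝) (first ⊕ main ⊕ writersᵗ) (eval-lit ⌜ 2 ⌝ ρ)
    (eval-⊕ first (main ⊕ writersᵗ)
      (trans (eval-block addressᵗ ze (start p) (to addressᵗ) ρ (λ a s → cong just (eval-address p [])))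
        (cong (λ S → block S 0 (start p)) S≡))
    (eval-⊕ main writersᵗ
      (trans (eval-blocks addressᵗ 1 fixed ρ) (cong (λ S → blocks S 1 fixed) S≡))
      (trans (eval-writers p) (cong₂ (λ S n → blocks S n (writers p)) (sym (length-code p)) (+-comm 1 (length fixed)))))))))
    (trans (cong (λ t → ⌜ K ⌝ ++ ⌜ length (code p) ⌝ ++ ⌜ 2 ⌝ ++ block (length (code p)) 0 (start p) ++ t)
        (sym (blocks-++ (length (code p)) 1 fixed (writers p))))
      (sym (encode-machine K (start p) (code p))))
    where
    ρ : Env (str ∷ [])
    ρ = p ∷ []
    states first main : Tm (str ∷ []) str
    states = call numeralᵗ (addressᵗ ∷ [])
    first  = blockᵗ addressᵗ ze (to addressᵗ) false idle
    main   = blocksᵗ addressᵗ 1 fixed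
    S≡ : eval addressᵗ ρ ≡ length (code p)
    S≡ = trans (eval-address p []) (sym (length-code p))

  module _ (p : Str) where
    open Simulation K (start p) (code p)

    jump-segment : Code (length fixed) (jumpᴵ 1 ∷ [])
    jump-segment = start p ∷ prog , writers p , cong (start p ∷_) (++-assoc prog (jumpᴵ 1 ∷ []) (writers p)) ,
      trans (length-++ prog) (+-comm (length prog) 1)

    prog-segment : Code 1 prog
    prog-segment = start p ∷ [] , jumpᴵ 1 ∷ writers p , cong (start p ∷_) (++-assoc prog (jumpᴵ 1 ∷ []) (writers p)) , refl

    writers-segment : Code (suc (length fixed)) (writers p)
    writers-segment = start p ∷ fixed , [] , cong (λ l → start p ∷ fixed ++ l) (sym (++-identityʳ (writers p))) , refl

    load : ∀ w → Code (suc (length fixed)) (writers w) → ∀ {σ u} →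
           Halts 1 (σ [ 0 ≔ w ʳ++ σ 0 ]) u → Halts (length fixed + length w) σ u
    load [] seg {σ} {u} h = at-address′ (halts-jump {length fixed} {1} {σ} {u} (segment-lookup {pc = length fixed} jump-segment)
      (Halts-cong {1} {σ} {σ [ 0 ≔ [] ʳ++ σ 0 ]} {u} (λ { zero → refl ; (suc _) → refl }) h))
      where
      at-address′ : Halts (length fixed) σ u → Halts (length fixed + 0) σ u
      at-address′ = subst (λ pc → Halts pc σ u) (sym (+-identityʳ (length fixed)))
    load (b ∷ w) seg {σ} {u} h with segment-++ (writers w) seg
    ... | segʷ , segᵇ = subst (λ pc → Halts pc σ u) (sym (+-suc (length fixed) (length w)))
      (halts-push {suc (length fixed + length w)} {0} {b} {length fixed + length w} {σ} {u}
        (segment-lookup {pc = suc (length fixed + length w)}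
          (code-address (cong (λ n → suc (length fixed + n)) (length-writers w)) segᵇ))
        (load w segʷ {σ [ 0 ≔ b ∷ σ 0 ]} {u} (Halts-cong {1} {σ [ 0 ≔ b ∷ σ 0 ] [ 0 ≔ w ʳ++ (b ∷ σ 0) ]} {σ [ 0 ≔ (b ∷ w) ʳ++ σ 0 ]} {u} (λ { zero → refl ; (suc _) → refl }) h)))

    loader-stops : ∀ x → Halts 1 ((λ _ → []) [ 0 ≔ p ʳ++ [] ]) (nothing , x) → loader p StopsAt x
    loader-stops x h = halts-jump {0} {length fixed + length p} {λ _ → []} {nothing , x} refl
      (load p writers-segment {λ _ → []} {nothing , x} h) _ blank
      where
      blank : Represents (λ _ → []) (Vec.replicate (suc K) (Run.blankTape (loader p)))
      blank i = cong Tape.before (lookup-replicate i (Run.blankTape (loader p)))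

reverseStrᵗ : Tm (str ∷ []) str
reverseStrᵗ = strRec v0 ε (λ b → v1 ⊕ lit (b ∷ []))

eval-reverseStr : ∀ s → eval reverseStrᵗ (s ∷ []) ≡ reverse s
eval-reverseStr s = trans (recStr-cong {f = id} refl (λ b _ r → eval-append r (b ∷ [])) s) (go s)
  where
  go : ∀ s → recStr [] (λ b _ r → r ++ b ∷ []) s ≡ reverse s
  go []      = refl
  go (b ∷ s) = trans (cong (_++ b ∷ []) (go s)) (sym (unfold-reverse b s))

-- Machines from description modes

-- This amounts to `s` being empty exactly if `u` is, which is all that decides whether another
-- letter is read.
Extends : Str → Str → Set
Extends []      s = s ≡ []
Extends (_ ∷ _) s = ∃₂ λ b w → s ≡ b ∷ w

-- `g` works on reversed words because letters pushed one after the other end up in reverse order.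
module Machines (Describes : Str → Str → Str → Set) (g : Rec 2)
  (g⇓ : ∀ p xʳ u → Describes p (xʳ ʳ++ u) (xʳ ʳ++ u) → ∃ λ s → g ⟨ xʳ ∷ reverse p ∷ [] ⟩⇓ s × Extends u s) where

  -- Stack 0 holds the reversed description and stack 1 the input read so far,
  -- in reversed order; stack 2 tells whether another letter has to be read.
  main : Prog
  main = push 2 true ⨾ loop 2 (λ first → (if first then nop else read 1) ⨾ muBody g (0 ∷ []) 1)

  private
    mainLoop : Prog
    mainLoop = loop 2 (λ first → (if first then nop else read 1) ⨾ muBody g (0 ∷ []) 1)

  module _ (p : Str) where
    private
      ρ : Store
      ρ = (λ _ → []) [ 0 ≔ reverse p ]

    args : Args 1 ρ (0 ∷ []) (reverse p ∷ [])
    args zero = s≤s z≤n , refl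

    body : ∀ {xʳ s} → g ⟨ xʳ ∷ reverse p ∷ [] ⟩⇓ s →
           Triple 1 ρ (nth (xʳ ∷ [])) (muBody g (0 ∷ []) 1) (nth (xʳ ∷ flag s [] ∷ []))
    body d = muBodyᵗ {f = g} args (program-correct d (1 ∷ 0 ∷ []) 3)

    -- Induction on the unread input `u`: a nonempty value of `g` raises the flag and makes the loop
    -- read one letter, an empty value ends it without an attempt to read.
    mainLoop-runs : ∀ u xʳ a {σ} → Describes p (xʳ ʳ++ u) (xʳ ʳ++ u) → Shape 1 ρ (nth (xʳ ∷ [])) σ →
      ∃₂ λ σ′ a′ → muBody g (0 ∷ []) 1 ⨾ mainLoop ∶ σ , (a , u) ⇒ σ′ , (a′ , [])
    mainLoop-runs u xʳ a d sh with g⇓ p xʳ u d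
    mainLoop-runs [] xʳ a d sh | .[] , d⇓ , refl with body d⇓ sh
    ... | σ′ , r , (_ , hi) = σ′ , a , (r ⨾ loop-[] (hi 1))
    mainLoop-runs (b ∷ u) xʳ a d sh | .(_ ∷ _) , d⇓ , (_ , _ , refl) with body d⇓ sh
    ... | σ₁ , r , sh₁@(_ , hi)
      with Shape-cong (λ { 0 → cong (b ∷_) (hi 0) ; 1 → refl ; (suc (suc _)) → refl }) (Shape-update 0 (b ∷ σ₁ 1) (Shape-update 1 [] sh₁))
    ... | sh₂ with mainLoop-runs u (b ∷ xʳ) (just b) d sh₂
    ... | σ′ , a′ , (r₁ ⨾ r₂) = σ′ , a′ , (r ⨾ loop-∷ (hi 1) ((read ⨾ r₁) ⨾ r₂))

  open Loader (height main) (assemble main 1 ++ stopᴵ ∷ []) public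

  loader-stopsAt : ∀ {p x} → Describes p x x → loader p StopsAt x
  loader-stopsAt {p} {x} d
    with mainLoop-runs p x [] nothing {(λ _ → []) [ 0 ≔ reverse p ] [ 2 ≔ true ∷ [] ] [ 2 ≔ [] ]} d
           ((λ { zero _ → refl ; (suc _) (s≤s ()) }) , λ { 0 → refl ; 1 → refl ; (suc (suc _)) → refl })
  ... | σ , a , (r ⨾ r′) = loader-stops p x (run-halts {main} (push ⨾ loop-∷ refl ((nop ⨾ r) ⨾ r′)) {1} (n≤1+n _) (proj₁ segments)
      (halts-stop {1 + size main} {σ} {a} (segment-lookup {pc = 1 + size main} (proj₂ segments))))
    where
    open Simulation (height main) (start p) (code p)
    segments : Code 1 (assemble main 1) × Code (1 + size main) (stopᴵ ∷ [])
    segments = code-++ {1} main (prog-segment p)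

  -- The first variable is a dummy: the relation is decidable, and `search` only brings it into the
  -- form of a domain.
  graphᵗ : Tm (str ∷ str ∷ str ∷ []) bool
  graphᵗ = call eqStrᵗ (v2 ∷ call encodeᵗ (v1 ∷ []) ∷ [])

  loaderDecompressor : Decompressor
  loaderDecompressor = record
    { Describes  = λ p y → y ≡ encode (loader p)
    ; enumerable = search graphᵗ , λ { (p ∷ y ∷ []) → mk⇔
        (λ eq → Equivalence.to (search-⇔ graphᵗ (p ∷ y ∷ [])) ([] ,
          trans (cong (λ z → eval eqStrᵗ (z ∷ eval encodeᵗ (p ∷ []) ∷ [])) (trans eq (sym (eval-encode p))))
                (eqStr-complete (eval encodeᵗ (p ∷ [])))))
        (λ d → trans (eqStr-sound y _ (proj₂ (Equivalence.from (search-⇔ graphᵗ (p ∷ y ∷ [])) d))) (eval-encode p)) }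
    ; functional = λ eq eq′ → trans eq (sym eq′)
    }

module _ (D : DescriptionMode) where
  open DescriptionMode D

  private
    f : Rec 3
    f = proj₁ enumerable

  -- On the reversed words x and p, searches for an extension z of x such that D
  -- describes z from p given z; the search word splits into a time bound and z - x.
  candidateᵗ : Tm (str ∷ str ∷ []) str
  candidateᵗ = call reverseStrᵗ (v1 ∷ []) ⊕ snd (call splitᵗ (v0 ∷ []))

  selfᵗ : Tm (nat ∷ str ∷ str ∷ []) bool
  selfᵗ = optCase (call (bounded f) (v0 ∷ cons v1 (cons v2 (cons v2 nil)) ∷ [])) ff tt

  extensionᵗ : Tm (str ∷ str ∷ str ∷ []) bool
  extensionᵗ = call selfᵗ (fst (call splitᵗ (v0 ∷ [])) ∷ call reverseStrᵗ (v2 ∷ []) ∷ call candidateᵗ (v0 ∷ v1 ∷ []) ∷ [])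

  -- `search` returns an index; this extracts the continuation from the search word with that index.
  suffixᵗ : Tm (nat ∷ []) str
  suffixᵗ = snd (call splitᵗ (call nthStrᵗ (v0 ∷ []) ∷ []))

  extension : Rec 2
  extension = comp (codeᵀ (compile suffixᵗ)) (search extensionᵗ ∷ [])

  self : ℕ → Str → Str → Bool
  self k p z = maybe′ (λ _ → true) false (run f k (p ∷ z ∷ z ∷ []))

  self-sound : ∀ k p z → self k p z ≡ true → Describes p z z
  self-sound k p z eq with run f k (p ∷ z ∷ z ∷ []) in e
  ... | just r = Equivalence.from (proj₂ enumerable (p ∷ z ∷ z ∷ [])) (r , run-sound f k (p ∷ z ∷ z ∷ []) e)

  self-complete : ∀ p z → Describes p z z → ∃ λ k → self k p z ≡ true
  self-complete p z d with Equivalence.to (proj₂ enumerable (p ∷ z ∷ z ∷ [])) d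
  ... | r , d⇓ with run-complete d⇓
  ... | K , eq = K , cong (maybe′ (λ _ → true) false) (eq K ≤-refl)

  eval-extension : ∀ s xʳ pʳ → eval extensionᵗ (s ∷ xʳ ∷ pʳ ∷ []) ≡
    self (proj₁ (split s)) (reverse pʳ) (reverse xʳ ++ proj₂ (split s))
  eval-extension s xʳ pʳ = cong₂ (self (proj₁ (split s))) (eval-reverseStr pʳ)
    (eval-⊕ (call reverseStrᵗ (v1 ∷ [])) (snd (call splitᵗ (v0 ∷ []))) {ρ = s ∷ xʳ ∷ []} (eval-reverseStr xʳ) refl)

  suffix : Str → Str
  suffix s = proj₂ (split s)

  suffix⇓ : ∀ i → codeᵀ (compile suffixᵗ) ⟨ replicate i false ∷ [] ⟩⇓ suffix (nthStr i)
  suffix⇓ i = subst (codeᵀ (compile suffixᵗ) ⟨ replicate i false ∷ [] ⟩⇓_) (cong suffix (eval-nthStr i))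
    (compile⇓ suffixᵗ (i ∷ []))

  extension-finds : ∀ xʳ pʳ → (∃ λ s → eval extensionᵗ (s ∷ xʳ ∷ pʳ ∷ []) ≡ true) →
    ∃ λ s → (extension ⟨ xʳ ∷ pʳ ∷ [] ⟩⇓ suffix s) × eval extensionᵗ (s ∷ xʳ ∷ pʳ ∷ []) ≡ true
  extension-finds xʳ pʳ hit = let i , d , eq = search⇓ extensionᵗ (xʳ ∷ pʳ ∷ []) hit in
    nthStr i , ⇓comp (d ∷ []) (suffix⇓ i) , eq

  self-hit : ∀ p xʳ u → Describes p (reverse xʳ ++ u) (reverse xʳ ++ u) →
             ∃ λ s → eval extensionᵗ (s ∷ xʳ ∷ reverse p ∷ []) ≡ true
  self-hit p xʳ u d with self-complete p (reverse xʳ ++ u) d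
  ... | j , eq = (⌜ j ⌝ ++ u) , trans (eval-extension (⌜ j ⌝ ++ u) xʳ (reverse p))
    (trans (cong₂ (λ sp q → self (proj₁ sp) q (reverse xʳ ++ proj₂ sp)) (split-⌜⌝ j u) (reverse-involutive p)) eq)

  self-found : ∀ p xʳ s → eval extensionᵗ (s ∷ xʳ ∷ reverse p ∷ []) ≡ true →
               Describes p (reverse xʳ ++ suffix s) (reverse xʳ ++ suffix s)
  self-found p xʳ s eq = self-sound (proj₁ (split s)) p (reverse xʳ ++ suffix s)
    (trans (cong (λ q → self (proj₁ (split s)) q (reverse xʳ ++ suffix s)) (sym (reverse-involutive p)))
      (trans (sym (eval-extension s xʳ (reverse p))) eq))

  prefix-[] : ∀ (x : Str) v → Prefix _≡_ (x ++ []) (x ++ v)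
  prefix-[] []      v = []
  prefix-[] (_ ∷ x) v = refl ∷ prefix-[] x v

  -- Prefix-freeness: if one of the two words were a proper prefix of the other, monotonicity would
  -- make `p` describe both given the longer one, against functionality.
  extends : ∀ p x u s → Describes p (x ++ s) (x ++ s) → Describes p (x ++ u) (x ++ u) → Extends u s
  extends p x []      s       e d = ++-cancelˡ x s [] (functional e (monotone (prefix-[] x s) d))
  extends p x (b ∷ u) (c ∷ s) e d = c , s , refl
  extends p x (b ∷ u) []      e d = case ++-cancelˡ x [] (b ∷ u) (functional (monotone (prefix-[] x (b ∷ u)) e) d) of λ ()

  -- The search may find an extension other than u, but since the words that D
  -- describes from p given themselves are prefix-free, it is empty only if u is.
  extension⇓ : ∀ p xʳ u → Describes p (xʳ ʳ++ u) (xʳ ʳ++ u) →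
    ∃ λ s → extension ⟨ xʳ ∷ reverse p ∷ [] ⟩⇓ s × Extends u s
  extension⇓ p xʳ u d =
    let d′ = subst (λ z → Describes p z z) (ʳ++-defn xʳ) d
        s , d⇓ , eq = extension-finds xʳ (reverse p) (self-hit p xʳ u d′)
    in suffix s , d⇓ , extends p (reverse xʳ) u (suffix s) (self-found p xʳ s eq) d′

machines : (D : DescriptionMode) → ∃ λ (V : Decompressor) → ∀ p x → DescriptionMode.Describes D p x x →
  ∃ λ M → M StopsAt x × Decompressor.Describes V p (encode M)
machines D = loaderDecompressor , λ p x d → loader p , loader-stopsAt {p} {x} d , refl
  where open Machines (DescriptionMode.Describes D) (extension D) (extension⇓ D)

-- Comparison with this mode bounds the complexity of each word, so that a minimal description
-- exists.
identityMode : DescriptionMode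
identityMode = record
  { Describes  = λ p _ y → p ≡ y
  ; enumerable = search sameᵗ , λ { (p ∷ x ∷ y ∷ []) → mk⇔
      (λ { refl → Equivalence.to (search-⇔ sameᵗ (p ∷ x ∷ p ∷ [])) ([] , eqStr-complete p) })
      (λ d → eqStr-sound p y (proj₂ (Equivalence.from (search-⇔ sameᵗ (p ∷ x ∷ y ∷ [])) d))) }
  ; functional = λ eq eq′ → trans (sym eq) eq′
  ; monotone   = λ _ eq → eq
  }
  where
  sameᵗ : Tm (str ∷ str ∷ str ∷ str ∷ []) bool
  sameᵗ = call eqStrᵗ (v1 ∷ v3 ∷ [])

-- Comparison of the two complexities

infixl 1 _>>=_

_>>=_ : {A B : Set} → ¬ ¬ A → (A → ¬ ¬ B) → ¬ ¬ B
(a >>= f) k = a (λ x → f x k)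

-- The least number principle by descent: without a minimum every element has a smaller one. The
-- bound `b` makes the descent structural.
min-exists : {P : ℕ → Set} → ∀ {n} → P n → ¬ ¬ ∃ λ m → IsMin P m × m ≤ n
min-exists {P} {n} = go n ≤-refl
  where
  go : ∀ b {n} → n ≤ b → P n → ¬ ¬ ∃ λ m → IsMin P m × m ≤ n
  go b {n} n≤b pn ¬min = ¬min (n , (pn , λ m pm → ≮⇒≥ (λ m<n → smaller b n≤b m<n pm)) , ≤-refl)
    where
    smaller : ∀ b → n ≤ b → ∀ {m} → m < n → P m → _
    smaller zero    n≤0 m<n pm = case ≤-trans m<n n≤0 of λ ()
    smaller (suc b) n≤b m<n pm = go b (≤-pred (≤-trans m<n n≤b)) pm
      (λ { (k , min , k≤m) → ¬min (k , min , ≤-trans k≤m (<⇒≤ m<n)) })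

-- Any element of `Q` will do, since up to double negation there is a minimum below it.
min≤⇒ : {P Q : ℕ → Set} {c n : ℕ} → min P ≤min Q + c → Q n → ¬ ¬ ∃ λ m → IsMin P m × m ≤ n + c
min≤⇒ {c = c} le qn = min-exists qn >>= λ { (k , min , k≤n) → le k min >>= λ { (m , min′ , m≤k+c) k′ →
  k′ (m , min′ , ≤-trans m≤k+c (+-monoˡ-≤ c k≤n)) } }

∣-∣≤ : ∀ {m n c d} → m ≤ n + c → n ≤ m + d → ∣ m - n ∣ ≤ c + d
∣-∣≤ {m} {n} {c} {d} m≤ n≤ with ≤-total m n
... | inj₁ m≤n rewrite m≤n⇒∣m-n∣≡n∸m m≤n = ≤-trans (m≤n+o⇒m∸n≤o n m n≤) (m≤n+m d c)
... | inj₂ n≤m rewrite m≤n⇒∣n-m∣≡n∸m n≤m = ≤-trans (m≤n+o⇒m∸n≤o m n m≤) (m≤m+n c d)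

comparison : (D : DescriptionMode) (U V : Decompressor) {b c d : ℕ} →
  (∀ p x → DescriptionMode.Describes D p x x → ∃ λ M → M StopsAt x × Decompressor.Describes V p (encode M)) →
  (∀ y x → min DescriptionMode.Lengths D y x ≤min DescriptionMode.Lengths identityMode y x + b) →
  (∀ y x → min DescriptionMode.Lengths D y x ≤min DescriptionMode.Lengths (stoppingMode U) y x + c) →
  (∀ y → min Decompressor.Lengths U y ≤min Decompressor.Lengths V y + d) →
  ∀ x →
  (¬ ¬ ∃ λ m → DescriptionMode.C D x x m) ×
  (¬ ¬ ∃ λ n → StoppingTime U x n) ×
  (∀ m n → DescriptionMode.C D x x m → StoppingTime U x n → ∣ m - n ∣ ≤ c + d)
comparison D U V {b} {c} {d} machine identity≤ stopping≤ V≤ x =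
    C-exists
  , (C-exists >>= λ { (m , min) → stopping-exists m min >>= λ { (n , min′ , _) k → k (n , min′) } })
  -- An inequality between numbers is decidable, hence stable, and the double negations can be
  -- removed.
  , λ m n minC minT → decidable-stable (_ ≤? _) (
      stopping-exists m minC >>= λ { (n′ , minT′ , n′≤m+d) →
      C-bound n minT >>= λ { (m′ , minC′ , m′≤n+c) k →
      k (∣-∣≤ (≤-trans (proj₂ minC m′ (proj₁ minC′)) m′≤n+c) (≤-trans (proj₂ minT n′ (proj₁ minT′)) n′≤m+d)) } })
  where
  C-exists : ¬ ¬ ∃ λ m → DescriptionMode.C D x x m
  C-exists = min≤⇒ (identity≤ x x) (x , refl , refl) >>= λ { (m , min , _) k → k (m , min) }

  stopping-exists : ∀ m → DescriptionMode.C D x x m → ¬ ¬ ∃ λ n → StoppingTime U x n × n ≤ m + d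
  stopping-exists m ((p , len , describes) , _) =
    let M , stops , d = machine p x describes in
    min≤⇒ (V≤ (encode M)) (p , len , d) >>= λ { (k , K , k≤m+d) →
    min-exists (M , stops , K) >>= λ { (n , min , n≤k) found →
    found (n , min , ≤-trans n≤k k≤m+d) } }

  C-bound : ∀ n → StoppingTime U x n → ¬ ¬ ∃ λ m → DescriptionMode.C D x x m × m ≤ n + c
  C-bound n ((M , stops , ((p , len , describes) , _)) , _) =
    min≤⇒ (stopping≤ x x) (p , len , stops⇒described U describes stops)

theorem3 : (D : DescriptionMode) → Optimal D →
    (U : Decompressor) → OptimalDecompressor U →
    ∃ λ (c : ℕ) → ∀ (x : Str) →
    (¬ ¬ ∃ λ m → DescriptionMode.C D x x m) ×
    (¬ ¬ ∃ λ n → StoppingTime U x n) ×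
    (∀ m n → DescriptionMode.C D x x m → StoppingTime U x n → ∣ m - n ∣ ≤ c)
theorem3 D optimalD U optimalU =
  let V , machine  = machines D
      _ , identity≤ = optimalD identityMode
      c , stopping≤ = optimalD (stoppingMode U)
      d , V≤        = optimalU V
  in c + d , comparison D U V machine identity≤ stopping≤ V≤
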